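{- Every flotilla-galaxy $H$ satisfies the Erdős–Hajnal Conjecture: there exists $\epsilon(H)>0$ such that every $H$-free tournament $T$ with $n$ vertices contains a transitive subtournament with at least $n^{\epsilon(H)}$ vertices.
   Context: A tournament is a digraph in which for every pair of distinct vertices $u,v$ exactly one of the arcs $(u,v),(v,u)$ is present; it is transitive if it has no directed cycle. A tournament $T$ contains $H$ if $H$ is isomorphic to the subtournament of $T$ induced by some vertex subset; otherwise $T$ is $H$-free. Let $\theta=(v_1,\dots,v_n)$ be an ordering of the vertices of a tournament $T$. An arc $(v_i,v_j)$ is backward under $\theta$ if $i>j$. The graph of backward arcs $B(T,\theta)$ is the undirected graph on $V(T)$ in which $v_iv_j$ is an edge iff $(v_i,v_j)$ or $(v_j,v_i)$ is a backward arc. A vertex $v_j$ is between $v_i$ and $v_k$ if $i<j<k$ or $k<j<i$. A left boat in $B(T,\theta)$ is a set $\{v_{i_1},v_{i_2},v_{i_3},v_{i_4}\}$ with $i_1<i_2<i_3<i_4$ and $i_3=i_2+1=i_1+2$ such that the subgraph of $B(T,\theta)$ induced on it has exactly the edges $v_{i_1}v_{i_3}$, $v_{i_1}v_{i_4}$, $v_{i_2}v_{i_4}$ (this is the graph of backward arcs of the 4-vertex tournament "boat" with arcs $y\to x, y\to u, v\to x, x\to u, u\to v, v\to y$ under the ordering $(x,u,v,y)$). A right boat is defined in the same way except that instead $i_4=i_3+1=i_2+2$ (i.e. $v_{i_2},v_{i_3},v_{i_4}$ are consecutive in $\theta$). A right star in $B(T,\theta)$ is a set $\{v_{i_0},\dots,v_{i_t}\}$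 ($t\ge1$) inducing in $B(T,\theta)$ a star $K_{1,t}$ with center $v_{i_t}$, where $i_t>i_0,\dots,i_{t-1}$; a left star is such a set inducing a star with center $v_{i_0}$, where $i_0<i_1,\dots,i_t$; the other vertices are leaves (when $t=1$ either vertex may be designated the center). A star is a left star or a right star. A tournament $T$ is a flotilla-galaxy if there is an ordering $\theta$ of $V(T)$ such that every connected component of $B(T,\theta)$ is a star, a singleton, a left boat or a right boat, and moreover: no center of a star is between two leaves of another star, and no vertex of a left boat or of a right boat is between two leaves of a star. -}

module Defs where

open import Data.Nat using (ℕ; suc; _^_) renaming (_≤_ to _≤ℕ_; _<_ to _<ℕ_)
open import Data.Fin using (Fin; zero; suc; toℕ; inject₁; fromℕ; _<_)
open import Data.Bool using (Bool; true; false; not)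
open import Data.Product using (Σ; _×_; _,_; ∃)
open import Data.Sum using (_⊎_)
open import Relation.Nullary using (¬_)
open import Relation.Binary.PropositionalEquality using (_≡_; _≢_)
open import Function.Definitions using (Injective)

record Tournament (n : ℕ) : Set where
  field
    arc    : Fin n → Fin n → Bool
    irrefl : ∀ i → arc i i ≡ false
    tourn  : ∀ i j → i ≢ j → arc i j ≡ not (arc j i)

open Tournament public

Contains : ∀ {n h} → Tournament n → Tournament h → Set
Contains {n} {h} T H =
  Σ (Fin h → Fin n) λ f → Injective _≡_ _≡_ f × (∀ i j → arc T (f i) (f j) ≡ arc H i j)

HasDirectedCycle : ∀ {k} → (Fin k → Fin k → Bool) → Set
HasDirectedCycle {k} a =
  Σ ℕ λ l → Σ (Fin (suc (suc l)) → Fin k) λ c →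
    Injective _≡_ _≡_ c ×
    (∀ (i : Fin (suc l)) → a (c (inject₁ i)) (c (suc i)) ≡ true) ×
    a (c (fromℕ (suc l))) (c zero) ≡ true

HasTransitiveSub : ∀ {n} → Tournament n → ℕ → Set
HasTransitiveSub {n} T k =
  Σ (Fin k → Fin n) λ f → Injective _≡_ _≡_ f ×
    ¬ HasDirectedCycle (λ i j → arc T (f i) (f j))

-- Flotilla-galaxies.
-- An ordering θ of V(H) is a bijection σ : Fin h → Fin h (position ↦ vertex);
-- we work with positions, so v_p = σ p.

module _ {h : ℕ} (H : Tournament h) (σ : Fin h → Fin h) where

  -- p q adjacent in the graph of backward arcs B(H, θ)
  Edge : Fin h → Fin h → Set
  Edge p q = (p < q × arc H (σ q) (σ p) ≡ true) ⊎ (q < p × arc H (σ p) (σ q) ≡ true)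

  Between : Fin h → Fin h → Fin h → Set
  Between x y z = (x < y × y < z) ⊎ (z < y × y < x)

  BoatEdges : Fin h → Fin h → Fin h → Fin h → Set
  BoatEdges a b c d =
    Edge a c × Edge a d × Edge b d × ¬ Edge a b × ¬ Edge b c × ¬ Edge c d

  LeftBoat : Fin h → Fin h → Fin h → Fin h → Set
  LeftBoat a b c d =
    toℕ b ≡ suc (toℕ a) × toℕ c ≡ suc (toℕ b) × c < d × BoatEdges a b c d

  RightBoat : Fin h → Fin h → Fin h → Fin h → Set
  RightBoat a b c d =
    a < b × toℕ c ≡ suc (toℕ b) × toℕ d ≡ suc (toℕ c) × BoatEdges a b c d

  data Role : Set where
    single center leaf boat : Role

  -- A decomposition of the positions into classes (labelled by lab) with
  -- designated roles, such that the classes are exactly the connected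
  -- components of B(H, θ) (no edges between classes, each class induces a
  -- connected graph of the prescribed shape), and the flotilla-galaxy
  -- betweenness conditions hold.
  record FGDecomposition : Set where
    field
      lab  : Fin h → ℕ
      role : Fin h → Role
      edge-inside : ∀ p q → Edge p q → lab p ≡ lab q
      single-ok : ∀ p → role p ≡ single → ∀ q → lab q ≡ lab p → q ≡ p
      center-ok : ∀ p → role p ≡ center →
        (Σ (Fin h) λ q → q ≢ p × lab q ≡ lab p) ×
        (∀ q → lab q ≡ lab p → q ≢ p → role q ≡ leaf × Edge p q) ×
        (∀ q r → lab q ≡ lab p → lab r ≡ lab p → q ≢ p → r ≢ p → ¬ Edge q r) ×
        ((∀ q → lab q ≡ lab p → q ≢ p → q < p) ⊎
         (∀ q → lab q ≡ lab p → q ≢ p → p < q))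
      leaf-ok : ∀ q → role q ≡ leaf → Σ (Fin h) λ p → role p ≡ center × lab p ≡ lab q
      boat-ok : ∀ p → role p ≡ boat →
        Σ (Fin h) λ a → Σ (Fin h) λ b → Σ (Fin h) λ c → Σ (Fin h) λ d →
          (lab a ≡ lab p × lab b ≡ lab p × lab c ≡ lab p × lab d ≡ lab p) ×
          (∀ q → lab q ≡ lab p → q ≡ a ⊎ q ≡ b ⊎ q ≡ c ⊎ q ≡ d) ×
          (LeftBoat a b c d ⊎ RightBoat a b c d)
      no-center-between : ∀ c l₁ l₂ → role c ≡ center → role l₁ ≡ leaf → role l₂ ≡ leaf →
        lab l₁ ≡ lab l₂ → lab c ≢ lab l₁ → ¬ Between l₁ c l₂
      no-boat-between : ∀ v l₁ l₂ → role v ≡ boat → role l₁ ≡ leaf → role l₂ ≡ leaf →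
        lab l₁ ≡ lab l₂ → ¬ Between l₁ v l₂

FlotillaGalaxy : ∀ {h} → Tournament h → Set
FlotillaGalaxy {h} H =
  Σ (Fin h → Fin h) λ σ → Injective _≡_ _≡_ σ × FGDecomposition H σ

-- Erdős–Hajnal property with exponent ε = p / q (p, q > 0):
-- every H-free n-vertex tournament has a transitive subtournament on
-- k vertices with k ≥ n ^ (p/q), i.e. n ^ p ≤ k ^ q.
EHWithExponent : ∀ {h} → Tournament h → ℕ → ℕ → Set
EHWithExponent H p q =
  ∀ (n : ℕ) (T : Tournament n) → ¬ Contains T H →
    Σ ℕ λ k → n ^ p ≤ℕ k ^ q × HasTransitiveSub T k

{-# OPTIONS --safe #-}

-- Let T be a minimal counterexample for the exponent 1 / Q with Q huge: the chains of T (transitive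
-- sets, listed in their order) have at most τ < n^(1/Q) vertices, while smaller tournaments inside T
-- satisfy the bound. Then no chain of length proportional to τ is complete to or from a set of size
-- proportional to n, because the chains of the two could be concatenated.
--
-- Since H is absent, a greedy embedding of H gets stuck at two large sets with few backward arcs
-- between them; iterating this gives sets F 0, F 1, … of proportional size, some of them replaced by
-- chains, such that few arcs go backward. H is then embedded one component at a time. The leaves of a
-- star go to consecutive pieces of one chain; if no vertex is a possible center, then by pigeonhole
-- many vertices are complete to one piece, a contradiction.
--
-- For a left boat the three consecutive vertices go to one set M and the last vertex to a set D, so
-- that one needs d in D and a cyclic triangle in M with exactly two vertices in the set P(d) of
-- backward neighbours of d. Suppose there are none. Call two vertices of M equivalent if they are
-- linked by cyclic triangles each of which lies in some P(d). The classes are modules of M, each of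
-- them lies in a single P(d) and is thus small, and the classes met by one P(d) form a transitive
-- tournament. So the chains of the classes met by P(d) have total length at most τ. On the other hand
-- a chain of length proportional to τ is met by half of the sets P(d), so most classes j are met by a
-- fraction at least (weight j) / 2τ of them. Double counting bounds the sum of the squares of the
-- weights by 2τ², which is too little for small classes covering half of M.

module Submission where

open import Defs
open import Data.Bool using (Bool; true; false; not; if_then_else_; _∧_; _∨_) renaming (T to IsTrue)
open import Data.Bool.Properties using (not-involutive)
open import Data.Empty using (⊥; ⊥-elim)
open import Data.Fin as F using (Fin; zero; suc; toℕ; inject₁; fromℕ)
import Data.Fin.Properties as FP
open import Data.List using (List; []; _∷_; length; filterᵇ; _++_; take; drop; map; lookup; allFin; cartesianProduct)
open import Data.List.Membership.Propositional using (_∈_)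
open import Data.List.Membership.Propositional.Properties using (∈-lookup; ∈-++⁻; ∈-allFin; ∈-map⁻; ∈-cartesianProduct⁺; ∈-cartesianProduct⁻)
open import Data.List.Properties using (length-take; length-drop; length-map; length-++; length-tabulate; take++drop≡id)
open import Data.List.Relation.Unary.All as All using (All; []; _∷_)
open import Data.List.Relation.Unary.AllPairs as AP using (AllPairs; []; _∷_)
import Data.List.Relation.Unary.AllPairs.Properties as APP
open import Data.List.Relation.Unary.Any as Any using (here; there)
open import Data.List.Relation.Unary.Unique.Propositional using (Unique)
import Data.List.Relation.Unary.Unique.Propositional.Properties as UniqueP
open import Data.Nat using (ℕ; zero; suc; _+_; _*_; _∸_; _^_; _≤_; _<_; z≤n; s≤s; _≤?_; _<?_; _≤ᵇ_; _<ᵇ_; _≡ᵇ_; _/_; _%_; >-nonZero)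
open import Data.Nat.DivMod using (m≡m%n+[m/n]*n; m%n<n)
open import Data.Nat.Induction using (<-rec)
open import Data.Nat.Properties
open import Data.Nat.Tactic.RingSolver using (solve-∀)
open import Data.Product using (Σ; _×_; _,_; proj₁; proj₂)
open import Data.Sum using (_⊎_; inj₁; inj₂; [_,_]; [_,_]′; map₂)
open import Function using (_∘_)
open import Function.Definitions using (Injective)
open import Relation.Binary.Construct.Closure.Equivalence as EqC using (EqClosure; symmetric; fold)
open import Relation.Binary.Construct.Closure.ReflexiveTransitive using (ε; _◅_; _◅◅_)
open import Relation.Binary.Construct.Closure.Symmetric using (SymClosure; fwd; bwd)
open import Relation.Binary.Definitions using (tri<; tri≈; tri>)
open import Relation.Binary.PropositionalEquality hiding ([_])
open import Relation.Nullary using (¬_; Dec; yes; no)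
open import Relation.Nullary.Decidable using (does)

private variable Item Kind : Set

-- Sums and counts over lists

⟦_⟧ : Bool → ℕ
⟦ true ⟧ = 1
⟦ false ⟧ = 0

∑ : List Item → (Item → ℕ) → ℕ
∑ [] f = 0
∑ (x ∷ xs) f = f x + ∑ xs f

# : (Item → Bool) → List Item → ℕ
# p xs = ∑ xs (λ x → ⟦ p x ⟧)

∑-mono : ∀ (xs : List Item) {f g : Item → ℕ} → (∀ {x} → x ∈ xs → f x ≤ g x) → ∑ xs f ≤ ∑ xs g
∑-mono [] h = z≤n
∑-mono (x ∷ xs) h = +-mono-≤ (h (here refl)) (∑-mono xs (h ∘ there))

∑-cong : ∀ (xs : List Item) {f g : Item → ℕ} → (∀ {x} → x ∈ xs → f x ≡ g x) → ∑ xs f ≡ ∑ xs g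
∑-cong [] h = refl
∑-cong (x ∷ xs) h = cong₂ _+_ (h (here refl)) (∑-cong xs (h ∘ there))

∑-zero : ∀ (xs : List Item) → ∑ xs (λ _ → 0) ≡ 0
∑-zero [] = refl
∑-zero (_ ∷ xs) = ∑-zero xs

∑-+ : ∀ (xs : List Item) (f g : Item → ℕ) → ∑ xs (λ x → f x + g x) ≡ ∑ xs f + ∑ xs g
∑-+ [] f g = refl
∑-+ (x ∷ xs) f g rewrite ∑-+ xs f g = lemma (f x) (g x) (∑ xs f) (∑ xs g)
  where
  lemma : ∀ a b c d → (a + b) + (c + d) ≡ (a + c) + (b + d)
  lemma = solve-∀

∑-*ˡ : ∀ (xs : List Item) (c : ℕ) (f : Item → ℕ) → ∑ xs (λ x → c * f x) ≡ c * ∑ xs f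
∑-*ˡ [] c f = sym (*-zeroʳ c)
∑-*ˡ (x ∷ xs) c f rewrite ∑-*ˡ xs c f = sym (*-distribˡ-+ c (f x) (∑ xs f))

∑-*ʳ : ∀ (xs : List Item) (c : ℕ) (f : Item → ℕ) → ∑ xs (λ x → f x * c) ≡ ∑ xs f * c
∑-*ʳ xs c f = trans (∑-cong xs (λ {x} _ → *-comm (f x) c)) (trans (∑-*ˡ xs c f) (*-comm c _))

∑-const : ∀ (xs : List Item) (c : ℕ) → ∑ xs (λ _ → c) ≡ length xs * c
∑-const [] c = refl
∑-const (_ ∷ xs) c = cong (c +_) (∑-const xs c)

∑-swap : ∀ (xs : List Item) (ys : List Kind) (f : Item → Kind → ℕ) →
  ∑ xs (λ x → ∑ ys (f x)) ≡ ∑ ys (λ y → ∑ xs (λ x → f x y))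
∑-swap [] ys f = sym (∑-zero ys)
∑-swap (x ∷ xs) ys f =
  trans (cong (∑ ys (f x) +_) (∑-swap xs ys f)) (sym (∑-+ ys (f x) (λ y → ∑ xs (λ x → f x y))))

∑-bound : ∀ (xs : List Item) (c : ℕ) {f : Item → ℕ} → (∀ {x} → x ∈ xs → f x ≤ c) → ∑ xs f ≤ length xs * c
∑-bound xs c h = ≤-trans (∑-mono xs h) (≤-reflexive (∑-const xs c))

∑-++ : ∀ (xs ys : List Item) (f : Item → ℕ) → ∑ (xs ++ ys) f ≡ ∑ xs f + ∑ ys f
∑-++ [] ys f = refl
∑-++ (x ∷ xs) ys f rewrite ∑-++ xs ys f = sym (+-assoc (f x) _ _)

∈⇒≤∑ : ∀ {xs : List Item} {x} (f : Item → ℕ) → x ∈ xs → f x ≤ ∑ xs f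
∈⇒≤∑ f (here refl) = m≤m+n _ _
∈⇒≤∑ f (there i) = ≤-trans (∈⇒≤∑ f i) (m≤n+m _ _)

someElement : ∀ (xs : List Item) → 0 < length xs → Σ Item λ x → x ∈ xs
someElement (x ∷ xs) _ = x , here refl

∈⇒nonempty : ∀ {x : Item} {xs} → x ∈ xs → 0 < length xs
∈⇒nonempty {xs = _ ∷ _} _ = s≤s z≤n

⟦⟧≤1 : ∀ b → ⟦ b ⟧ ≤ 1
⟦⟧≤1 true = ≤-refl
⟦⟧≤1 false = z≤n

⟦⟧-mono : ∀ {b c} → (b ≡ true → c ≡ true) → ⟦ b ⟧ ≤ ⟦ c ⟧
⟦⟧-mono {false} h = z≤n
⟦⟧-mono {true} h rewrite h refl = ≤-refl

not-¬ : ∀ {b} → ¬ (b ≡ true) → b ≡ false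
not-¬ {false} h = refl
not-¬ {true} h = ⊥-elim (h refl)

f≢t : ∀ {b} → b ≡ false → ¬ (b ≡ true)
f≢t refl ()

∧-true : ∀ {b c} → b ∧ c ≡ true → b ≡ true × c ≡ true
∧-true {true} {true} _ = refl , refl

bool-cong : ∀ {b c} → (b ≡ true → c ≡ true) → (c ≡ true → b ≡ true) → b ≡ c
bool-cong {true} h k = sym (h refl)
bool-cong {false} {false} h k = refl
bool-cong {false} {true} h k = k refl

#-mono : ∀ (xs : List Item) {p q : Item → Bool} → (∀ {x} → x ∈ xs → p x ≡ true → q x ≡ true) → # p xs ≤ # q xs
#-mono xs h = ∑-mono xs (λ i → ⟦⟧-mono (h i))

#-not : ∀ (p : Item → Bool) xs → # p xs + # (not ∘ p) xs ≡ length xs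
#-not p [] = refl
#-not p (x ∷ xs) with p x
... | true = cong suc (#-not p xs)
... | false = trans (+-suc _ _) (cong suc (#-not p xs))

#≤length : ∀ (p : Item → Bool) xs → # p xs ≤ length xs
#≤length p xs = ≤-trans (m≤m+n _ _) (≤-reflexive (#-not p xs))

length-filterᵇ : ∀ (p : Item → Bool) xs → length (filterᵇ p xs) ≡ # p xs
length-filterᵇ p [] = refl
length-filterᵇ p (x ∷ xs) with p x
... | true = cong suc (length-filterᵇ p xs)
... | false = length-filterᵇ p xs

∑-filterᵇ : ∀ (p : Item → Bool) xs (f : Item → ℕ) → ∑ (filterᵇ p xs) f ≡ ∑ xs (λ x → ⟦ p x ⟧ * f x)
∑-filterᵇ p [] f = refl
∑-filterᵇ p (x ∷ xs) f with p x
... | true = cong₂ _+_ (sym (+-identityʳ (f x))) (∑-filterᵇ p xs f)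
... | false = ∑-filterᵇ p xs f

∑-filterᵇ-≤ : ∀ (p : Item → Bool) xs (f : Item → ℕ) → ∑ (filterᵇ p xs) f ≤ ∑ xs f
∑-filterᵇ-≤ p xs f = ≤-trans (≤-reflexive (∑-filterᵇ p xs f))
  (∑-mono xs (λ {x} _ → ≤-trans (*-monoˡ-≤ (f x) (⟦⟧≤1 (p x))) (≤-reflexive (+-identityʳ (f x)))))

length-filterᵇ-≤ : ∀ (p : Item → Bool) xs → length (filterᵇ p xs) ≤ length xs
length-filterᵇ-≤ p xs = ≤-trans (≤-reflexive (length-filterᵇ p xs)) (#≤length p xs)

∈-filterᵇ⁺ : ∀ (p : Item → Bool) {x xs} → x ∈ xs → p x ≡ true → x ∈ filterᵇ p xs
∈-filterᵇ⁺ p {xs = y ∷ _} (here refl) e with p y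
∈-filterᵇ⁺ p (here refl) refl | true = here refl
∈-filterᵇ⁺ p {xs = y ∷ _} (there i) e with p y
... | true = there (∈-filterᵇ⁺ p i e)
... | false = ∈-filterᵇ⁺ p i e

∈-filterᵇ⁻ : ∀ (p : Item → Bool) {x} xs → x ∈ filterᵇ p xs → x ∈ xs × p x ≡ true
∈-filterᵇ⁻ p (y ∷ xs) i with p y in eq
∈-filterᵇ⁻ p (y ∷ xs) (here refl) | true = here refl , eq
∈-filterᵇ⁻ p (y ∷ xs) (there i) | true = let (j , e) = ∈-filterᵇ⁻ p xs i in there j , e
... | false = let (j , e) = ∈-filterᵇ⁻ p xs i in there j , e

AllPairs-filterᵇ : ∀ {R : Item → Item → Set} (p : Item → Bool) {xs} → AllPairs R xs → AllPairs R (filterᵇ p xs)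
AllPairs-filterᵇ p [] = []
AllPairs-filterᵇ p {x ∷ xs} (r ∷ rs) with p x
... | true = All.tabulate (λ i → All.lookup r (proj₁ (∈-filterᵇ⁻ p xs i))) ∷ AllPairs-filterᵇ p rs
... | false = AllPairs-filterᵇ p rs

#-pos : ∀ (p : Item → Bool) xs → 0 < # p xs → Σ Item λ x → x ∈ xs × p x ≡ true
#-pos p (x ∷ xs) h with p x in eq
... | true = x , here refl , eq
... | false = let (y , i , e) = #-pos p xs h in y , there i , e

markov : ∀ (p : Item → Bool) (c : ℕ) (f : Item → ℕ) xs → (∀ {x} → x ∈ xs → p x ≡ true → c ≤ f x) → # p xs * c ≤ ∑ xs f
markov p c f xs h = ≤-trans (≤-reflexive (sym (∑-*ʳ xs c (λ x → ⟦ p x ⟧)))) (∑-mono xs k)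
  where
  k : ∀ {x} → x ∈ xs → ⟦ p x ⟧ * c ≤ f x
  k {x} i with p x in eq
  ... | true = ≤-trans (≤-reflexive (+-identityʳ c)) (h i eq)
  ... | false = z≤n

anyᵇ : (Item → Bool) → List Item → Bool
anyᵇ p [] = false
anyᵇ p (x ∷ xs) = p x ∨ anyᵇ p xs

anyᵇ⁻ : ∀ (p : Item → Bool) xs → anyᵇ p xs ≡ true → Σ Item λ x → x ∈ xs × p x ≡ true
anyᵇ⁻ p (x ∷ xs) h with p x in eq
... | true = x , here refl , eq
... | false = let (y , i , e) = anyᵇ⁻ p xs h in y , there i , e

anyᵇ⁺ : ∀ (p : Item → Bool) {x xs} → x ∈ xs → p x ≡ true → anyᵇ p xs ≡ true
anyᵇ⁺ p (here refl) e rewrite e = refl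
anyᵇ⁺ p {xs = y ∷ ys} (there i) e with p y
... | true = refl
... | false = anyᵇ⁺ p i e

⟦anyᵇ⟧≤# : ∀ (p : Item → Bool) xs → ⟦ anyᵇ p xs ⟧ ≤ # p xs
⟦anyᵇ⟧≤# p [] = z≤n
⟦anyᵇ⟧≤# p (x ∷ xs) with p x
... | true = s≤s z≤n
... | false = ⟦anyᵇ⟧≤# p xs

allᵇ : (Item → Bool) → List Item → Bool
allᵇ p xs = not (anyᵇ (not ∘ p) xs)

allᵇ⁻ : ∀ (p : Item → Bool) xs → allᵇ p xs ≡ true → ∀ {x} → x ∈ xs → p x ≡ true
allᵇ⁻ p xs h {x} i with p x in eq
... | true = refl
... | false with anyᵇ (not ∘ p) xs | anyᵇ⁺ (not ∘ p) i (cong not eq)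
allᵇ⁻ p xs () i | false | true | _

allᵇ-fail : ∀ (p : Item → Bool) xs → allᵇ p xs ≡ false → Σ Item λ x → x ∈ xs × p x ≡ false
allᵇ-fail p xs h with anyᵇ (not ∘ p) xs in eq
... | true with anyᵇ⁻ (not ∘ p) xs eq
... | (x , i , e) = x , i , not-inj e
  where
  not-inj : ∀ {b} → not b ≡ true → b ≡ false
  not-inj {false} _ = refl

≤ᵇ-true : ∀ {m n} → (m ≤ᵇ n) ≡ true → m ≤ n
≤ᵇ-true {m} {n} e = ≤ᵇ⇒≤ m n (subst IsTrue (sym e) _)

≤ᵇ-false : ∀ {m n} → (m ≤ᵇ n) ≡ false → n < m
≤ᵇ-false {m} {n} e = ≰⇒> (λ h → subst IsTrue e (≤⇒≤ᵇ h))

-- Summed over all `k`, the counts reach every entry of `xs` at least once, so they cannot all lie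
-- below the average. The Boolean search over `ks` makes the choice of `k` constructive.
pigeonhole : ∀ {Item Kind : Set} (ks : List Kind) (p : Kind → Item → Bool) (xs : List Item) → 0 < length xs →
  (∀ {x} → x ∈ xs → Σ Kind λ k → k ∈ ks × p k x ≡ true) →
  Σ Kind λ k → k ∈ ks × length xs ≤ length ks * # (p k) xs
pigeonhole {Item} {Kind} ks p xs pos h with anyᵇ (λ k → length xs ≤ᵇ length ks * # (p k) xs) ks in eq
... | true = let (k , i , e) = anyᵇ⁻ _ ks eq in k , i , ≤ᵇ-true e
... | false = ⊥-elim (<⇒≱ strict total)
  where
  L = length ks
  total : length xs * L ≤ ∑ ks (λ k → L * # (p k) xs)
  total = begin
    length xs * L ≡⟨ *-comm (length xs) L ⟩
    L * length xs ≡⟨ cong (L *_) (trans (sym (*-identityʳ _)) (sym (∑-const xs 1))) ⟩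
    L * ∑ xs (λ _ → 1) ≤⟨ *-monoʳ-≤ L (∑-mono xs (λ {x} i → let (k , j , e) = h i in
        ≤-trans (≤-reflexive (cong ⟦_⟧ (sym e))) (∈⇒≤∑ (λ k → ⟦ p k x ⟧) j))) ⟩
    L * ∑ xs (λ x → ∑ ks (λ k → ⟦ p k x ⟧)) ≡⟨ cong (L *_) (∑-swap xs ks (λ x k → ⟦ p k x ⟧)) ⟩
    L * ∑ ks (λ k → # (p k) xs) ≡⟨ sym (∑-*ˡ ks L (λ k → # (p k) xs)) ⟩
    ∑ ks (λ k → L * # (p k) xs) ∎
    where open ≤-Reasoning
  small : ∀ {k} → k ∈ ks → L * # (p k) xs < length xs
  small {k} i = ≤ᵇ-false (not-¬ (λ e → f≢t eq (anyᵇ⁺ (λ k → length xs ≤ᵇ length ks * # (p k) xs) i e)))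
  sum< : ∀ (zs : List Kind) (f : Kind → ℕ) (c : ℕ) → 0 < length zs → (∀ {k} → k ∈ zs → f k < c) → ∑ zs f < length zs * c
  sum< (z ∷ zs) f c _ h = +-mono-<-≤ (h (here refl)) (∑-bound zs c (λ i → <⇒≤ (h (there i))))
  nonempty : ∀ (xs : List Item) → 0 < length xs → (∀ {x} → x ∈ xs → Σ Kind λ k → k ∈ ks × p k x ≡ true) → 0 < length ks
  nonempty (x ∷ _) _ h with h (here refl)
  ... | (k , here refl , _) = s≤s z≤n
  ... | (k , there _ , _) = s≤s z≤n
  strict : ∑ ks (λ k → L * # (p k) xs) < length xs * L
  strict = ≤-trans (sum< ks _ (length xs) (nonempty xs pos h) small) (≤-reflexive (*-comm L (length xs)))

-- Chains

∈-take : ∀ k {x : Item} xs → x ∈ take k xs → x ∈ xs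
∈-take (suc k) (y ∷ xs) (here e) = here e
∈-take (suc k) (y ∷ xs) (there i) = there (∈-take k xs i)

∈-drop : ∀ k {x : Item} xs → x ∈ drop k xs → x ∈ xs
∈-drop zero xs i = i
∈-drop (suc k) (y ∷ xs) i = there (∈-drop k xs i)

AllPairs-take-drop : ∀ {R : Item → Item → Set} k {xs x y} → AllPairs R xs → x ∈ take k xs → y ∈ drop k xs → R x y
AllPairs-take-drop (suc k) {z ∷ xs} (r ∷ rs) (here refl) j = All.lookup r (∈-drop k xs j)
AllPairs-take-drop (suc k) {z ∷ xs} (r ∷ rs) (there i) j = AllPairs-take-drop k rs i j

chunk : ∀ {k} → ℕ → Fin k → List Item → List Item
chunk s zero xs = take s xs
chunk s (suc i) xs = chunk s i (drop s xs)

∈-chunk : ∀ {k} s (i : Fin k) {x : Item} xs → x ∈ chunk s i xs → x ∈ xs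
∈-chunk s zero xs m = ∈-take s xs m
∈-chunk s (suc i) xs m = ∈-drop s xs (∈-chunk s i _ m)

length-chunk : ∀ {k} s (i : Fin k) (xs : List Item) → k * s ≤ length xs → length (chunk s i xs) ≡ s
length-chunk {k = suc k} s zero xs h = trans (length-take s xs) (m≤n⇒m⊓n≡m (≤-trans (m≤m+n s (k * s)) h))
length-chunk {k = suc k} s (suc i) xs h = length-chunk s i (drop s xs)
  (≤-trans (≤-trans (≤-reflexive (sym (m+n∸m≡n s (k * s)))) (∸-monoˡ-≤ s h)) (≤-reflexive (sym (length-drop s xs))))

AllPairs-chunk : ∀ {k} {R : Item → Item → Set} s (i : Fin k) {xs} → AllPairs R xs → AllPairs R (chunk s i xs)
AllPairs-chunk s zero r = APP.take⁺ s r
AllPairs-chunk s (suc i) r = AllPairs-chunk s i (APP.drop⁺ s r)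

chunk-ordered : ∀ {k} {R : Item → Item → Set} s {i j : Fin k} {xs x y} → AllPairs R xs → i F.< j →
  x ∈ chunk s i xs → y ∈ chunk s j xs → R x y
chunk-ordered s {zero} {suc j} r _ a b = AllPairs-take-drop s r a (∈-chunk s j _ b)
chunk-ordered s {suc i} {suc j} r (s≤s l) a b = chunk-ordered s (APP.drop⁺ s r) l a b

-- The witness is the quotient `m / suc k`. It is positive, so the remainder, being less than
-- `suc k`, at most doubles the bound.
chunkSize : ∀ k {m} → suc k ≤ m → Σ ℕ λ s → suc k * s ≤ m × m ≤ 2 * suc k * s
chunkSize k {m} h = m / K , ≤-trans (≤-reflexive (*-comm K (m / K))) low , up
  where
  K = suc k
  eq : m ≡ m % K + (m / K) * K
  eq = m≡m%n+[m/n]*n m K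
  low : (m / K) * K ≤ m
  low = ≤-trans (m≤n+m _ _) (≤-reflexive (sym eq))
  pos : 1 ≤ m / K
  pos with m / K | eq
  ... | suc _ | _ = s≤s z≤n
  ... | zero | e = ⊥-elim (<⇒≱ (m%n<n m K) (≤-trans h (≤-trans (≤-reflexive e) (≤-reflexive (+-identityʳ _)))))
  up : m ≤ 2 * K * (m / K)
  up = begin
    m ≡⟨ eq ⟩
    m % K + (m / K) * K ≤⟨ +-monoˡ-≤ _ (≤-trans (<⇒≤ (m%n<n m K)) (≤-trans (≤-reflexive (sym (*-identityˡ K))) (*-monoˡ-≤ K pos))) ⟩
    (m / K) * K + (m / K) * K ≡⟨ cong₂ _+_ (*-comm (m / K) K) (trans (*-comm (m / K) K) (sym (+-identityʳ _))) ⟩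
    2 * (K * (m / K)) ≡⟨ sym (*-assoc 2 K (m / K)) ⟩
    2 * K * (m / K) ∎
    where open ≤-Reasoning

lookup-injective : ∀ {xs : List Item} → Unique xs → ∀ i j → lookup xs i ≡ lookup xs j → i ≡ j
lookup-injective (u ∷ us) zero zero e = refl
lookup-injective {xs = x ∷ xs} (u ∷ us) zero (suc j) e = ⊥-elim (All.lookup u (∈-lookup {xs = xs} j) e)
lookup-injective {xs = x ∷ xs} (u ∷ us) (suc i) zero e = ⊥-elim (All.lookup u (∈-lookup {xs = xs} i) (sym e))
lookup-injective (u ∷ us) (suc i) (suc j) e = cong suc (lookup-injective us i j e)

length-allFin : ∀ k → length (allFin k) ≡ k
length-allFin k = length-tabulate (λ (i : Fin k) → i)

Unique-length : ∀ {n} {xs : List (Fin n)} → Unique xs → length xs ≤ n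
Unique-length u = FP.injective⇒≤ (λ {i} {j} e → lookup-injective u i j e)

module _ {n} (T : Tournament n) where

  Arc : Fin n → Fin n → Set
  Arc u v = arc T u v ≡ true

  Chain : List (Fin n) → Set
  Chain = AllPairs Arc

  Arc⇒≢ : ∀ {u v} → Arc u v → u ≢ v
  Arc⇒≢ a refl = f≢t (irrefl T _) a

  ¬Arc : ∀ {u v} → arc T u v ≡ false → u ≢ v → Arc v u
  ¬Arc {u} {v} e ne rewrite tourn T v u (ne ∘ sym) | e = refl

  Arc-asym : ∀ {u v} → Arc u v → arc T v u ≡ false
  Arc-asym {u} {v} a = trans (tourn T v u (Arc⇒≢ a ∘ sym)) (cong not a)

  Chain⇒Unique : ∀ {xs} → Chain xs → Unique xs
  Chain⇒Unique = AP.map Arc⇒≢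

  -- Asking for the arc in the required direction, and not for `arc T u v ≡ b`, excludes `u ≡ v`
  -- also when `b` is `false`.
  dir : Bool → Fin n → Fin n → Bool
  dir b u v = if b then arc T u v else arc T v u

  dir⇒≢ : ∀ b {u v} → dir b u v ≡ true → u ≢ v
  dir⇒≢ true a = Arc⇒≢ a
  dir⇒≢ false a = Arc⇒≢ a ∘ sym

  dir⇒arc : ∀ b {u v} → dir b u v ≡ true → arc T u v ≡ b
  dir⇒arc true a = a
  dir⇒arc false a = Arc-asym a

  contains : ∀ {h} (H : Tournament h) (φ : Fin h → Fin n) →
    (∀ i j → i F.< j → dir (arc H i j) (φ i) (φ j) ≡ true) → Contains T H
  contains H φ d = φ , inj , arcs
    where
    inj : Injective _≡_ _≡_ φ
    inj {i} {j} e with FP.<-cmp i j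
    ... | tri< l _ _ = ⊥-elim (dir⇒≢ (arc H i j) (d i j l) e)
    ... | tri≈ _ q _ = q
    ... | tri> _ _ g = ⊥-elim (dir⇒≢ (arc H j i) (d j i g) (sym e))
    arcs : ∀ i j → arc T (φ i) (φ j) ≡ arc H i j
    arcs i j with FP.<-cmp i j
    ... | tri< l _ _ = dir⇒arc (arc H i j) (d i j l)
    ... | tri≈ _ refl _ = trans (irrefl T (φ i)) (sym (irrefl H i))
    ... | tri> _ ne g = trans (tourn T (φ i) (φ j) (λ e → ne (inj e)))
      (trans (cong not (dir⇒arc (arc H j i) (d j i g))) (sym (tourn H i j ne)))

  lookup-Chain : ∀ {xs} → Chain xs → ∀ i j → i F.< j → Arc (lookup xs i) (lookup xs j)
  lookup-Chain {x ∷ xs} (r ∷ rs) zero (suc j) _ = All.lookup r (∈-lookup {xs = xs} j)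
  lookup-Chain (r ∷ rs) (suc i) (suc j) (s≤s l) = lookup-Chain rs i j l

  -- Arcs go from earlier to later entries only, so the indices along a cycle increase, and the
  -- closing arc back to its start cannot exist.
  Chain⇒HasTransitiveSub : ∀ {xs} → Chain xs → HasTransitiveSub T (length xs)
  Chain⇒HasTransitiveSub {xs} ch = lookup xs , (λ {i} {j} → lookup-injective (Chain⇒Unique ch) i j) , acyclic
    where
    up : ∀ i j → Arc (lookup xs i) (lookup xs j) → i F.< j
    up i j a with FP.<-cmp i j
    ... | tri< l _ _ = l
    ... | tri≈ _ refl _ = ⊥-elim (Arc⇒≢ a refl)
    ... | tri> _ _ g = ⊥-elim (f≢t (Arc-asym (lookup-Chain ch j i g)) a)
    climb : ∀ l (c : Fin (suc l) → Fin (length xs)) →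
      (∀ (i : Fin l) → c (inject₁ i) F.< c (suc i)) → toℕ (c zero) ≤ toℕ (c (fromℕ l))
    climb zero c h = ≤-refl
    climb (suc l) c h = ≤-trans (<⇒≤ (h zero)) (climb l (c ∘ suc) (h ∘ suc))
    acyclic : ¬ HasDirectedCycle (λ i j → arc T (lookup xs i) (lookup xs j))
    acyclic (l , c , _ , steps , back) =
      <⇒≱ (up _ _ back) (climb (suc l) c (λ i → up _ _ (steps i)))

  Chain-++ : ∀ {xs ys} → Chain xs → Chain ys → (∀ {x y} → x ∈ xs → y ∈ ys → Arc x y) → Chain (xs ++ ys)
  Chain-++ cx cy h = APP.++⁺ cx cy (All.tabulate (λ i → All.tabulate (h i)))

  -- Decidability allows the final induction to split on the existence of a long chain without
  -- excluded middle. The search runs over the first vertex and continues among its out-neighbours.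
  chainOfLength? : ∀ k S → Dec (Σ (List (Fin n)) λ xs → Chain xs × length xs ≡ k × (∀ {x} → x ∈ xs → x ∈ S))
  chainOfLength? zero S = yes ([] , [] , refl , λ ())
  chainOfLength? (suc k) S = decide (search S (λ i → i))
    where
    Goal = Σ (List (Fin n)) λ xs → Chain xs × length xs ≡ suc k × (∀ {x} → x ∈ xs → x ∈ S)
    From : Fin n → Set
    From v = Σ (List (Fin n)) λ xs → Chain xs × length xs ≡ k × (∀ {x} → x ∈ xs → x ∈ filterᵇ (arc T v) S)
    found : ∀ {v} → v ∈ S → From v → Goal
    found {v} i (xs , c , l , s) = v ∷ xs , All.tabulate (λ j → proj₂ (∈-filterᵇ⁻ (arc T v) S (s j))) ∷ c , cong suc l ,
      λ { (here refl) → i ; (there j) → proj₁ (∈-filterᵇ⁻ (arc T v) S (s j)) }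
    missing : (∀ {v} → v ∈ S → ¬ From v) → ¬ Goal
    missing h (v ∷ xs , r ∷ c , l , s) = h (s (here refl))
      (xs , c , suc-injective l , λ j → ∈-filterᵇ⁺ (arc T v) (s (there j)) (All.lookup r j))
    search : ∀ R → (∀ {v} → v ∈ R → v ∈ S) → Goal ⊎ (∀ {v} → v ∈ R → ¬ From v)
    search [] s = inj₂ (λ ())
    search (v ∷ R) s with chainOfLength? k (filterᵇ (arc T v) S)
    ... | yes f = inj₁ (found (s (here refl)) f)
    ... | no nf with search R (s ∘ there)
    ... | inj₁ g = inj₁ g
    ... | inj₂ h = inj₂ (λ { (here refl) → nf ; (there i) → h i })
    decide : Goal ⊎ (∀ {v} → v ∈ S → ¬ From v) → Dec Goal
    decide (inj₁ g) = yes g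
    decide (inj₂ h) = no (missing h)

  -- The other vertices split into out-neighbours and in-neighbours of `v`, and one part has at
  -- least `2 ^ k` members. A chain in the former is preceded by `v`, one in the latter is followed
  -- by it.
  ramsey : ∀ k S → Unique S → 2 ^ k ≤ length S →
    Σ (List (Fin n)) λ xs → Chain xs × length xs ≡ k × (∀ {x} → x ∈ xs → x ∈ S)
  ramsey zero S u h = [] , [] , refl , λ ()
  ramsey (suc k) [] u h = ⊥-elim (<⇒≱ (s≤s z≤n) (≤-trans (m^n>0 2 (suc k)) h))
  ramsey (suc k) (v ∷ S) (uv ∷ u) h with 2 ^ k ≤? # (arc T v) S
  ... | yes p = let (xs , c , l , s) = ramsey k (filterᵇ (arc T v) S) (AllPairs-filterᵇ _ u)
                                          (≤-trans p (≤-reflexive (sym (length-filterᵇ _ S)))) in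
    v ∷ xs , All.tabulate (λ j → proj₂ (∈-filterᵇ⁻ (arc T v) S (s j))) ∷ c , cong suc l ,
      λ { (here refl) → here refl ; (there j) → there (proj₁ (∈-filterᵇ⁻ (arc T v) S (s j))) }
  ... | no p = let (xs , c , l , s) = ramsey k (filterᵇ (not ∘ arc T v) S) (AllPairs-filterᵇ _ u)
                                          (≤-trans big (≤-reflexive (sym (length-filterᵇ _ S)))) in
    xs ++ v ∷ [] ,
    Chain-++ c ([] ∷ []) (λ { {x} i (here refl) → let (j , e) = ∈-filterᵇ⁻ (not ∘ arc T v) S (s i) in
      ¬Arc (trans (sym (not-involutive _)) (cong not e)) (All.lookup uv j) }) ,
    trans (length-++ xs) (trans (+-comm (length xs) 1) (cong suc l)) ,
    λ i → mem xs s i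
    where
    big : 2 ^ k ≤ # (not ∘ arc T v) S
    big = +-cancelˡ-≤ (suc (# (arc T v) S)) _ _ (begin
      suc (# (arc T v) S) + 2 ^ k ≤⟨ +-monoˡ-≤ _ (≰⇒> p) ⟩
      2 ^ k + 2 ^ k ≡⟨ cong (2 ^ k +_) (sym (+-identityʳ _)) ⟩
      2 ^ suc k ≤⟨ h ⟩
      suc (length S) ≡⟨ cong suc (sym (#-not (arc T v) S)) ⟩
      suc (# (arc T v) S) + # (not ∘ arc T v) S ∎)
      where open ≤-Reasoning
    mem : ∀ xs → (∀ {x} → x ∈ xs → x ∈ filterᵇ (not ∘ arc T v) S) → ∀ {x} → x ∈ xs ++ v ∷ [] → x ∈ v ∷ S
    mem xs s i with ∈-++⁻ xs i
    ... | inj₁ j = there (proj₁ (∈-filterᵇ⁻ (not ∘ arc T v) S (s j)))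
    ... | inj₂ (here refl) = here refl

  sub : ∀ {xs} → Unique xs → Tournament (length xs)
  sub {xs} u = record
    { arc = λ i j → arc T (lookup xs i) (lookup xs j)
    ; irrefl = λ i → irrefl T (lookup xs i)
    ; tourn = λ i j ne → tourn T _ _ (λ e → ne (lookup-injective u i j e)) }

  sub-free : ∀ {h} {H : Tournament h} {xs} (u : Unique xs) → ¬ Contains T H → ¬ Contains (sub u) H
  sub-free {xs = xs} u nc (f , inj , e) = nc (lookup xs ∘ f , (λ eq → inj (lookup-injective u _ _ eq)) , e)

indexOf : ∀ {Item : Set} {x : Item} {xs} (i : x ∈ xs) → lookup xs (Any.index i) ≡ x
indexOf (here refl) = refl
indexOf (there i) = indexOf i

unique-⊆ : ∀ {Item : Set} {xs ys : List Item} → Unique xs → (∀ {x} → x ∈ xs → x ∈ ys) → length xs ≤ length ys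
unique-⊆ {xs = xs} {ys} u sub = FP.injective⇒≤ {f = λ i → Any.index (sub (∈-lookup {xs = xs} i))}
  (λ {i} {j} e → lookup-injective u i j
    (trans (sym (indexOf (sub (∈-lookup {xs = xs} i)))) (trans (cong (lookup ys) e) (indexOf (sub (∈-lookup {xs = xs} j))))))

-- Sparse pairs

-- `E` bounds the ratio of `S` to a candidate set. Each embedded vertex multiplies it by `M`, and
-- getting stuck costs a factor for the pigeonhole choice among the remaining positions; the sum
-- dominates the cost of every possible stop.
embedCost : ℕ → ℕ → ℕ → ℕ
embedCost zero E M = 1
embedCost (suc k) E M = suc k * E + embedCost k (E * M) M

module _ {n} (T : Tournament n) where

  -- also true when u ≡ v
  nonarc : Fin n → Fin n → Bool
  nonarc u v = not (arc T u v)

  record SparsePair (X : List (Fin n)) (S K M : ℕ) : Set where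
    field
      A B : List (Fin n)
      A-unique : Unique A
      B-unique : Unique B
      A⊆X : ∀ {x} → x ∈ A → x ∈ X
      B⊆X : ∀ {x} → x ∈ B → x ∈ X
      disjoint : ∀ {x y} → x ∈ A → y ∈ B → x ≢ y
      |A|≤|X| : length A ≤ length X
      |B|≤|X| : length B ≤ length X
      A-large : S ≤ K * length A
      B-large : S ≤ K * length B
      sparse : M * ∑ A (λ u → # (nonarc u) B) ≤ length A * length B

  weakenCost : ∀ {X S K K' M} → K ≤ K' → SparsePair X S K M → SparsePair X S K' M
  weakenCost le p = record
    { A = A ; B = B ; A-unique = A-unique ; B-unique = B-unique ; A⊆X = A⊆X ; B⊆X = B⊆X
    ; disjoint = disjoint ; |A|≤|X| = |A|≤|X| ; |B|≤|X| = |B|≤|X|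
    ; A-large = ≤-trans A-large (*-monoˡ-≤ _ le) ; B-large = ≤-trans B-large (*-monoˡ-≤ _ le) ; sparse = sparse }
    where open SparsePair p

  nonarc⇒arc : ∀ {u v} → nonarc u v ≡ true → u ≢ v → Arc T v u
  nonarc⇒arc {u} {v} e = ¬Arc T (trans (sym (not-involutive _)) (cong not e))

  -- A vertex of `C zero` with a proportion `1 / M` of suitable neighbours in every later candidate
  -- set is embedded, and these sets shrink to its neighbours. If there is none, each vertex of
  -- `C zero` fails at some later position, and pigeonhole fixes one such position for a large part
  -- `W`.
  embedOrSparse : ∀ k (adj : Fin k → Fin k → Bool) (X : List (Fin n)) (S M E : ℕ) (C : Fin k → List (Fin n)) →
    (∀ j → Unique (C j)) → (∀ i j {x y} → i F.< j → x ∈ C i → y ∈ C j → x ≢ y) →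
    (∀ j {x} → x ∈ C j → x ∈ X) → (∀ j → length (C j) ≤ length X) →
    0 < S → (∀ j → S ≤ E * length (C j)) →
    (Σ (Fin k → Fin n) λ φ → (∀ j → φ j ∈ C j) × (∀ i j → i F.< j → dir T (adj i j) (φ i) (φ j) ≡ true))
    ⊎ SparsePair X S (embedCost k E M) M
  embedOrSparse zero adj X S M E C uniq dis C⊆X C≤X S>0 large = inj₁ ((λ ()) , (λ ()) , λ ())
  embedOrSparse (suc k) adj X S M E C uniq dis C⊆X C≤X S>0 large
    with anyᵇ (λ v → allᵇ (λ j → length (C (suc j)) ≤ᵇ M * # (dir T (adj zero (suc j)) v) (C (suc j))) (allFin k)) (C zero) in eq
  ... | true = step (anyᵇ⁻ _ (C zero) eq)
    where
    step : _ → _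
    step (v , v∈ , e) with embedOrSparse k (λ i j → adj (suc i) (suc j)) X S M (E * M)
        (λ j → filterᵇ (dir T (adj zero (suc j)) v) (C (suc j)))
        (λ j → AllPairs-filterᵇ _ (uniq (suc j)))
        (λ i j l a b → dis (suc i) (suc j) (s≤s l) (proj₁ (∈-filterᵇ⁻ _ _ a)) (proj₁ (∈-filterᵇ⁻ _ _ b)))
        (λ j a → C⊆X (suc j) (proj₁ (∈-filterᵇ⁻ _ _ a)))
        (λ j → ≤-trans (length-filterᵇ-≤ (dir T (adj zero (suc j)) v) (C (suc j))) (C≤X (suc j)))
        S>0
        (λ j → begin
          S ≤⟨ large (suc j) ⟩
          E * length (C (suc j)) ≤⟨ *-monoʳ-≤ E (≤ᵇ-true (allᵇ⁻ _ (allFin k) e (∈-allFin j))) ⟩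
          E * (M * # (dir T (adj zero (suc j)) v) (C (suc j))) ≡⟨ cong (λ z → E * (M * z)) (sym (length-filterᵇ _ (C (suc j)))) ⟩
          E * (M * length (filterᵇ (dir T (adj zero (suc j)) v) (C (suc j)))) ≡⟨ sym (*-assoc E M _) ⟩
          E * M * length (filterᵇ (dir T (adj zero (suc j)) v) (C (suc j))) ∎)
      where open ≤-Reasoning
    ... | inj₂ sp = inj₂ (weakenCost (m≤n+m _ _) sp)
    ... | inj₁ (φ , φ∈ , φd) = inj₁ (φ' , φ∈' , φd')
      where
      φ' : Fin (suc k) → Fin n
      φ' zero = v
      φ' (suc j) = φ j
      φ∈' : ∀ j → φ' j ∈ C j
      φ∈' zero = v∈
      φ∈' (suc j) = proj₁ (∈-filterᵇ⁻ _ _ (φ∈ j))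
      φd' : ∀ i j → i F.< j → dir T (adj i j) (φ' i) (φ' j) ≡ true
      φd' zero (suc j) _ = proj₂ (∈-filterᵇ⁻ (dir T (adj zero (suc j)) v) (C (suc j)) (φ∈ j))
      φd' (suc i) (suc j) (s≤s l) = φd i j l
  ... | false = inj₂ (build (pigeonhole (allFin k) few (C zero) C₀>0 fails))
    where
    few : Fin k → Fin n → Bool
    few j v = not (length (C (suc j)) ≤ᵇ M * # (dir T (adj zero (suc j)) v) (C (suc j)))
    C₀>0 : 0 < length (C zero)
    C₀>0 with length (C zero) | large zero
    ... | suc _ | _ = s≤s z≤n
    ... | zero | l = ⊥-elim (<⇒≱ S>0 (≤-trans l (≤-reflexive (*-zeroʳ E))))
    fails : ∀ {v} → v ∈ C zero → Σ (Fin k) λ j → j ∈ allFin k × few j v ≡ true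
    fails {v} i with allᵇ-fail _ (allFin k) (not-¬ (λ e → f≢t eq (anyᵇ⁺ _ i e)))
    ... | (j , m , e) = j , m , cong not e
    build : _ → _
    build (j , _ , many) = go (adj zero (suc j)) refl
      where
      open ≤-Reasoning
      D = C (suc j)
      W = filterᵇ (few j) (C zero)
      W⊆ : ∀ {x} → x ∈ W → x ∈ C zero
      W⊆ i = proj₁ (∈-filterᵇ⁻ _ _ i)
      fewHits : ∀ {v} → v ∈ W → M * # (dir T (adj zero (suc j)) v) D ≤ length D
      fewHits {v} i = <⇒≤ (≤ᵇ-false (trans (sym (not-involutive _)) (cong not (proj₂ (∈-filterᵇ⁻ (few j) (C zero) i)))))
      W-large : S ≤ (suc k * E + embedCost k (E * M) M) * length W
      W-large = begin
        S ≤⟨ large zero ⟩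
        E * length (C zero) ≤⟨ *-monoʳ-≤ E many ⟩
        E * (length (allFin k) * # (few j) (C zero)) ≡⟨ cong₂ (λ a b → E * (a * b)) (length-allFin k) (sym (length-filterᵇ (few j) (C zero))) ⟩
        E * (k * length W) ≡⟨ trans (sym (*-assoc E k _)) (cong (_* length W) (*-comm E k)) ⟩
        k * E * length W ≤⟨ *-monoˡ-≤ (length W) (≤-trans (m≤n+m (k * E) E) (m≤m+n _ _)) ⟩
        (suc k * E + embedCost k (E * M) M) * length W ∎
      D-large : S ≤ (suc k * E + embedCost k (E * M) M) * length D
      D-large = ≤-trans (large (suc j)) (*-monoˡ-≤ (length D) (≤-trans (m≤m+n E (k * E)) (m≤m+n _ _)))
      total : M * ∑ W (λ v → # (dir T (adj zero (suc j)) v) D) ≤ length W * length D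
      total = ≤-trans (≤-reflexive (sym (∑-*ˡ W M _))) (∑-bound W (length D) fewHits)
      go : ∀ b → adj zero (suc j) ≡ b → SparsePair X S (suc k * E + embedCost k (E * M) M) M
      -- If `H` asks for arcs from `W` to `D`, these are the rare ones, so nearly all arcs lead from
      -- `D` to `W` and `D` comes first.
      go true e = record
        { A = D ; B = W ; A-unique = uniq (suc j) ; B-unique = AllPairs-filterᵇ _ (uniq zero)
        ; A⊆X = C⊆X (suc j) ; B⊆X = C⊆X zero ∘ W⊆ ; disjoint = λ a b → dis zero (suc j) (s≤s z≤n) (W⊆ b) a ∘ sym
        ; |A|≤|X| = C≤X (suc j) ; |B|≤|X| = ≤-trans (length-filterᵇ-≤ (few j) (C zero)) (C≤X zero)
        ; A-large = D-large ; B-large = W-large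
        ; sparse = begin
            M * ∑ D (λ u → # (nonarc u) W) ≡⟨ cong (M *_) (∑-swap D W _) ⟩
            M * ∑ W (λ v → # (λ u → nonarc u v) D) ≤⟨ *-monoʳ-≤ M (∑-mono W (λ {v} i → #-mono D (λ {u} i' p →
                 subst (λ b → dir T b v u ≡ true) (sym e) (nonarc⇒arc p (λ q → dis zero (suc j) (s≤s z≤n) (W⊆ i) i' (sym q)))))) ⟩
            M * ∑ W (λ v → # (dir T (adj zero (suc j)) v) D) ≤⟨ total ⟩
            length W * length D ≡⟨ *-comm (length W) (length D) ⟩
            length D * length W ∎ }
      go false e = record
        { A = W ; B = D ; A-unique = AllPairs-filterᵇ _ (uniq zero) ; B-unique = uniq (suc j)
        ; A⊆X = C⊆X zero ∘ W⊆ ; B⊆X = C⊆X (suc j) ; disjoint = λ a b → dis zero (suc j) (s≤s z≤n) (W⊆ a) b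
        ; |A|≤|X| = ≤-trans (length-filterᵇ-≤ (few j) (C zero)) (C≤X zero) ; |B|≤|X| = C≤X (suc j)
        ; A-large = W-large ; B-large = D-large
        ; sparse = begin
            M * ∑ W (λ v → # (nonarc v) D) ≤⟨ *-monoʳ-≤ M (∑-mono W (λ {v} i → #-mono D (λ {u} i' p →
                 subst (λ b → dir T b v u ≡ true) (sym e) (nonarc⇒arc p (dis zero (suc j) (s≤s z≤n) (W⊆ i) i'))))) ⟩
            M * ∑ W (λ v → # (dir T (adj zero (suc j)) v) D) ≤⟨ total ⟩
            length W * length D ∎ }

-- With H absent, greedily embedding H into consecutive chunks of X must get stuck at a sparse pair.
sparsePair : ∀ {h} (H : Tournament h) (M : ℕ) → Σ ℕ λ K → ∀ {n} (T : Tournament n) → ¬ Contains T H →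
  ∀ X → Unique X → K ≤ length X → SparsePair T X (length X) K M
sparsePair {zero} H M = 0 , λ T free → ⊥-elim (free ((λ ()) , (λ { {()} }) , λ ()))
-- The summand `suc k` allows `X` to be cut into `suc k` nonempty chunks, one for each vertex of
-- `H`.
sparsePair {suc k} H M = suc k + embedCost (suc k) (2 * suc k) M , λ T free X u le →
  let (s , fits , covers) = chunkSize k (≤-trans (m≤m+n (suc k) _) le)
      len = λ (j : Fin (suc k)) → length-chunk s j X fits
  in [ (λ { (φ , _ , d) → ⊥-elim (free (contains T H φ d)) }) , weakenCost T (m≤n+m _ (suc k)) ]
    (embedOrSparse T (suc k) (arc H) X (length X) M (2 * suc k) (λ j → chunk s j X)
      (λ j → AllPairs-chunk s j u)
      (λ i j l → chunk-ordered s u l)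
      (λ j → ∈-chunk s j X)
      (λ j → ≤-trans (≤-reflexive (len j)) (≤-trans (m≤m+n s (k * s)) fits))
      (≤-trans (s≤s z≤n) le)
      (λ j → ≤-trans covers (≤-reflexive (cong (2 * suc k *_) (sym (len j))))))

-- Sequences of sets with few backward arcs

-- Markov's inequality with density threshold `1 / L` and exceptional proportion `1 / c`. The factor
-- `length ys` is cancelled at the end, so it must be positive.
fewDense : ∀ {A B : Set} (p : A → B → Bool) (c L : ℕ) xs ys → 0 < length ys →
  c * L * ∑ xs (λ x → # (p x) ys) ≤ length xs * length ys →
  c * # (λ x → not (L * # (p x) ys ≤ᵇ length ys)) xs ≤ length xs
fewDense p c L xs ys pos total = *-cancelʳ-≤ _ _ (length ys) {{>-nonZero pos}} (begin
  c * # dense xs * length ys ≡⟨ *-assoc c (# dense xs) _ ⟩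
  c * (# dense xs * length ys) ≤⟨ *-monoʳ-≤ c (markov dense (length ys) (λ x → L * # (p x) ys) xs
      (λ _ e → <⇒≤ (≤ᵇ-false (trans (sym (not-involutive _)) (cong not e))))) ⟩
  c * ∑ xs (λ x → L * # (p x) ys) ≡⟨ cong (c *_) (∑-*ˡ xs L _) ⟩
  c * (L * ∑ xs (λ x → # (p x) ys)) ≡⟨ sym (*-assoc c L _) ⟩
  c * L * ∑ xs (λ x → # (p x) ys) ≤⟨ total ⟩
  length xs * length ys ∎)
  where
  open ≤-Reasoning
  dense = λ x → not (L * # (p x) ys ≤ᵇ length ys)

halfRemains : ∀ {A : Set} (p : A → Bool) xs → 2 * # (not ∘ p) xs ≤ length xs → length xs ≤ 2 * # p xs
halfRemains p xs few = +-cancelˡ-≤ (length xs) _ _ (begin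
  length xs + length xs ≡⟨ cong (length xs +_) (sym (+-identityʳ _)) ⟩
  2 * length xs ≡⟨ cong (2 *_) (sym (#-not p xs)) ⟩
  2 * (# p xs + # (not ∘ p) xs) ≡⟨ *-distribˡ-+ 2 (# p xs) _ ⟩
  2 * # p xs + 2 * # (not ∘ p) xs ≤⟨ +-monoʳ-≤ (2 * # p xs) few ⟩
  2 * # p xs + length xs ≡⟨ +-comm (2 * # p xs) _ ⟩
  length xs + 2 * # p xs ∎)
  where open ≤-Reasoning

mostlySparse : ∀ {A B : Set} (p : A → B → Bool) (L : ℕ) xs ys → 0 < length ys →
  2 * L * ∑ xs (λ x → # (p x) ys) ≤ length xs * length ys →
  length xs ≤ 2 * # (λ x → L * # (p x) ys ≤ᵇ length ys) xs
mostlySparse p L xs ys pos total = halfRemains _ xs (fewDense p 2 L xs ys pos total)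

-- This is the form in which the minimality of the counterexample is used: the bound with exponent
-- `1 / q` inside every smaller vertex set.
Hereditary : ∀ {n} → Tournament n → ℕ → Set
Hereditary {n} T q = ∀ S → Unique S → length S < n →
  Σ (List (Fin n)) λ R → Chain T R × (∀ {x} → x ∈ R → x ∈ S) × length S ≤ length R ^ q

-- The flag `linear?` selects for each index a set of size proportional to `length X` or a chain
-- whose `q`-th power is. Smoothness is one-sided, from later vertices to earlier sets; the other
-- direction is recovered by averaging in `Framing`.
record Tower {n} (T : Tournament n) (q : ℕ) (X : List (Fin n)) (N C Λ : ℕ) (linear? : ℕ → Bool) : Set where
  field
    F : ℕ → List (Fin n)
    F⊆X : ∀ i → i < N → ∀ {x} → x ∈ F i → x ∈ X
    disjoint : ∀ i j → i < j → j < N → ∀ {x y} → x ∈ F i → y ∈ F j → x ≢ y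
    smooth : ∀ i j → i < j → j < N → ∀ {y} → y ∈ F j → Λ * # (λ x → nonarc T x y) (F i) ≤ length (F i)
    linear : ∀ i → i < N → linear? i ≡ true → Unique (F i) × length X ≤ C * length (F i)
    chain : ∀ i → i < N → linear? i ≡ false → Chain T (F i) × length X ≤ C * length (F i) ^ q

-- One level loses the factor of the sparse pair and a 2 for cleaning. The sparsity `2 * (2 * Λ)` is
-- spent on two cleanings, of `A` and then of `B`; the outer `suc` gives the strict inequality that
-- makes `B*` large enough for the next level.
towerCost : ∀ {h} → Tournament h → ℕ → ℕ → ℕ
towerCost H Λ zero = 1
towerCost H Λ (suc N) = suc (2 * proj₁ (sparsePair H (2 * (2 * Λ))) * suc (towerCost H Λ N))

pos-root : ∀ q {m k} → 0 < m → m ≤ k ^ suc q → 0 < k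
pos-root q {k = zero} p h = ⊥-elim (<⇒≱ p h)
pos-root q {k = suc k} p h = s≤s z≤n

-- The first set is taken from the `A` of a sparse pair, and the tower continues inside those
-- vertices of `B` that receive arcs from nearly all of it. All later sets lie there, so they are
-- smooth to the first.
tower : ∀ {h} (H : Tournament h) (Λ : ℕ) (N : ℕ) {n} (T : Tournament n) (q : ℕ) → ¬ Contains T H → Hereditary T (suc q) →
  ∀ linear? X → Unique X → length X < n → towerCost H Λ N ≤ length X →
  Tower T (suc q) X N (towerCost H Λ N) Λ linear?
tower H Λ zero T q free her linear? X u X<n big = record
  { F = λ _ → [] ; F⊆X = λ _ () ; disjoint = λ _ _ _ () ; smooth = λ _ _ _ () ; linear = λ _ () ; chain = λ _ () }
tower H Λ (suc N) {n} T q free her linear? X u X<n big = build (linear? zero) refl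
  where
  open ≤-Reasoning
  K = proj₁ (sparsePair H (2 * (2 * Λ)))
  C = towerCost H Λ N
  C' = towerCost H Λ (suc N)
  K≤C' : K ≤ C'
  K≤C' = begin
    K ≤⟨ m≤m+n K (K + 0) ⟩
    2 * K ≡⟨ sym (*-identityʳ _) ⟩
    2 * K * 1 ≤⟨ *-monoʳ-≤ (2 * K) (s≤s z≤n) ⟩
    2 * K * suc C ≤⟨ n≤1+n _ ⟩
    C' ∎
  open SparsePair (proj₂ (sparsePair H (2 * (2 * Λ))) T free X u (≤-trans K≤C' big))
  X>0 : 0 < length X
  X>0 = ≤-trans (s≤s z≤n) big
  positive : ∀ {k m} → length X ≤ k * m → 0 < m
  positive {k} {suc m} _ = s≤s z≤n
  positive {k} {zero} l = ⊥-elim (<⇒≱ X>0 (≤-trans l (≤-reflexive (*-zeroʳ k))))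
  test : Fin n → Bool
  test u = 2 * Λ * # (nonarc T u) B ≤ᵇ length B
  -- Every single vertex of `A*` has few nonarcs to `B`, so any nonempty part of `A*`, even a short
  -- chain, is still sparse towards `B`.
  A* = filterᵇ test A
  twice : ∀ {a b} → length X ≤ K * a → a ≤ 2 * b → length X ≤ 2 * K * b
  twice {a} {b} l l' = begin
    length X ≤⟨ l ⟩ K * a ≤⟨ *-monoʳ-≤ K l' ⟩ K * (2 * b) ≡⟨ sym (*-assoc K 2 b) ⟩
    K * 2 * b ≡⟨ cong (_* b) (*-comm K 2) ⟩ 2 * K * b ∎
  A*-large : length X ≤ 2 * K * length A*
  A*-large = twice A-large (≤-trans (mostlySparse (nonarc T) (2 * Λ) A B (positive {K} B-large) sparse)
    (≤-reflexive (cong (2 *_) (sym (length-filterᵇ test A)))))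
  A*⊆A : ∀ {x} → x ∈ A* → x ∈ A
  A*⊆A i = proj₁ (∈-filterᵇ⁻ test A i)
  A*-unique : Unique A*
  A*-unique = AllPairs-filterᵇ test A-unique
  2K≤C' : 2 * K ≤ C'
  2K≤C' = ≤-trans (≤-reflexive (sym (*-identityʳ _))) (≤-trans (*-monoʳ-≤ (2 * K) (s≤s z≤n)) (n≤1+n _))

  onTop : ∀ R → 0 < length R → (∀ {x} → x ∈ R → x ∈ A*) →
    (linear? 0 ≡ true → Unique R × length X ≤ C' * length R) →
    (linear? 0 ≡ false → Chain T R × length X ≤ C' * length R ^ suc q) →
    Tower T (suc q) X (suc N) C' Λ linear?
  onTop R R>0 R⊆ lin cha = record
    { F = G ; F⊆X = G⊆X ; disjoint = dis ; smooth = smo ; linear = li ; chain = ch }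
    where
    ok : Fin n → Bool
    ok w = Λ * # (λ u → nonarc T u w) R ≤ᵇ length R
    B* = filterᵇ ok B
    B*⊆B : ∀ {x} → x ∈ B* → x ∈ B
    B*⊆B i = proj₁ (∈-filterᵇ⁻ ok B i)
    sparseR : 2 * Λ * ∑ B (λ w → # (λ u → nonarc T u w) R) ≤ length B * length R
    sparseR = begin
      2 * Λ * ∑ B (λ w → # (λ u → nonarc T u w) R) ≡⟨ cong (2 * Λ *_) (∑-swap B R _) ⟩
      2 * Λ * ∑ R (λ u → # (nonarc T u) B) ≡⟨ sym (∑-*ˡ R (2 * Λ) _) ⟩
      ∑ R (λ u → 2 * Λ * # (nonarc T u) B) ≤⟨ ∑-bound R (length B) (λ i → ≤ᵇ-true (proj₂ (∈-filterᵇ⁻ test A (R⊆ i)))) ⟩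
      length R * length B ≡⟨ *-comm (length R) _ ⟩
      length B * length R ∎
    B*-large : length X ≤ 2 * K * length B*
    B*-large = twice B-large (≤-trans (mostlySparse (λ w u → nonarc T u w) Λ B R R>0 sparseR)
      (≤-reflexive (cong (2 *_) (sym (length-filterᵇ ok B)))))
    B*≥C : C ≤ length B*
    B*≥C = <⇒≤ (*-cancelˡ-< (2 * K) C (length B*)
       (≤-trans (s≤s (≤-trans (*-monoʳ-≤ (2 * K) (n≤1+n C)) ≤-refl)) (≤-trans big B*-large)))
    rest : Tower T (suc q) B* N C Λ (linear? ∘ suc)
    rest = tower H Λ N T q free her (linear? ∘ suc) B* (AllPairs-filterᵇ ok B-unique)
      (≤-<-trans (≤-trans (length-filterᵇ-≤ ok B) |B|≤|X|) X<n) B*≥C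
    module R' = Tower rest
    G : ℕ → List (Fin n)
    G zero = R
    G (suc i) = R'.F i
    G⊆X : ∀ i → i < suc N → ∀ {x} → x ∈ G i → x ∈ X
    G⊆X zero _ m = A⊆X (A*⊆A (R⊆ m))
    G⊆X (suc i) (s≤s l) m = B⊆X (B*⊆B (R'.F⊆X i l m))
    dis : ∀ i j → i < j → j < suc N → ∀ {x y} → x ∈ G i → y ∈ G j → x ≢ y
    dis zero (suc j) _ (s≤s l) a b = disjoint (A*⊆A (R⊆ a)) (B*⊆B (R'.F⊆X j l b))
    dis (suc i) (suc j) (s≤s l) (s≤s l') = R'.disjoint i j l l'
    smo : ∀ i j → i < j → j < suc N → ∀ {y} → y ∈ G j → Λ * # (λ x → nonarc T x y) (G i) ≤ length (G i)
    smo zero (suc j) _ (s≤s l) b = ≤ᵇ-true (proj₂ (∈-filterᵇ⁻ ok B (R'.F⊆X j l b)))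
    smo (suc i) (suc j) (s≤s l) (s≤s l') = R'.smooth i j l l'
    relay : ∀ {m} → length B* ≤ C * m → length X ≤ C' * m
    relay {m} l = begin
      length X ≤⟨ B*-large ⟩ 2 * K * length B* ≤⟨ *-monoʳ-≤ (2 * K) l ⟩ 2 * K * (C * m) ≡⟨ sym (*-assoc (2 * K) C m) ⟩
      2 * K * C * m ≤⟨ *-monoˡ-≤ m (≤-trans (*-monoʳ-≤ (2 * K) (n≤1+n C)) (n≤1+n _)) ⟩ C' * m ∎
    li : ∀ i → i < suc N → linear? i ≡ true → Unique (G i) × length X ≤ C' * length (G i)
    li zero _ e = lin e
    li (suc i) (s≤s l) e = let (un , z) = R'.linear i l e in un , relay z
    ch : ∀ i → i < suc N → linear? i ≡ false → Chain T (G i) × length X ≤ C' * length (G i) ^ suc q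
    ch zero _ e = cha e
    ch (suc i) (s≤s l) e = let (un , z) = R'.chain i l e in un , relay z

  build : ∀ b → linear? 0 ≡ b → Tower T (suc q) X (suc N) C' Λ linear?
  build true e = onTop A* (positive {2 * K} A*-large) (λ i → i)
    (λ _ → A*-unique , ≤-trans A*-large (*-monoˡ-≤ (length A*) 2K≤C'))
    (λ e' → ⊥-elim (f≢t e' e))
  build false e =
    let (R , c , R⊆ , le) = her A* A*-unique (≤-<-trans (≤-trans (length-filterᵇ-≤ test A) |A|≤|X|) X<n) in
    onTop R (pos-root q (positive {2 * K} A*-large) le) R⊆ (λ e' → ⊥-elim (f≢t e e'))
      (λ _ → c , ≤-trans A*-large (*-mono-≤ 2K≤C' le))

-- Boats

eqᵇ : ∀ {n} → Fin n → Fin n → Bool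
eqᵇ x y = does (x FP.≟ y)

eqᵇ⇒≡ : ∀ {n} {x y : Fin n} → eqᵇ x y ≡ true → x ≡ y
eqᵇ⇒≡ {x = x} {y} e with x FP.≟ y
... | yes p = p

eqᵇ-refl : ∀ {n} (x : Fin n) → eqᵇ x x ≡ true
eqᵇ-refl x with x FP.≟ x
... | yes _ = refl
... | no ne = ⊥-elim (ne refl)

#-≤1 : ∀ {A : Set} (p : A → Bool) {v} {xs} → Unique xs → (∀ {x} → x ∈ xs → p x ≡ true → v ≡ x) → # p xs ≤ 1
#-≤1 p [] h = z≤n
#-≤1 p {v} {x ∷ xs} (ux ∷ u) h with p x in eq
... | false = #-≤1 p u (h ∘ there)
... | true = s≤s (≤-trans (#-mono xs {q = λ _ → false} (λ i e →
      ⊥-elim (All.lookup ux i (trans (sym (h (here refl) eq)) (h (there i) e))))) (≤-reflexive (∑-zero xs)))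

-- A union-find: each pair `s i`, `t i` merges the label of the former into that of the latter. This
-- makes the equivalence generated by a finite list of pairs decidable.
classLabels : ∀ {n} {I : Set} (s t : I → Fin n) (is : List I) →
  Σ (Fin n → Fin n) λ cl → (∀ {i} → i ∈ is → cl (s i) ≡ cl (t i)) ×
    (∀ {u v} → cl u ≡ cl v → EqClosure (λ u v → Σ I λ i → i ∈ is × u ≡ s i × v ≡ t i) u v)
classLabels s t [] = (λ x → x) , (λ ()) , λ { refl → ε }
classLabels {n} {I} s t (i ∷ is) = cl' , joins , sound
  where
  prev = classLabels s t is
  cl = proj₁ prev
  cl' : Fin n → Fin n
  cl' x = if eqᵇ (cl x) (cl (s i)) then cl (t i) else cl x
  R' : Fin n → Fin n → Set
  R' = λ u v → Σ I λ k → k ∈ i ∷ is × u ≡ s k × v ≡ t k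
  joins : ∀ {k} → k ∈ i ∷ is → cl' (s k) ≡ cl' (t k)
  joins (here refl) rewrite eqᵇ-refl (cl (s i)) with eqᵇ (cl (t i)) (cl (s i))
  ... | true = refl
  ... | false = refl
  joins (there m) rewrite proj₁ (proj₂ prev) m = refl
  old : ∀ {u v} → cl u ≡ cl v → EqClosure R' u v
  old e = EqC.map (λ (k , m , p) → k , there m , p) (proj₂ (proj₂ prev) e)
  link : EqClosure R' (s i) (t i)
  link = fwd (i , here refl , refl , refl) ◅ ε
  sound : ∀ {u v} → cl' u ≡ cl' v → EqClosure R' u v
  sound {u} {v} e with eqᵇ (cl u) (cl (s i)) in eu | eqᵇ (cl v) (cl (s i)) in ev
  ... | true | true = old (trans (eqᵇ⇒≡ eu) (sym (eqᵇ⇒≡ ev)))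
  ... | true | false = old (eqᵇ⇒≡ eu) ◅◅ link ◅◅ old e
  ... | false | true = old e ◅◅ symmetric R' link ◅◅ old (sym (eqᵇ⇒≡ ev))
  ... | false | false = old e

-- A boat is a cyclic triangle of M exactly two of whose vertices are hit by some d in D. Without
-- boats, the classes generated by the cyclic triangles inside the hit sets are modules of M.
module HitStructure {n} (T : Tournament n) (M D : List (Fin n)) (hit : Fin n → Fin n → Bool)
  (noBoat : ∀ {d u v w} → d ∈ D → u ∈ M → v ∈ M → w ∈ M → Arc T u v → Arc T v w → Arc T w u →
    hit d u ≡ true → hit d v ≡ true → hit d w ≡ true)
  where

  V = Fin n

  Joined : V → V → V → Set
  Joined d u v = Σ V λ w → (u ∈ M × v ∈ M × w ∈ M) × (Arc T u v × Arc T v w × Arc T w u) ×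
    (hit d u ≡ true × hit d v ≡ true × hit d w ≡ true)

  turn : ∀ {d u v} (j : Joined d u v) → Joined d v (proj₁ j)
  turn {u = u} (w , (a , b , c) , (e , f , g) , (x , y , z)) = u , (b , c , a) , (f , g , e) , (y , z , x)

  Conn : V → V → V → Set
  Conn d = EqClosure (Joined d)

  _≈_ : V → V → Set
  _≈_ = EqClosure (λ u v → Σ V λ d → d ∈ D × Joined d u v)

  ≈-sym : ∀ {u v} → u ≈ v → v ≈ u
  ≈-sym = symmetric _

  Conn-sym : ∀ {d u v} → Conn d u v → Conn d v u
  Conn-sym = symmetric _

  Conn⇒∈ : ∀ {d u v} → u ∈ M → Conn d u v → v ∈ M
  Conn⇒∈ i ε = i
  Conn⇒∈ i (fwd (_ , (_ , b , _) , _) ◅ p) = Conn⇒∈ b p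
  Conn⇒∈ i (bwd (_ , (a , _ , _) , _) ◅ p) = Conn⇒∈ a p

  Conn⇒hit : ∀ {d u v} → hit d u ≡ true → Conn d u v → hit d v ≡ true
  Conn⇒hit i ε = i
  Conn⇒hit i (fwd (_ , _ , _ , (_ , b , _)) ◅ p) = Conn⇒hit b p
  Conn⇒hit i (bwd (_ , _ , _ , (a , _ , _)) ◅ p) = Conn⇒hit a p

  -- An implication along each arc of a cyclic triangle can be followed all the way around, so it is
  -- an equivalence. `P` is the invariant under which the implication is available.
  cyclic-cong : ∀ {q d u v} (P : V → Set) → (∀ {x y} → Joined d x y → P x → P y) →
    (∀ {x y} → Joined d x y → P x → Arc T q x → Arc T q y) →
    Joined d u v → P u → arc T q u ≡ arc T q v
  cyclic-cong P next imp j p = bool-cong (imp j p)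
    (λ a → imp (turn (turn j)) (next (turn j) (next j p)) (imp (turn j) (next j p) a))

  -- A vertex `q` that splits a triangle hit by `d` closes a cyclic triangle with one of its arcs;
  -- `d` hits both ends of this arc but not `q`, which makes a boat.
  unhit-uniform : ∀ {d q u v} → d ∈ D → q ∈ M → hit d q ≡ false → Conn d u v → arc T q u ≡ arc T q v
  unhit-uniform {d} {q} d∈ q∈ nh = fold record { refl = refl ; sym = sym ; trans = trans }
    (λ j → cyclic-cong {d = d} (λ x → x ≡ x) (λ _ _ → refl) imp j refl)
    where
    imp : ∀ {x y} → Joined d x y → x ≡ x → Arc T q x → Arc T q y
    imp {x} {y} (z , (x∈ , y∈ , z∈) , (xy , yz , zx) , (hx , hy , hz)) _ qx with arc T q y in eq
    ... | true = refl
    ... | false = ⊥-elim (f≢t nh (noBoat d∈ x∈ y∈ q∈ xy (¬Arc T eq λ { refl → f≢t nh hy }) qx hx hy))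

  -- If q splits a triangle whose vertices are all hit by d, then q closes a cyclic triangle with
  -- one of its arcs: either d hits q and q belongs to the class, or there is a boat.
  outside-uniform : ∀ {q u v} → q ∈ M → ¬ (q ≈ u) → u ≈ v → arc T q u ≡ arc T q v
  outside-uniform q∈ ne ε = refl
  outside-uniform {q} {u} q∈ ne (s ◅ p) = trans (one s) (outside-uniform q∈ (λ e → ne (e ◅◅ ≈-sym (s ◅ ε))) p)
    where
    imp : ∀ {d x y} → d ∈ D → Joined d x y → ¬ (q ≈ x) → Arc T q x → Arc T q y
    imp {d} {x} {y} d∈ j@(z , (x∈ , y∈ , z∈) , (xy , yz , zx) , (hx , hy , hz)) ne qx with arc T q y in eq
    ... | true = refl
    ... | false = ⊥-elim (ne (fwd (d , d∈ , y , (q∈ , x∈ , y∈) , (qx , xy , yq) , (noBoat d∈ x∈ y∈ q∈ xy yq qx hx hy , hx , hy)) ◅ ε))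
      where
      yq : Arc T y q
      yq = ¬Arc T eq λ { refl → ne (bwd (d , d∈ , j) ◅ ε) }
    next : ∀ {d x y} → d ∈ D → Joined d x y → ¬ (q ≈ x) → ¬ (q ≈ y)
    next {d} d∈ j ne e = ne (e ◅◅ (bwd (d , d∈ , j) ◅ ε))
    one : ∀ {x} → SymClosure (λ u v → Σ V λ d → d ∈ D × Joined d u v) u x → arc T q u ≡ arc T q x
    one (fwd (d , d∈ , j)) = cyclic-cong {d = d} (λ x → ¬ (q ≈ x)) (next d∈) (imp d∈) j ne
    one (bwd (d , d∈ , j)) = sym (cyclic-cong {d = d} (λ x → ¬ (q ≈ x)) (next d∈) (imp d∈) j
      (λ e → ne (e ◅◅ (fwd (d , d∈ , j) ◅ ε))))

  -- Hit sets are laminar: if a walk of d' leaves the d-component of v, then it does so through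
  -- a triangle p → a → b → p with a and b missed by d, and a vertex of the d-component of v
  -- missed by d' would be dominated by b but dominate a.
  laminar : ∀ {d d' v x} → d ∈ D → d' ∈ D → v ∈ M → hit d v ≡ true → Conn d' v x →
    Conn d v x ⊎ (∀ {z} → Conn d v z → Conn d' v z)
  laminar {d} {d'} {v} {x} d∈ d'∈ v∈ hv walk = map₂ inside (explore ε hv walk)
    where
    Triangle : V → V → V → Set
    Triangle p a b = (p ∈ M × a ∈ M × b ∈ M) × (Arc T p a × Arc T a b × Arc T b p) ×
      (hit d' p ≡ true × hit d' a ≡ true × hit d' b ≡ true)
    caught : ∀ {p a b} → Conn d v p → Triangle p a b → hit d a ≡ false → hit d b ≡ false →
      ∀ {z} → Conn d v z → hit d' z ≡ true
    caught {p} {a} {b} vp ((p∈ , a∈ , b∈) , (pa , ab , bp) , (hp , ha , hb)) na nb {z} vz with hit d' z in nz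
    ... | true = refl
    ... | false = ⊥-elim (f≢t (trans ez (Arc-asym T bz)) za)
      where
      z∈ : z ∈ M
      z∈ = Conn⇒∈ v∈ vz
      ez : arc T z a ≡ arc T z b
      ez = unhit-uniform d'∈ z∈ nz (fwd (p , (a∈ , b∈ , p∈) , (ab , bp , pa) , (ha , hb , hp)) ◅ ε)
      bz : Arc T b z
      bz = trans (sym (unhit-uniform d∈ b∈ nb (Conn-sym vp ◅◅ vz))) bp
      za : Arc T z a
      za = ¬Arc T (trans (sym (unhit-uniform d∈ a∈ na (Conn-sym vp ◅◅ vz))) (Arc-asym T pa)) λ { refl → f≢t nz ha }
    Escaped : Set
    Escaped = ∀ {z} → Conn d v z → hit d' z ≡ true
    -- As boats are excluded, `d` hits the whole triangle or only `p`; in the second case `caught`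
    -- shows that `d'` hits the whole `d`-component of `v`.
    visit : ∀ {p a b} → Conn d v p → hit d p ≡ true → Triangle p a b → (hit d a ≡ true × hit d b ≡ true) ⊎ Escaped
    visit {p} {a} {b} vp hp t@((p∈ , a∈ , b∈) , (pa , ab , bp) , _) with hit d a in ea | hit d b in eb
    ... | true | true = inj₁ (refl , refl)
    ... | true | false = ⊥-elim (f≢t eb (noBoat d∈ p∈ a∈ b∈ pa ab bp hp ea))
    ... | false | true = ⊥-elim (f≢t ea (noBoat d∈ b∈ p∈ a∈ bp pa ab eb hp))
    ... | false | false = inj₂ (caught vp t ea eb)
    explore : ∀ {p} → Conn d v p → hit d p ≡ true → Conn d' p x → Conn d v x ⊎ Escaped
    explore vp hp ε = inj₁ vp
    explore vp hp (fwd (w , ms , arcs , hs) ◅ rest) with visit vp hp (ms , arcs , hs)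
    ... | inj₂ esc = inj₂ esc
    ... | inj₁ (ha , hw) = explore (vp ◅◅ (fwd (w , ms , arcs , (hp , ha , hw)) ◅ ε)) ha rest
    explore vp hp (bwd (w , ms@(a , b , c) , arcs@(e , f , g) , (x , y , z)) ◅ rest)
      with visit vp hp ((b , c , a) , (f , g , e) , (y , z , x))
    ... | inj₂ esc = inj₂ esc
    ... | inj₁ (hw , ha) = explore (vp ◅◅ (bwd (w , ms , arcs , (ha , hp , hw)) ◅ ε)) ha rest
    -- Since `d'` hits the whole `d`-component of `v`, the triangles that connect it for `d` also
    -- connect it for `d'`.
    inside : Escaped → ∀ {z} → Conn d v z → Conn d' v z
    inside esc = go ε ε
      where
      move : ∀ {p p'} → Conn d v p → Joined d p p' → Joined d' p p'
      move vp j@(w , ms , arcs , _) = w , ms , arcs ,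
        (esc vp , esc (vp ◅◅ (fwd j ◅ ε)) , esc (vp ◅◅ (fwd j ◅ fwd (turn j) ◅ ε)))
      go : ∀ {p z} → Conn d v p → Conn d' v p → Conn d p z → Conn d' v z
      go vp vp' ε = vp'
      go vp vp' (fwd j ◅ r) = go (vp ◅◅ (fwd j ◅ ε)) (vp' ◅◅ (fwd (move vp j) ◅ ε)) r
      go vp vp' (bwd j ◅ r) = go (vp ◅◅ (bwd j ◅ ε)) (vp' ◅◅ (bwd (move (vp ◅◅ (bwd j ◅ ε)) j) ◅ ε)) r

  -- A walk may change `d` at each step, but by `laminar` two components with a common vertex are
  -- nested, so the larger one can always be kept.
  class-connected : ∀ {v x} → v ≈ x → v ≡ x ⊎ Σ V λ d → d ∈ D × (v ∈ M × hit d v ≡ true) × Conn d v x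
  class-connected ε = inj₁ refl
  class-connected {v} {x} (_◅_ {j = p} s rest) = extend (ends s) (class-connected rest)
    where
    ends : SymClosure (λ u v → Σ V λ d → d ∈ D × Joined d u v) v p →
      Σ V λ d → d ∈ D × (v ∈ M × hit d v ≡ true) × Conn d v p
    ends (fwd (d , d∈ , j@(_ , (a , _) , _ , (h , _)))) = d , d∈ , (a , h) , (fwd j ◅ ε)
    ends (bwd (d , d∈ , j@(_ , (_ , a , _) , _ , (_ , h , _)))) = d , d∈ , (a , h) , (bwd j ◅ ε)
    extend : (Σ V λ d → d ∈ D × (v ∈ M × hit d v ≡ true) × Conn d v p) →
      p ≡ x ⊎ (Σ V λ d → d ∈ D × (p ∈ M × hit d p ≡ true) × Conn d p x) →
      v ≡ x ⊎ Σ V λ d → d ∈ D × (v ∈ M × hit d v ≡ true) × Conn d v x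
    extend (d , d∈ , vh , vp) (inj₁ refl) = inj₂ (d , d∈ , vh , vp)
    extend (d , d∈ , (v∈ , hv) , vp) (inj₂ (e , e∈ , (p∈ , hp) , px)) with laminar e∈ d∈ p∈ hp (Conn-sym vp)
    ... | inj₁ pv = inj₂ (e , e∈ , (v∈ , Conn⇒hit hp pv) , (Conn-sym pv ◅◅ px))
    ... | inj₂ sub = inj₂ (d , d∈ , (v∈ , hv) , (vp ◅◅ sub px))

  -- The nesting of components is used again, now to find one `d` for all entries simultaneously.
  -- The first alternative is the case of a single vertex.
  class-in-hit-set : ∀ {v} xs → (∀ {x} → x ∈ xs → v ≈ x) →
    (∀ {x} → x ∈ xs → v ≡ x) ⊎ Σ V λ d → d ∈ D × (v ∈ M × hit d v ≡ true) × (∀ {x} → x ∈ xs → Conn d v x)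
  class-in-hit-set [] h = inj₁ λ ()
  class-in-hit-set {v} (x ∷ xs) h with class-connected (h (here refl)) | class-in-hit-set xs (h ∘ there)
  ... | inj₁ refl | inj₁ f = inj₁ λ { (here refl) → refl ; (there i) → f i }
  ... | inj₁ refl | inj₂ (d , d∈ , vh , f) = inj₂ (d , d∈ , vh , λ { (here refl) → ε ; (there i) → f i })
  ... | inj₂ (e , e∈ , vh , vx) | inj₁ f = inj₂ (e , e∈ , vh , λ { (here refl) → vx ; (there i) → subst (Conn e v) (f i) ε })
  ... | inj₂ (e , e∈ , vh , vx) | inj₂ (d , d∈ , (v∈ , hv) , f) with laminar d∈ e∈ v∈ hv vx
  ... | inj₁ vx' = inj₂ (d , d∈ , (v∈ , hv) , λ { (here refl) → vx' ; (there i) → f i })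
  ... | inj₂ sub = inj₂ (e , e∈ , vh , λ { (here refl) → vx ; (there i) → sub (f i) })

  triangles : List (V × V × V × V)
  triangles = filterᵇ (λ (d , u , v , w) → (arc T u v ∧ (arc T v w ∧ arc T w u)) ∧ (hit d u ∧ (hit d v ∧ hit d w)))
    (cartesianProduct D (cartesianProduct M (cartesianProduct M M)))

  labels = classLabels (λ (d , u , v , w) → u) (λ (d , u , v , w) → v) triangles

  cl : V → V
  cl = proj₁ labels

  cl⇒≈ : ∀ {u v} → cl u ≡ cl v → u ≈ v
  cl⇒≈ e = EqC.map joined (proj₂ (proj₂ labels) e)
    where
    joined : ∀ {u v} → (Σ (V × V × V × V) λ i → i ∈ triangles × u ≡ proj₁ (proj₂ i) × v ≡ proj₁ (proj₂ (proj₂ i))) →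
      Σ V λ d → d ∈ D × Joined d u v
    joined ((d , u , v , w) , i , refl , refl) =
      let (m , t) = ∈-filterᵇ⁻ _ _ i
          (d∈ , m') = ∈-cartesianProduct⁻ D _ m
          (u∈ , m'') = ∈-cartesianProduct⁻ M _ m'
          (v∈ , w∈) = ∈-cartesianProduct⁻ M _ m''
          (as , hs) = ∧-true t
          (a₁ , as') = ∧-true as
          (h₁ , hs') = ∧-true hs
      in d , d∈ , w , (u∈ , v∈ , w∈) , (a₁ , ∧-true as') , (h₁ , ∧-true hs')

  triangle⇒cl : ∀ {d u v w} → d ∈ D → u ∈ M → v ∈ M → w ∈ M → Arc T u v → Arc T v w → Arc T w u →
    hit d u ≡ true → hit d v ≡ true → hit d w ≡ true → cl u ≡ cl v
  triangle⇒cl {d} {u} {v} {w} d∈ u∈ v∈ w∈ a b c x y z = proj₁ (proj₂ labels)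
    (∈-filterᵇ⁺ _ {x = d , u , v , w} (∈-cartesianProduct⁺ d∈ (∈-cartesianProduct⁺ u∈ (∈-cartesianProduct⁺ v∈ w∈))) true-test)
    where
    true-test : (arc T u v ∧ (arc T v w ∧ arc T w u)) ∧ (hit d u ∧ (hit d v ∧ hit d w)) ≡ true
    true-test rewrite a | b | c | x | y | z = refl

  ≈⇒cl : ∀ {u v} → u ≈ v → cl u ≡ cl v
  ≈⇒cl = fold record { refl = refl ; sym = sym ; trans = trans }
    λ (d , d∈ , w , (u∈ , v∈ , w∈) , (a , b , c) , (x , y , z)) → triangle⇒cl d∈ u∈ v∈ w∈ a b c x y z

  class-module : ∀ {q u v} → q ∈ M → cl u ≡ cl v → cl q ≢ cl u → arc T q u ≡ arc T q v
  class-module q∈ e ne = outside-uniform q∈ (ne ∘ ≈⇒cl) (cl⇒≈ e)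

  -- A class with more than one vertex lies in a single hit set, so the sparsity of the hit sets
  -- bounds every class.
  class-small : Unique M → ∀ j → # (λ x → eqᵇ (cl x) j) M ≤ 1 ⊎ Σ V λ d → d ∈ D × # (λ x → eqᵇ (cl x) j) M ≤ # (hit d) M
  class-small u j with filterᵇ (λ x → eqᵇ (cl x) j) M in eq
  ... | [] = inj₁ (≤-trans (≤-reflexive (trans (sym (length-filterᵇ (λ x → eqᵇ (cl x) j) M)) (cong length eq))) z≤n)
  ... | v ∷ K with class-in-hit-set {v} (v ∷ K) (λ i → cl⇒≈ (trans (lab (here refl)) (sym (lab i))))
    where
    lab : ∀ {x} → x ∈ v ∷ K → cl x ≡ j
    lab i = eqᵇ⇒≡ (proj₂ (∈-filterᵇ⁻ (λ x → eqᵇ (cl x) j) M (subst (_ ∈_) (sym eq) i)))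
  ... | inj₁ f = inj₁ (#-≤1 _ u (λ i e → f (subst (_ ∈_) eq (∈-filterᵇ⁺ (λ x → eqᵇ (cl x) j) i e))))
  ... | inj₂ (d , d∈ , (_ , hv) , f) = inj₂ (d , d∈ ,
    #-mono M (λ i e → Conn⇒hit hv (f (subst (_ ∈_) eq (∈-filterᵇ⁺ (λ x → eqᵇ (cl x) j) i e)))))

-- Sorting into chains, and double counting over the classes

module _ {n} (T : Tournament n) where

  -- The hypothesis on arcs out of `v` says that its out-neighbours form a final segment of `ys`, so
  -- `v` fits in front of the first of them. Equality of all sums stands for `zs` being a
  -- permutation.
  insertChain : ∀ v ys → Chain T ys → (∀ {y} → y ∈ ys → v ≢ y) →
    (∀ {x y} → x ∈ ys → y ∈ ys → Arc T v x → Arc T x y → Arc T v y) →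
    Σ (List (Fin n)) λ zs → Chain T zs × (∀ {z} → z ∈ zs → z ∈ v ∷ ys) × (∀ f → ∑ zs f ≡ f v + ∑ ys f)
  insertChain v [] c ne tr = v ∷ [] , [] ∷ [] , (λ i → i) , λ f → refl
  insertChain v (y ∷ ys) (r ∷ c) ne tr with arc T v y in e
  ... | true = v ∷ y ∷ ys , (e ∷ All.tabulate (λ i → tr (here refl) (there i) e (All.lookup r i))) ∷ r ∷ c , (λ i → i) , λ f → refl
  ... | false =
    let (zs , cz , sub , sums) = insertChain v ys c (ne ∘ there) (λ i j → tr (there i) (there j)) in
    y ∷ zs , All.tabulate (λ i → first (sub i)) ∷ cz ,
      (λ { (here p) → there (here p) ; (there i) → under (sub i) }) ,
      λ f → trans (cong (f y +_) (sums f)) (swap (f y) (f v) (∑ ys f))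
    where
    first : ∀ {z} → z ∈ v ∷ ys → Arc T y z
    first (here refl) = ¬Arc T e (ne (here refl))
    first (there i) = All.lookup r i
    under : ∀ {z} → z ∈ v ∷ ys → z ∈ v ∷ y ∷ ys
    under (here p) = here p
    under (there i) = there (there i)
    swap : ∀ a b c → a + (b + c) ≡ b + (a + c)
    swap = solve-∀

  -- Without cyclic triangles the arcs are transitive on `xs`, which is what insertion sort needs.
  sortChain : ∀ xs → Unique xs →
    (∀ {x y z} → x ∈ xs → y ∈ xs → z ∈ xs → Arc T x y → Arc T y z → ¬ Arc T z x) →
    Σ (List (Fin n)) λ ys → Chain T ys × (∀ {y} → y ∈ ys → y ∈ xs) × (∀ f → ∑ ys f ≡ ∑ xs f)
  sortChain [] u ac = [] , [] , (λ ()) , λ f → refl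
  sortChain (v ∷ xs) (uv ∷ u) ac =
    let (ys , c , sub , sums) = sortChain xs u (λ i j k → ac (there i) (there j) (there k))
        (zs , cz , sub' , sums') = insertChain v ys c (λ i → All.lookup uv (sub i)) (trs ys sub)
    in zs , cz , (λ i → under sub (sub' i)) , λ f → trans (sums' f) (cong (f v +_) (sums f))
    where
    under : ∀ {ys z} → (∀ {y} → y ∈ ys → y ∈ xs) → z ∈ v ∷ ys → z ∈ v ∷ xs
    under sub (here p) = here p
    under sub (there i) = there (sub i)
    trs : ∀ ys → (∀ {y} → y ∈ ys → y ∈ xs) → ∀ {x y} → x ∈ ys → y ∈ ys → Arc T v x → Arc T x y → Arc T v y
    trs ys sub {x} {y} i j vx xy with arc T v y in e
    ... | true = refl
    ... | false = ⊥-elim (ac (here refl) (there (sub i)) (there (sub j)) vx xy (¬Arc T e (All.lookup uv (sub j))))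

-- The contradiction is derived from properties of the classes alone. `light` compares the size of a
-- class with the square of its chain length, `half` makes chains covering half of `M` as long as
-- `τ / 2`, and `hitsHalf` says that half of `D` meets such a chain.
module Counting {n} (T : Tournament n) (Q τ : ℕ) (M D : List (Fin n)) (hit : Fin n → Fin n → Bool) (cl : Fin n → Fin n)
  (her : Hereditary T Q) (M-unique : Unique M) (M<n : length M < n)
  (bounded : ∀ {R} → Chain T R → length R ≤ τ)
  (module-cl : ∀ {q u v} → q ∈ M → cl u ≡ cl v → cl q ≢ cl u → arc T q u ≡ arc T q v)
  (triangle-cl : ∀ {d u v w} → d ∈ D → u ∈ M → v ∈ M → w ∈ M → Arc T u v → Arc T v w → Arc T w u →
    hit d u ≡ true → hit d v ≡ true → hit d w ≡ true → cl u ≡ cl v)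
  (light : ∀ j k → # (λ x → eqᵇ (cl x) j) M ≤ k ^ Q →
    16 * (τ * τ) * # (λ x → eqᵇ (cl x) j) M ≤ length M * (k * k))
  (half : ∀ k → length M ≤ 2 * k ^ Q → τ ≤ 2 * k)
  (hitsHalf : ∀ R → Chain T R → (∀ {x} → x ∈ R → x ∈ M) → τ ≤ 2 * length R →
    length D ≤ 2 * # (λ d → anyᵇ (hit d) R) D)
  (τ>0 : 0 < τ) (D>0 : 0 < length D)
  where

  open ≤-Reasoning
  V = Fin n

  inClass : V → V → Bool
  inClass j x = eqᵇ (cl x) j

  K : V → List V
  K j = filterᵇ (inClass j) M

  classChain : ∀ j → Σ (List V) λ R → Chain T R × (∀ {x} → x ∈ R → x ∈ K j) × length (K j) ≤ length R ^ Q
  classChain j = her (K j) (AllPairs-filterᵇ (inClass j) M-unique) (≤-<-trans (length-filterᵇ-≤ (inClass j) M) M<n)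

  R : V → List V
  R j = proj₁ (classChain j)

  weight : V → ℕ
  weight j = length (R j)

  R⊆ : ∀ {j x} → x ∈ R j → x ∈ M × cl x ≡ j
  R⊆ {j} i = let (m , e) = ∈-filterᵇ⁻ (inClass j) M (proj₁ (proj₂ (proj₂ (classChain j))) i) in m , eqᵇ⇒≡ e

  -- Classes are modules, so a chain of representatives blows up to a chain made of the chains of their classes.
  blowUp : ∀ rs → Chain T rs → (∀ {r} → r ∈ rs → r ∈ M) →
    (∀ {r s} → r ∈ rs → s ∈ rs → cl r ≡ cl s → r ≡ s) → ∑ rs (weight ∘ cl) ≤ τ
  blowUp rs c rs⊆ inj = let (xs , cx , l , _) = expand rs c (λ i → i) in ≤-trans (≤-reflexive (sym l)) (bounded cx)
    where
    between : ∀ {r s x y} → r ∈ rs → s ∈ rs → Arc T r s → x ∈ R (cl r) → y ∈ R (cl s) → Arc T x y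
    between {r} {s} {x} {y} r∈ s∈ rs' x∈ y∈ =
      let (xM , ex) = R⊆ x∈
          (yM , ey) = R⊆ y∈
          ne : cl r ≢ cl s
          ne e = Arc⇒≢ T rs' (inj r∈ s∈ e)
          -- The arc from `r` to `s` is carried over in two moves: from `r` to `x` as seen from `s`,
          -- then from `s` to `y` as seen from `x`.
          sx : arc T s x ≡ false
          sx = trans (module-cl (rs⊆ s∈) ex (λ e → ne (sym (trans e ex)))) (Arc-asym T rs')
          xs : Arc T x s
          xs = ¬Arc T sx (λ { refl → ne (sym ex) })
      in trans (module-cl xM ey (λ e → ne (trans (sym ex) (trans e ey)))) xs
    expand : ∀ ps → Chain T ps → (∀ {r} → r ∈ ps → r ∈ rs) →
      Σ (List V) λ xs → Chain T xs × length xs ≡ ∑ ps (weight ∘ cl) × (∀ {x} → x ∈ xs → Σ V λ r → r ∈ ps × x ∈ R (cl r))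
    expand [] [] sub = [] , [] , refl , λ ()
    expand (p ∷ ps) (a ∷ c) sub =
      let (xs , cx , l , src) = expand ps c (sub ∘ there) in
      R (cl p) ++ xs ,
      Chain-++ T (proj₁ (proj₂ (classChain (cl p)))) cx
        (λ i j → let (r , r∈ , y∈) = src j in between (sub (here refl)) (sub (there r∈)) (All.lookup a r∈) i y∈) ,
      trans (length-++ (R (cl p))) (cong (weight (cl p) +_) l) ,
      λ i → [ (λ j → p , here refl , j) , (λ j → let (r , r∈ , x∈) = src j in r , there r∈ , x∈) ] (∈-++⁻ (R (cl p)) i)

  InjectiveOn : List V → Set
  InjectiveOn xs = ∀ {x y} → x ∈ xs → y ∈ xs → cl x ≡ cl y → x ≡ y

  injectiveOn-∷ : ∀ {x xs} → (∀ {y} → y ∈ xs → cl y ≢ cl x) → InjectiveOn xs → InjectiveOn (x ∷ xs)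
  injectiveOn-∷ fresh inj (here refl) (here refl) _ = refl
  injectiveOn-∷ fresh inj (here refl) (there k) e = ⊥-elim (fresh k (sym e))
  injectiveOn-∷ fresh inj (there i) (here refl) e = ⊥-elim (fresh i e)
  injectiveOn-∷ fresh inj (there i) (there k) = inj i k

  hits : V → V → Bool
  hits d j = anyᵇ (λ x → hit d x ∧ inClass j x) M

  g : V → ℕ
  g j = # (λ d → hits d j) D

  representatives : ∀ d js → Unique js → (∀ {j} → j ∈ js → hits d j ≡ true) →
    Σ (List V) λ xs → Unique xs × (∀ {x} → x ∈ xs → x ∈ M × hit d x ≡ true × cl x ∈ js) ×
      InjectiveOn xs × ∑ xs (weight ∘ cl) ≡ ∑ js weight
  representatives d [] u h = [] , [] , (λ ()) , (λ ()) , refl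
  representatives d (j ∷ js) (uj ∷ u) h with anyᵇ⁻ (λ x → hit d x ∧ inClass j x) M (h (here refl)) | representatives d js u (h ∘ there)
  ... | (x , x∈ , e) | (xs , ux , props , inj , sums) with ∧-true e
  ... | hx , ex with eqᵇ⇒≡ {x = cl x} {j} ex
  ... | refl = x ∷ xs , All.tabulate (λ i e → fresh i (cong cl (sym e))) ∷ ux ,
    (λ { (here refl) → x∈ , hx , here refl ; (there i) → let (a , b , c) = props i in a , b , there c }) ,
    injectiveOn-∷ fresh inj ,
    cong (weight (cl x) +_) sums
    where
    fresh : ∀ {y} → y ∈ xs → cl y ≢ cl x
    fresh i e = All.lookup uj (proj₂ (proj₂ (props i))) (sym e)

  -- Choose a hit vertex in each class met by `d`. A cyclic triangle among them would lie in one
  -- class, so they can be sorted into a chain, and `blowUp` applies.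
  hitClasses≤τ : ∀ {d} → d ∈ D → ∑ (allFin n) (λ j → ⟦ hits d j ⟧ * weight j) ≤ τ
  hitClasses≤τ {d} d∈ =
    let js = filterᵇ (hits d) (allFin n)
        (xs , ux , props , inj , sums) = representatives d js (AllPairs-filterᵇ (hits d) (UniqueP.allFin⁺ n))
          (λ i → proj₂ (∈-filterᵇ⁻ (hits d) (allFin n) i))
        (ys , cy , sub , sums') = sortChain T xs ux (λ {x} {y} {z} i j k a b c →
          let (xM , hx , _) = props i
              (yM , hy , _) = props j
              (zM , hz , _) = props k
          in Arc⇒≢ T a (inj i j (triangle-cl d∈ xM yM zM a b c hx hy hz)))
    in begin
    ∑ (allFin n) (λ j → ⟦ hits d j ⟧ * weight j) ≡⟨ sym (∑-filterᵇ (hits d) (allFin n) weight) ⟩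
    ∑ js weight ≡⟨ sym sums ⟩
    ∑ xs (weight ∘ cl) ≡⟨ sym (sums' (weight ∘ cl)) ⟩
    ∑ ys (weight ∘ cl) ≤⟨ blowUp ys cy (λ i → proj₁ (props (sub i))) (λ i j → inj (sub i) (sub j)) ⟩
    τ ∎

  dedupe : ∀ xs → Chain T xs → Σ (List V) λ ys → Chain T ys × (∀ {y} → y ∈ ys → y ∈ xs) ×
    InjectiveOn ys × (∀ {x} → x ∈ xs → Σ V λ y → y ∈ ys × cl y ≡ cl x)
  dedupe [] c = [] , [] , (λ ()) , (λ ()) , λ ()
  dedupe (x ∷ xs) (a ∷ c) with dedupe xs c | anyᵇ (inClass (cl x)) xs in eq
  ... | (ys , cy , sub , inj , cover) | true = ys , cy , there ∘ sub , inj , cov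
    where
    cov : ∀ {z} → z ∈ x ∷ xs → Σ V λ y → y ∈ ys × cl y ≡ cl z
    cov (there i) = cover i
    cov (here refl) = let (w , w∈ , e) = anyᵇ⁻ (inClass (cl x)) xs eq
                          (y , y∈ , e') = cover w∈ in y , y∈ , trans e' (eqᵇ⇒≡ e)
  ... | (ys , cy , sub , inj , cover) | false =
    x ∷ ys , All.tabulate (λ i → All.lookup a (sub i)) ∷ cy ,
    (λ { (here p) → here p ; (there i) → there (sub i) }) ,
    injectiveOn-∷ fresh inj ,
    λ { (here refl) → x , here refl , refl ; (there i) → let (y , y∈ , e) = cover i in y , there y∈ , e }
    where
    fresh : ∀ {y} → y ∈ ys → cl y ≢ cl x
    fresh {y} i e = f≢t eq (anyᵇ⁺ (inClass (cl x)) (sub i) (subst (λ j → eqᵇ (cl y) j ≡ true) e (eqᵇ-refl (cl y))))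

  -- A chain meets classes of total weight at most τ, so if it avoids the rich classes,
  -- which are those hit by at least weight j / 2τ of D, then it is hit by less than half of D.
  rich : V → Bool
  rich j = weight j * length D ≤ᵇ 2 * τ * g j

  poorPart : 2 * # (not ∘ rich ∘ cl) M < length M
  poorPart with 2 * # (not ∘ rich ∘ cl) M <? length M
  ... | yes p = p
  ... | no np = ⊥-elim (<⇒≱ tooFew enough)
    where
    -- If the poor part were at least half of `M`, heredity would yield in it a chain with at least
    -- `τ / 2` vertices, which half of `D` must hit.
    S = filterᵇ (not ∘ rich ∘ cl) M
    found = her S (AllPairs-filterᵇ (not ∘ rich ∘ cl) M-unique) (≤-<-trans (length-filterᵇ-≤ (not ∘ rich ∘ cl) M) M<n)
    C = proj₁ found
    cC = proj₁ (proj₂ found)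
    C⊆ : ∀ {x} → x ∈ C → x ∈ M × not (rich (cl x)) ≡ true
    C⊆ i = ∈-filterᵇ⁻ (not ∘ rich ∘ cl) M (proj₁ (proj₂ (proj₂ found)) i)
    long : τ ≤ 2 * length C
    long = half (length C) (begin
      length M ≤⟨ ≮⇒≥ np ⟩
      2 * # (not ∘ rich ∘ cl) M ≡⟨ cong (2 *_) (sym (length-filterᵇ (not ∘ rich ∘ cl) M)) ⟩
      2 * length S ≤⟨ *-monoʳ-≤ 2 (proj₂ (proj₂ (proj₂ found))) ⟩
      2 * length C ^ Q ∎)
    reps = dedupe C cC
    Y = proj₁ reps
    Y⊆C = proj₁ (proj₂ (proj₂ reps))
    cover = proj₂ (proj₂ (proj₂ (proj₂ reps)))
    -- The inequality in `tooFew` is strict because each class met by `Y` contributes a surplus of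
    -- at least 1.
    Y>0 : 0 < length Y
    Y>0 = let (x , x∈) = someElement C (positive long)
              (y , y∈ , _) = cover x∈
          in ∈⇒nonempty y∈
      where
      positive : ∀ {k} → τ ≤ 2 * k → 0 < k
      positive {zero} l = ⊥-elim (<⇒≱ τ>0 l)
      positive {suc k} l = s≤s z≤n
    hitBound : # (λ d → anyᵇ (hit d) C) D ≤ ∑ Y (g ∘ cl)
    hitBound = begin
      # (λ d → anyᵇ (hit d) C) D ≤⟨ ∑-mono D (λ {d} _ → pointwise d) ⟩
      ∑ D (λ d → ∑ Y (λ y → ⟦ hits d (cl y) ⟧)) ≡⟨ ∑-swap D Y _ ⟩
      ∑ Y (g ∘ cl) ∎
      where
      pointwise : ∀ d → ⟦ anyᵇ (hit d) C ⟧ ≤ ∑ Y (λ y → ⟦ hits d (cl y) ⟧)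
      pointwise d with anyᵇ (hit d) C in eq
      ... | false = z≤n
      ... | true with anyᵇ⁻ (hit d) C eq
      ... | (x , x∈ , hx) with cover x∈
      ... | (y , y∈ , e) = ≤-trans (≤-reflexive (cong ⟦_⟧ (sym (anyᵇ⁺ _ {x} (proj₁ (C⊆ x∈)) both)))) (∈⇒≤∑ (λ y → ⟦ hits d (cl y) ⟧) y∈)
        where
        both : hit d x ∧ inClass (cl y) x ≡ true
        both rewrite hx | e = eqᵇ-refl (cl x)
    poor : ∀ {y} → y ∈ Y → suc (2 * τ * g (cl y)) ≤ weight (cl y) * length D
    poor {y} i = ≤ᵇ-false (trans (sym (not-involutive _)) (cong not (proj₂ (C⊆ (Y⊆C i)))))
    tooFew : 2 * τ * ∑ Y (g ∘ cl) < τ * length D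
    tooFew = begin-strict
      2 * τ * ∑ Y (g ∘ cl) ≡⟨ sym (∑-*ˡ Y (2 * τ) (g ∘ cl)) ⟩
      ∑ Y (λ y → 2 * τ * g (cl y)) <⟨ m<n+m _ (≤-trans Y>0 (≤-reflexive (trans (sym (*-identityʳ _)) (sym (∑-const Y 1))))) ⟩
      ∑ Y (λ _ → 1) + ∑ Y (λ y → 2 * τ * g (cl y)) ≡⟨ sym (∑-+ Y (λ _ → 1) _) ⟩
      ∑ Y (λ y → suc (2 * τ * g (cl y))) ≤⟨ ∑-mono Y poor ⟩
      ∑ Y (λ y → weight (cl y) * length D) ≡⟨ ∑-*ʳ Y (length D) (weight ∘ cl) ⟩
      ∑ Y (weight ∘ cl) * length D ≤⟨ *-monoˡ-≤ (length D) (blowUp Y (proj₁ (proj₂ reps)) (proj₁ ∘ C⊆ ∘ Y⊆C) (proj₁ (proj₂ (proj₂ (proj₂ reps))))) ⟩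
      τ * length D ∎
    enough : τ * length D ≤ 2 * τ * ∑ Y (g ∘ cl)
    enough = begin
      τ * length D ≤⟨ *-monoʳ-≤ τ (hitsHalf C cC (proj₁ ∘ C⊆) long) ⟩
      τ * (2 * # (λ d → anyᵇ (hit d) C) D) ≤⟨ *-monoʳ-≤ τ (*-monoʳ-≤ 2 hitBound) ⟩
      τ * (2 * ∑ Y (g ∘ cl)) ≡⟨ trans (sym (*-assoc τ 2 _)) (cong (_* ∑ Y (g ∘ cl)) (*-comm τ 2)) ⟩
      2 * τ * ∑ Y (g ∘ cl) ∎

  -- Count the pairs of a `d` and a class hit by it, weighted by the class: each `d` contributes at
  -- most `τ`, while a rich class `j` is hit by at least a proportion `weight j / 2τ` of `D`.
  squares : ∑ (allFin n) (λ j → ⟦ rich j ⟧ * (weight j * weight j)) ≤ 2 * (τ * τ)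
  squares = *-cancelˡ-≤ (length D) {{>-nonZero D>0}} (begin
    length D * ∑ (allFin n) (λ j → ⟦ rich j ⟧ * (weight j * weight j)) ≡⟨ sym (∑-*ˡ (allFin n) (length D) _) ⟩
    ∑ (allFin n) (λ j → length D * (⟦ rich j ⟧ * (weight j * weight j))) ≤⟨ ∑-mono (allFin n) (λ {j} _ → pointwise j) ⟩
    ∑ (allFin n) (λ j → 2 * τ * (g j * weight j)) ≡⟨ ∑-*ˡ (allFin n) (2 * τ) _ ⟩
    2 * τ * ∑ (allFin n) (λ j → g j * weight j) ≡⟨ cong (2 * τ *_) (trans (∑-cong (allFin n) (λ {j} _ → sym (∑-*ʳ D (weight j) _)))
        (∑-swap (allFin n) D _)) ⟩
    2 * τ * ∑ D (λ d → ∑ (allFin n) (λ j → ⟦ hits d j ⟧ * weight j)) ≤⟨ *-monoʳ-≤ (2 * τ) (∑-bound D τ hitClasses≤τ) ⟩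
    2 * τ * (length D * τ) ≡⟨ regroup τ (length D) ⟩
    length D * (2 * (τ * τ)) ∎)
    where
    regroup : ∀ t d → 2 * t * (d * t) ≡ d * (2 * (t * t))
    regroup = solve-∀
    pointwise : ∀ j → length D * (⟦ rich j ⟧ * (weight j * weight j)) ≤ 2 * τ * (g j * weight j)
    pointwise j with weight j * length D ≤ᵇ 2 * τ * g j in eq
    ... | false = ≤-trans (≤-reflexive (*-zeroʳ (length D))) (z≤n {2 * τ * (g j * weight j)})
    ... | true = begin
      length D * (1 * (weight j * weight j)) ≡⟨ assoc₁ (length D) (weight j) ⟩
      weight j * length D * weight j ≤⟨ *-monoˡ-≤ (weight j) (≤ᵇ-true {weight j * length D} {2 * τ * g j} eq) ⟩
      2 * τ * g j * weight j ≡⟨ *-assoc (2 * τ) (g j) (weight j) ⟩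
      2 * τ * (g j * weight j) ∎
      where
      assoc₁ : ∀ d w → d * (1 * (w * w)) ≡ w * d * w
      assoc₁ = solve-∀

  -- `light` bounds each class by a multiple of its squared weight, and `squares` bounds the sum;
  -- the 16 in `light` against the 2 in `squares` leaves 8.
  richPart : 8 * # (rich ∘ cl) M ≤ length M
  richPart = *-cancelˡ-≤ (2 * (τ * τ)) {{m*n≢0 2 (τ * τ) {{_}} {{m*n≢0 τ τ {{>-nonZero τ>0}} {{>-nonZero τ>0}}}}}} (begin
    2 * (τ * τ) * (8 * # (rich ∘ cl) M) ≡⟨ regroup (τ * τ) (# (rich ∘ cl) M) ⟩
    16 * (τ * τ) * # (rich ∘ cl) M ≤⟨ *-monoʳ-≤ (16 * (τ * τ)) split ⟩
    16 * (τ * τ) * ∑ (allFin n) (λ j → ⟦ rich j ⟧ * # (inClass j) M) ≡⟨ sym (∑-*ˡ (allFin n) (16 * (τ * τ)) _) ⟩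
    ∑ (allFin n) (λ j → 16 * (τ * τ) * (⟦ rich j ⟧ * # (inClass j) M)) ≤⟨ ∑-mono (allFin n) (λ {j} _ → pointwise j) ⟩
    ∑ (allFin n) (λ j → length M * (⟦ rich j ⟧ * (weight j * weight j))) ≡⟨ ∑-*ˡ (allFin n) (length M) _ ⟩
    length M * ∑ (allFin n) (λ j → ⟦ rich j ⟧ * (weight j * weight j)) ≤⟨ *-monoʳ-≤ (length M) squares ⟩
    length M * (2 * (τ * τ)) ≡⟨ *-comm (length M) _ ⟩
    2 * (τ * τ) * length M ∎)
    where
    regroup : ∀ t x → 2 * t * (8 * x) ≡ 16 * t * x
    regroup = solve-∀
    exchange : ∀ a b c → a * (b * c) ≡ b * (a * c)
    exchange = solve-∀
    pointwise : ∀ j → 16 * (τ * τ) * (⟦ rich j ⟧ * # (inClass j) M) ≤ length M * (⟦ rich j ⟧ * (weight j * weight j))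
    pointwise j = begin
      16 * (τ * τ) * (⟦ rich j ⟧ * # (inClass j) M) ≡⟨ exchange (16 * (τ * τ)) ⟦ rich j ⟧ _ ⟩
      ⟦ rich j ⟧ * (16 * (τ * τ) * # (inClass j) M) ≤⟨ *-monoʳ-≤ ⟦ rich j ⟧ (light j (weight j)
          (≤-trans (≤-reflexive (sym (length-filterᵇ (inClass j) M))) (proj₂ (proj₂ (proj₂ (classChain j)))))) ⟩
      ⟦ rich j ⟧ * (length M * (weight j * weight j)) ≡⟨ exchange ⟦ rich j ⟧ (length M) _ ⟩
      length M * (⟦ rich j ⟧ * (weight j * weight j)) ∎
    split : # (rich ∘ cl) M ≤ ∑ (allFin n) (λ j → ⟦ rich j ⟧ * # (inClass j) M)
    split = begin
      # (rich ∘ cl) M ≤⟨ ∑-mono M (λ {x} _ → own x) ⟩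
      ∑ M (λ x → ∑ (allFin n) (λ j → ⟦ rich j ⟧ * ⟦ inClass j x ⟧)) ≡⟨ ∑-swap M (allFin n) _ ⟩
      ∑ (allFin n) (λ j → ∑ M (λ x → ⟦ rich j ⟧ * ⟦ inClass j x ⟧)) ≡⟨ ∑-cong (allFin n) (λ {j} _ → ∑-*ˡ M ⟦ rich j ⟧ _) ⟩
      ∑ (allFin n) (λ j → ⟦ rich j ⟧ * # (inClass j) M) ∎
      where
      own : ∀ x → ⟦ rich (cl x) ⟧ ≤ ∑ (allFin n) (λ j → ⟦ rich j ⟧ * ⟦ inClass j x ⟧)
      own x = ≤-trans (≤-reflexive (trans (sym (*-identityʳ _)) (cong (λ b → ⟦ rich (cl x) ⟧ * ⟦ b ⟧) (sym (eqᵇ-refl (cl x))))))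
        (∈⇒≤∑ (λ j → ⟦ rich j ⟧ * ⟦ inClass j x ⟧) (∈-allFin (cl x)))

  -- The rich classes cover at most an eighth of `M` and the poor ones less than half.
  impossible : ⊥
  impossible = <⇒≱ (begin-strict
    8 * length M ≡⟨ trans (cong (8 *_) (sym (#-not (rich ∘ cl) M))) (*-distribˡ-+ 8 (# (rich ∘ cl) M) _) ⟩
    8 * # (rich ∘ cl) M + 8 * # (not ∘ rich ∘ cl) M ≡⟨ cong (8 * # (rich ∘ cl) M +_) (*-assoc 4 2 (# (not ∘ rich ∘ cl) M)) ⟩
    8 * # (rich ∘ cl) M + 4 * (2 * # (not ∘ rich ∘ cl) M) <⟨ +-mono-≤-< richPart (*-monoʳ-< 4 poorPart) ⟩
    length M + 4 * length M ∎) (*-monoˡ-≤ (length M) (m≤m+n 5 3))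

-- Critical tournaments

-- Bernoulli's inequality for `(1 + 1 / a) ^ q`, cleared of denominators.
bernoulli : ∀ a q → (a + q) * a ^ q ≤ a * suc a ^ q
bernoulli a zero = ≤-reflexive (cong (_* 1) (+-identityʳ a))
bernoulli a (suc q) = begin
  (a + suc q) * (a * a ^ q) ≡⟨ shuffle₁ a q (a ^ q) ⟩
  (a * a + a * suc q) * a ^ q ≤⟨ *-monoˡ-≤ (a ^ q) (≤-trans (m≤m+n _ q) (≤-reflexive (shuffle₂ a q))) ⟩
  suc a * (a + q) * a ^ q ≡⟨ *-assoc (suc a) (a + q) (a ^ q) ⟩
  suc a * ((a + q) * a ^ q) ≤⟨ *-monoʳ-≤ (suc a) (bernoulli a q) ⟩
  suc a * (a * suc a ^ q) ≡⟨ shuffle₃ a (suc a ^ q) ⟩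
  a * (suc a * suc a ^ q) ∎
  where
  open ≤-Reasoning
  shuffle₁ : ∀ a q p → (a + (1 + q)) * (a * p) ≡ (a * a + a * (1 + q)) * p
  shuffle₁ = solve-∀
  shuffle₂ : ∀ a q → a * a + a * (1 + q) + q ≡ (1 + a) * (a + q)
  shuffle₂ = solve-∀
  shuffle₃ : ∀ a p → (1 + a) * (a * p) ≡ a * ((1 + a) * p)
  shuffle₃ = solve-∀

-- This determines how large the exponent must be for `(1 + 1 / a) ^ q` to outweigh a loss of `Z` in
-- set sizes.
powerGap : ∀ a Z q → 0 < a → a * Z ≤ q → Z * a ^ q ≤ suc a ^ q
powerGap a Z q a>0 le = *-cancelˡ-≤ a {{>-nonZero a>0}} (begin
  a * (Z * a ^ q) ≡⟨ sym (*-assoc a Z _) ⟩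
  a * Z * a ^ q ≤⟨ *-monoˡ-≤ (a ^ q) (≤-trans le (m≤n+m q a)) ⟩
  (a + q) * a ^ q ≤⟨ bernoulli a q ⟩
  a * suc a ^ q ∎)
  where open ≤-Reasoning

n≤2^n : ∀ n → n ≤ 2 ^ n
n≤2^n zero = z≤n
n≤2^n (suc n) = ≤-trans (+-mono-≤ (m^n>0 2 n) (n≤2^n n)) (≤-reflexive (cong (2 ^ n +_) (sym (+-identityʳ _))))

^-distribʳ-* : ∀ m k q → (m * k) ^ q ≡ m ^ q * k ^ q
^-distribʳ-* m k zero = refl
^-distribʳ-* m k (suc q) rewrite ^-distribʳ-* m k q = interchange m k (m ^ q) (k ^ q)
  where
  interchange : ∀ a b c d → (a * b) * (c * d) ≡ (a * c) * (b * d)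
  interchange = solve-∀

twiceCount : ∀ {A : Set} (p : A → Bool) xs → ¬ (length xs ≤ 2 * # p xs) → length xs ≤ 2 * # (not ∘ p) xs
twiceCount p xs h = +-cancelˡ-≤ (2 * # p xs) _ _ (begin
  2 * # p xs + length xs ≤⟨ +-monoˡ-≤ (length xs) (<⇒≤ (≰⇒> h)) ⟩
  length xs + length xs ≡⟨ cong (length xs +_) (sym (+-identityʳ _)) ⟩
  2 * length xs ≡⟨ cong (2 *_) (sym (#-not p xs)) ⟩
  2 * (# p xs + # (not ∘ p) xs) ≡⟨ *-distribˡ-+ 2 (# p xs) _ ⟩
  2 * # p xs + 2 * # (not ∘ p) xs ∎)
  where open ≤-Reasoning

-- `τ` bounds the chains and lies below the `Q`-th root of `n`; `Z` bounds the losses in set sizes.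
-- By `gap₂` and `gapₐ` the `Q`-th root of `Z` is at most 2 and at most `1 + 1 / a`, so a set of
-- `n / Z` vertices still has a chain of nearly `τ` vertices.
module Critical {n} (T : Tournament n) (Q' Z a τ : ℕ)
  (her : Hereditary T (2 + Q')) (bounded : ∀ {R} → Chain T R → length R ≤ τ) (τ^Q<n : τ ^ (2 + Q') < n) (τ>0 : 0 < τ)
  (gap₂ : 16 * Z ≤ 2 ^ Q') (a>0 : 0 < a) (gapₐ : Z * a ^ (2 + Q') ≤ suc a ^ (2 + Q'))
  where

  open ≤-Reasoning
  V = Fin n
  Q = 2 + Q'

  n>0 : 0 < n
  n>0 = ≤-trans (s≤s z≤n) τ^Q<n

  Z≤2^Q' : Z ≤ 2 ^ Q'
  Z≤2^Q' = ≤-trans (m≤m+n Z (15 * Z)) gap₂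

  Z≤2^Q : Z ≤ 2 ^ Q
  Z≤2^Q = ≤-trans Z≤2^Q' (^-monoʳ-≤ 2 (m≤n+m Q' 2))

  -- Raising the last inequality to the power `Q` contradicts `τ ^ Q < n`. The ratio `b / suc c`
  -- will be `1 / 2` or `a / suc a`.
  rootBound : ∀ b c k → n ≤ Z * k ^ Q → Z * b ^ Q ≤ suc c ^ Q → suc c * k ≤ b * τ → ⊥
  rootBound b c k n≤ gap ck≤ = <⇒≱ (begin-strict
    n * suc c ^ Q ≤⟨ *-monoˡ-≤ (suc c ^ Q) n≤ ⟩
    Z * k ^ Q * suc c ^ Q ≡⟨ *-assoc Z _ _ ⟩
    Z * (k ^ Q * suc c ^ Q) ≡⟨ cong (Z *_) (trans (*-comm (k ^ Q) _) (sym (^-distribʳ-* (suc c) k Q))) ⟩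
    Z * (suc c * k) ^ Q ≤⟨ *-monoʳ-≤ Z (^-monoˡ-≤ Q ck≤) ⟩
    Z * (b * τ) ^ Q ≡⟨ trans (cong (Z *_) (^-distribʳ-* b τ Q)) (sym (*-assoc Z _ _)) ⟩
    Z * b ^ Q * τ ^ Q ≤⟨ *-monoˡ-≤ (τ ^ Q) gap ⟩
    suc c ^ Q * τ ^ Q <⟨ *-monoʳ-< (suc c ^ Q) {{>-nonZero (m^n>0 (suc c) Q)}} τ^Q<n ⟩
    suc c ^ Q * n ∎) (≤-reflexive (*-comm (suc c ^ Q) n))

  halfRoot : ∀ k → n ≤ Z * k ^ Q → τ ≤ 2 * k
  halfRoot k n≤ with τ ≤? 2 * k
  ... | yes p = p
  ... | no np = ⊥-elim (rootBound 1 1 k n≤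
    (≤-trans (≤-reflexive (trans (cong (Z *_) (^-zeroˡ Q)) (*-identityʳ Z))) Z≤2^Q)
    (≤-trans (<⇒≤ (≰⇒> np)) (≤-reflexive (sym (+-identityʳ τ)))))

  -- `Y` contains a chain with more than `a * τ / suc a` vertices, and `R` supplies the missing
  -- `τ / suc a`. Which of the two comes first is left to `extend`.
  noExtension : ∀ {R Y : List V} → τ ≤ suc a * length R → Unique Y → length Y < n → n ≤ Z * length Y →
    (∀ {Y'} → Chain T Y' → (∀ {y} → y ∈ Y' → y ∈ Y) → length Y' + length R ≤ τ) → ⊥
  noExtension {R} {Y} long u Y<n large extend with her Y u Y<n
  ... | (Y' , c , sub , root) = rootBound a a (length Y') (≤-trans large (*-monoʳ-≤ Z root)) gapₐ
    (+-cancelˡ-≤ τ _ _ (begin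
      τ + suc a * length Y' ≤⟨ +-monoˡ-≤ _ long ⟩
      suc a * length R + suc a * length Y' ≡⟨ sym (*-distribˡ-+ (suc a) (length R) _) ⟩
      suc a * (length R + length Y') ≡⟨ cong (suc a *_) (+-comm (length R) _) ⟩
      suc a * (length Y' + length R) ≤⟨ *-monoʳ-≤ (suc a) (extend c sub) ⟩
      τ + a * τ ∎))

  -- The power Q makes classes with short chains tiny; for the others the factor 64 suffices.
  lightClass : ∀ {m s} k → n ≤ Z * m → 64 * s ≤ m → s ≤ k ^ Q → 16 * (τ * τ) * s ≤ m * (k * k)
  lightClass {m} {s} k n≤ 64s≤m s≤ with τ ≤? 2 * k
  ... | yes τ≤2k = begin
    16 * (τ * τ) * s ≤⟨ *-monoˡ-≤ s (*-monoʳ-≤ 16 (*-mono-≤ τ≤2k τ≤2k)) ⟩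
    16 * (2 * k * (2 * k)) * s ≡⟨ shuffle k s ⟩
    64 * s * (k * k) ≤⟨ *-monoˡ-≤ (k * k) 64s≤m ⟩
    m * (k * k) ∎
    where
    shuffle : ∀ k s → 16 * (2 * k * (2 * k)) * s ≡ 64 * s * (k * k)
    shuffle = solve-∀
  ... | no np = *-cancelʳ-≤ _ _ (2 ^ Q') {{m^n≢0 2 Q'}} (begin
    16 * (τ * τ) * s * 2 ^ Q' ≤⟨ *-monoˡ-≤ (2 ^ Q') (*-monoʳ-≤ (16 * (τ * τ)) s≤) ⟩
    16 * (τ * τ) * (k * (k * k ^ Q')) * 2 ^ Q' ≡⟨ shuffle τ k (k ^ Q') (2 ^ Q') ⟩
    16 * (k * k) * (τ * (τ * (2 ^ Q' * k ^ Q'))) ≡⟨ cong (λ x → 16 * (k * k) * (τ * (τ * x))) (sym (^-distribʳ-* 2 k Q')) ⟩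
    16 * (k * k) * (τ * (τ * (2 * k) ^ Q')) ≤⟨ *-monoʳ-≤ (16 * (k * k)) (*-monoʳ-≤ τ (*-monoʳ-≤ τ (^-monoˡ-≤ Q' (<⇒≤ (≰⇒> np))))) ⟩
    16 * (k * k) * τ ^ Q ≤⟨ *-monoʳ-≤ (16 * (k * k)) (≤-trans (<⇒≤ τ^Q<n) n≤) ⟩
    16 * (k * k) * (Z * m) ≡⟨ shuffle' k Z m ⟩
    m * (k * k) * (16 * Z) ≤⟨ *-monoʳ-≤ (m * (k * k)) gap₂ ⟩
    m * (k * k) * 2 ^ Q' ∎)
    where
    shuffle : ∀ t k x y → 16 * (t * t) * (k * (k * x)) * y ≡ 16 * (k * k) * (t * (t * (y * x)))
    shuffle = solve-∀
    shuffle' : ∀ k z m → 16 * (k * k) * (z * m) ≡ m * (k * k) * (16 * z)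
    shuffle' = solve-∀

  -- `hit` stands for backward arcs in either direction, so that left and right boats share one
  -- proof; `join` concatenates the chains in the matching order.
  module _ (M D : List V) (M-unique : Unique M) (D-unique : Unique D) (M<n : length M < n) (D<n : length D < n)
    (z : ℕ) (2z≤Z : 2 * z ≤ Z) (M-large : n ≤ z * length M) (D-large : n ≤ z * length D)
    (64≤M : 64 ≤ length M) (hit : V → V → Bool)
    (sparse : ∀ {d} → d ∈ D → 64 * # (hit d) M ≤ length M)
    (join : ∀ {R Y} → Chain T R → Chain T Y → (∀ {x} → x ∈ R → x ∈ M) → (∀ {y} → y ∈ Y → y ∈ D) →
      (∀ {x d} → x ∈ R → d ∈ Y → hit d x ≡ false) → length Y + length R ≤ τ)
    where

    Boat : Set
    Boat = Σ V λ d → Σ V λ u → Σ V λ v → Σ V λ w → (d ∈ D × u ∈ M × v ∈ M × w ∈ M) ×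
      (Arc T u v × Arc T v w × Arc T w u) × (hit d u ≡ true × hit d v ≡ true × hit d w ≡ false)

    z≤Z : ∀ m → z * m ≤ Z * m
    z≤Z m = *-monoˡ-≤ m (≤-trans (m≤m+n z _) 2z≤Z)

    doubled : ∀ {m k} → n ≤ z * m → m ≤ 2 * k → n ≤ Z * k
    doubled {m} {k} l l' = begin
      n ≤⟨ l ⟩ z * m ≤⟨ *-monoʳ-≤ z l' ⟩ z * (2 * k) ≡⟨ trans (sym (*-assoc z 2 k)) (cong (_* k) (*-comm z 2)) ⟩
      2 * z * k ≤⟨ *-monoˡ-≤ k 2z≤Z ⟩ Z * k ∎

    D>0 : 0 < length D
    D>0 = *-cancelˡ-< z 0 (length D) (≤-trans (s≤s (≤-reflexive (*-zeroʳ z))) (≤-trans n>0 D-large))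

    -- Otherwise half of `D` misses `R`, and a chain from that half could be joined to `R`, against
    -- `noExtension`.
    hitsHalf : ∀ R → Chain T R → (∀ {x} → x ∈ R → x ∈ M) → τ ≤ 2 * length R →
      length D ≤ 2 * # (λ d → anyᵇ (hit d) R) D
    hitsHalf R c R⊆M long with length D ≤? 2 * # (λ d → anyᵇ (hit d) R) D
    ... | yes p = p
    ... | no np = ⊥-elim (noExtension {R} {Y} (≤-trans long (*-monoˡ-≤ (length R) (s≤s a>0)))
        (AllPairs-filterᵇ miss D-unique) (≤-<-trans (length-filterᵇ-≤ miss D) D<n)
        (doubled D-large (≤-trans (twiceCount (λ d → anyᵇ (hit d) R) D np) (≤-reflexive (cong (2 *_) (sym (length-filterᵇ miss D))))))
        (λ cY sub → join c cY R⊆M (λ i → proj₁ (∈-filterᵇ⁻ miss D (sub i)))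
          (λ {x} {d} x∈ d∈ → missed x∈ (proj₂ (∈-filterᵇ⁻ miss D (sub d∈))))))
      where
      miss : V → Bool
      miss d = not (anyᵇ (hit d) R)
      Y = filterᵇ miss D
      missed : ∀ {x d} → x ∈ R → miss d ≡ true → hit d x ≡ false
      missed {x} {d} x∈ e with hit d x in eq
      ... | false = refl
      ... | true with anyᵇ (hit d) R | anyᵇ⁺ (hit d) x∈ eq
      missed x∈ () | true | true | _

    quadruples : List (V × V × V × V)
    quadruples = cartesianProduct D (cartesianProduct M (cartesianProduct M M))

    isBoat : V × V × V × V → Bool
    isBoat (d , u , v , w) = (arc T u v ∧ (arc T v w ∧ arc T w u)) ∧ (hit d u ∧ (hit d v ∧ not (hit d w)))

    boatExists : Boat
    boatExists with anyᵇ isBoat quadruples in eq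
    ... | true =
      let ((d , u , v , w) , m , t) = anyᵇ⁻ isBoat quadruples eq
          (d∈ , m') = ∈-cartesianProduct⁻ D _ m
          (u∈ , m'') = ∈-cartesianProduct⁻ M _ m'
          (v∈ , w∈) = ∈-cartesianProduct⁻ M _ m''
          (as , hs) = ∧-true t
          (a₁ , as') = ∧-true as
          (h₁ , hs') = ∧-true hs
          (h₂ , h₃) = ∧-true hs'
      in d , u , v , w , (d∈ , u∈ , v∈ , w∈) , (a₁ , ∧-true as') , (h₁ , h₂ , trans (sym (not-involutive _)) (cong not h₃))
    -- A failed search is the hypothesis of `HitStructure`, whose classes then satisfy the
    -- assumptions of `Counting`.
    ... | false = ⊥-elim impossible
      where
      noBoat : ∀ {d u v w} → d ∈ D → u ∈ M → v ∈ M → w ∈ M → Arc T u v → Arc T v w → Arc T w u →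
        hit d u ≡ true → hit d v ≡ true → hit d w ≡ true
      noBoat {d} {u} {v} {w} d∈ u∈ v∈ w∈ a₁ a₂ a₃ h₁ h₂ with hit d w in h₃
      ... | true = refl
      ... | false = ⊥-elim (f≢t eq (anyᵇ⁺ isBoat {d , u , v , w}
        (∈-cartesianProduct⁺ d∈ (∈-cartesianProduct⁺ u∈ (∈-cartesianProduct⁺ v∈ w∈))) yes-test))
        where
        yes-test : (arc T u v ∧ (arc T v w ∧ arc T w u)) ∧ (hit d u ∧ (hit d v ∧ not (hit d w))) ≡ true
        yes-test rewrite a₁ | a₂ | a₃ | h₁ | h₂ | h₃ = refl
      open HitStructure T M D hit noBoat
      small : ∀ j → 64 * # (λ x → eqᵇ (cl x) j) M ≤ length M
      small j with class-small M-unique j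
      ... | inj₁ l = ≤-trans (*-monoʳ-≤ 64 l) 64≤M
      ... | inj₂ (d , d∈ , l) = ≤-trans (*-monoʳ-≤ 64 l) (sparse d∈)
      open Counting T Q τ M D hit cl her M-unique M<n bounded class-module triangle⇒cl
        (λ j k → lightClass k (≤-trans M-large (z≤Z _)) (small j))
        (λ k l → halfRoot k (doubled M-large l)) hitsHalf τ>0 D>0
        using (impossible)

-- Sets assigned to the positions of H

∑-take-drop : ∀ {A : Set} k (xs : List A) (f : A → ℕ) → ∑ (take k xs) f + ∑ (drop k xs) f ≡ ∑ xs f
∑-take-drop k xs f = trans (sym (∑-++ (take k xs) (drop k xs) f)) (cong (λ ys → ∑ ys f) (take++drop≡id k xs))

∑-chunk : ∀ {A : Set} {k} s (i : Fin k) (xs : List A) (f : A → ℕ) → ∑ (chunk s i xs) f ≤ ∑ xs f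
∑-chunk s zero xs f = ≤-trans (m≤m+n _ _) (≤-reflexive (∑-take-drop s xs f))
∑-chunk s (suc i) xs f = ≤-trans (∑-chunk s i (drop s xs) f) (≤-trans (m≤n+m _ _) (≤-reflexive (∑-take-drop s xs f)))

-- Parity serves as the flag `linear?` of the tower: odd indices hold sets of linear size, for
-- marked positions, and even ones chains.
odd : ℕ → Bool
odd 0 = false
odd 1 = true
odd (suc (suc k)) = odd k

odd-slot : ∀ b c → odd (⟦ b ⟧ + c * 2) ≡ b
odd-slot true zero = refl
odd-slot false zero = refl
odd-slot true (suc c) = odd-slot true c
odd-slot false (suc c) = odd-slot false c

_<ᶠ_ : ∀ {h} → Fin h → Fin h → Bool
p <ᶠ q = toℕ p <ᵇ toℕ q

true-<ᶠ : ∀ {h} {p q : Fin h} → (p <ᶠ q) ≡ true → p F.< q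
true-<ᶠ {p = p} {q} e = <ᵇ⇒< (toℕ p) (toℕ q) (subst IsTrue (sym e) _)

<ᶠ-true : ∀ {h} {p q : Fin h} → p F.< q → (p <ᶠ q) ≡ true
<ᶠ-true {p = p} {q} l with toℕ p <ᵇ toℕ q | <⇒<ᵇ l
... | true | _ = refl

<ᶠ-false : ∀ {h} {p q : Fin h} → ¬ (p F.< q) → (p <ᶠ q) ≡ false
<ᶠ-false {p = p} {q} n = not-¬ (n ∘ true-<ᶠ {p = p} {q})

-- Slots of an ordered set of positions, some of which are marked: a marked position gets an odd
-- slot of its own, a maximal run of unmarked positions shares an even slot.
module Slots {h} (marked : Fin h → Bool) where

  before : Fin h → ℕ
  before p = # (λ r → (r <ᶠ p) ∧ marked r) (allFin h)

  slot : Fin h → ℕ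
  slot p = ⟦ marked p ⟧ + before p * 2

  before-mono : ∀ {p q} → p F.< q → ⟦ marked p ⟧ + before p ≤ before q
  before-mono {p} {q} l = begin
    ⟦ marked p ⟧ + before p ≤⟨ +-monoˡ-≤ (before p) own ⟩
    # (λ r → eqᵇ r p ∧ marked r) (allFin h) + before p ≡⟨ sym (∑-+ (allFin h) _ _) ⟩
    ∑ (allFin h) (λ r → ⟦ eqᵇ r p ∧ marked r ⟧ + ⟦ (r <ᶠ p) ∧ marked r ⟧) ≤⟨ ∑-mono (allFin h) (λ {r} _ → pointwise r) ⟩
    before q ∎
    where
    open ≤-Reasoning
    own : ⟦ marked p ⟧ ≤ # (λ r → eqᵇ r p ∧ marked r) (allFin h)
    own = ≤-trans (≤-reflexive (cong (λ b → ⟦ b ∧ marked p ⟧) (sym (eqᵇ-refl p))))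
      (∈⇒≤∑ (λ r → ⟦ eqᵇ r p ∧ marked r ⟧) (∈-allFin p))
    pointwise : ∀ r → ⟦ eqᵇ r p ∧ marked r ⟧ + ⟦ (r <ᶠ p) ∧ marked r ⟧ ≤ ⟦ (r <ᶠ q) ∧ marked r ⟧
    pointwise r with r FP.≟ p | r <ᶠ p in e
    ... | yes refl | true = ⊥-elim (FP.<-irrefl refl (true-<ᶠ {p = r} {r} e))
    ... | yes refl | false rewrite <ᶠ-true l = ≤-reflexive (+-identityʳ _)
    ... | no _ | true rewrite <ᶠ-true (FP.<-trans (true-<ᶠ {p = r} {p} e) l) = ≤-refl
    ... | no _ | false = z≤n

  slot-mono : ∀ {p q} → p F.< q → slot p < slot q ⊎ (marked p ≡ false × marked q ≡ false × slot p ≡ slot q)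
  slot-mono {p} {q} l with marked p in ep | marked q in eq | before-mono l
  ... | true | b | le = inj₁ (≤-trans (≤-reflexive refl) (≤-trans (*-monoˡ-≤ 2 le) (m≤n+m _ ⟦ b ⟧)))
  ... | false | true | le = inj₁ (s≤s (*-monoˡ-≤ 2 le))
  ... | false | false | le with m≤n⇒m<n∨m≡n le
  ... | inj₁ lt = inj₁ (*-monoˡ-< 2 lt)
  ... | inj₂ e = inj₂ (refl , refl , cong (_* 2) e)

  slot-run : ∀ {p q} → p F.< q → marked p ≡ false → marked q ≡ false →
    (∀ r → p F.< r → r F.< q → marked r ≡ false) → slot p ≡ slot q
  slot-run {p} {q} l mp mq gap rewrite mp | mq = cong (_* 2) (≤-antisym
    (≤-trans (m≤n+m (before p) ⟦ marked p ⟧) (before-mono l))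
    (#-mono (allFin h) (λ {r} _ e → let (e₁ , e₂) = ∧-true e in back r e₂ (true-<ᶠ {p = r} {q} e₁))))
    where
    back : ∀ r → marked r ≡ true → r F.< q → ((r <ᶠ p) ∧ marked r) ≡ true
    back r mr rq with FP.<-cmp r p
    ... | tri< rp _ _ rewrite <ᶠ-true rp = mr
    ... | tri≈ _ refl _ = ⊥-elim (f≢t mp mr)
    ... | tri> _ _ pr = ⊥-elim (f≢t (gap r pr rq) mr)

  slot-bound : ∀ p → slot p < 2 + h * 2
  slot-bound p = s≤s (+-mono-≤ (⟦⟧≤1 (marked p)) (*-monoˡ-≤ 2 (≤-trans (#≤length _ (allFin h)) (≤-reflexive (length-allFin h)))))

module _ {n} (T : Tournament n) where

  forward : ∀ {h} → Fin h → Fin h → Fin n → Fin n → Bool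
  forward p q v w = if p <ᶠ q then arc T v w else arc T w v

  forward-< : ∀ {h} {p q : Fin h} {v w} → p F.< q → forward p q v w ≡ arc T v w
  forward-< l rewrite <ᶠ-true l = refl

  forward-> : ∀ {h} {p q : Fin h} {v w} → q F.< p → forward p q v w ≡ arc T w v
  forward-> {p = p} {q} l rewrite <ᶠ-false {p = p} {q} (λ l' → FP.<-asym l l') = refl

-- `A p` holds the candidates for position `p`. Unlike in a tower, smoothness goes both ways;
-- `A-aligned` reflects that unmarked positions with a common slot receive pieces of one chain.
record Frame {n} (T : Tournament n) (τ : ℕ) {k} (marked : Fin (suc k) → Bool) (Λ C : ℕ) : Set where
  open Slots marked
  field
    A : Fin (suc k) → List (Fin n)
    A<n : ∀ p → length (A p) < n
    A-unique : ∀ p → Unique (A p)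
    A-marked : ∀ p → marked p ≡ true → n ≤ C * length (A p)
    A-chain : ∀ p → marked p ≡ false → Chain T (A p) × τ ≤ 8 * suc k * length (A p)
    A-smooth : ∀ p q → p ≢ q → ∀ {v} → v ∈ A p → Λ * # (λ w → not (forward T p q v w)) (A q) ≤ length (A q)
    A-disjoint : ∀ p q → p ≢ q → ∀ {v w} → v ∈ A p → w ∈ A q → v ≢ w
    A-aligned : ∀ p q → p F.< q → slot p ≡ slot q → ∀ {v w} → v ∈ A p → w ∈ A q → Arc T v w

-- Of the smoothness `4 * h * h * (2 * Λ)`, where `h` is `suc k`, one factor `2 * h` pays for
-- cutting chains into pieces, another for discarding exceptional vertices, and the last 2 for the
-- halving of the sets.
module Framing {n} (T : Tournament n) (Q τ : ℕ) {k} (marked : Fin (suc k) → Bool) (Λ C : ℕ) (X : List (Fin n))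
  (X<n : length X < n) (n≤2X : n ≤ 2 * length X) (h≤τ : 2 * suc k ≤ τ)
  (halfRoot : ∀ m → n ≤ 2 * C * m ^ Q → τ ≤ 2 * m)
  (tow : Tower T Q X (2 + suc k * 2) C (4 * suc k * suc k * (2 * Λ)) odd)
  where

  open ≤-Reasoning
  open Slots marked
  open Tower tow
  V = Fin n
  h = suc k

  widen : ∀ {m} → length X ≤ C * m → n ≤ 2 * C * m
  widen {m} l = ≤-trans n≤2X (≤-trans (*-monoʳ-≤ 2 l) (≤-reflexive (sym (*-assoc 2 C m))))

  S : Fin h → List V
  S p = F (slot p)

  S-marked : ∀ p → marked p ≡ true → Unique (S p) × n ≤ 2 * C * length (S p)
  S-marked p e = let (u , l) = linear (slot p) (slot-bound p) (trans (odd-slot (marked p) (before p)) e) in u , widen l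

  S-chain : ∀ p → marked p ≡ false → Chain T (S p) × τ ≤ 2 * length (S p)
  S-chain p e = let (c , l) = chain (slot p) (slot-bound p) (trans (odd-slot (marked p) (before p)) e)
                in c , halfRoot (length (S p)) (widen l)

  pieceSize : ∀ p → marked p ≡ false → Σ ℕ λ s → h * s ≤ length (S p) × length (S p) ≤ 2 * h * s
  pieceSize p e = chunkSize k (*-cancelˡ-≤ 2 (≤-trans h≤τ (proj₂ (S-chain p e))))

  -- The chunk has number `p` itself, so positions that share a chain receive disjoint pieces in
  -- their own order. The Boolean and its equation are arguments so that they can be matched on.
  piece : ∀ p b → marked p ≡ b → List V
  piece p true e = S p
  piece p false e = chunk (proj₁ (pieceSize p e)) p (S p)

  A₀ : Fin h → List V
  A₀ p = piece p (marked p) refl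

  piece⊆ : ∀ p b e {x} → x ∈ piece p b e → x ∈ S p
  piece⊆ p true e i = i
  piece⊆ p false e i = ∈-chunk _ p (S p) i

  piece-∑ : ∀ p b e (f : V → ℕ) → ∑ (piece p b e) f ≤ ∑ (S p) f
  piece-∑ p true e f = ≤-refl
  piece-∑ p false e f = ∑-chunk _ p (S p) f

  piece-large : ∀ p b e → length (S p) ≤ 2 * h * length (piece p b e)
  piece-large p true e = m≤m+n _ _
  piece-large p false e = let (s , fits , covers) = pieceSize p e in
    ≤-trans covers (≤-reflexive (cong (2 * h *_) (sym (length-chunk s p (S p) fits))))

  A₀>0 : ∀ p → 0 < length (A₀ p)
  A₀>0 p = *-cancelˡ-< (2 * h) 0 _ (≤-trans (s≤s (≤-reflexive (*-zeroʳ (2 * h)))) (≤-trans (go (marked p) refl) (piece-large p _ refl)))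
    where
    go : ∀ b → marked p ≡ b → 0 < length (S p)
    go true e = *-cancelˡ-< (2 * C) 0 _ (≤-trans (s≤s (≤-reflexive (*-zeroʳ (2 * C)))) (≤-trans (≤-trans (s≤s z≤n) X<n) (proj₂ (S-marked p e))))
    go false e = *-cancelˡ-< 2 0 _ (≤-trans (≤-trans (s≤s z≤n) h≤τ) (proj₂ (S-chain p e)))

  A₀-unique : ∀ p → Unique (A₀ p)
  A₀-unique p = go (marked p) refl
    where
    go : ∀ b e → Unique (piece p b e)
    go true e = proj₁ (S-marked p e)
    go false e = AllPairs-chunk _ p (Chain⇒Unique T (proj₁ (S-chain p e)))

  A₀-aligned : ∀ p q → p F.< q → slot p ≡ slot q → ∀ {v w} → v ∈ A₀ p → w ∈ A₀ q → Arc T v w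
  A₀-aligned p q l e {v} {w} v∈ w∈ with slot-mono l
  ... | inj₁ lt = ⊥-elim (<-irrefl e lt)
  ... | inj₂ (mp , mq , _) = go (marked p) refl (marked q) refl mp mq v∈ w∈
    where
    go : ∀ b e₁ b' e₂ → b ≡ false → b' ≡ false → v ∈ piece p b e₁ → w ∈ piece q b' e₂ → Arc T v w
    go false e₁ false e₂ _ _ i j = chunk-ordered (proj₁ (pieceSize p e₁)) (proj₁ (S-chain p e₁)) l i
      (subst (w ∈_) (cong₂ (λ s xs → chunk s q xs) sameSize (cong F (sym e))) j)
      where
      sameSize : proj₁ (pieceSize q e₂) ≡ proj₁ (pieceSize p e₁)
      sameSize = cong (λ xs → length xs / h) (cong F (sym e))

  A₀-disjoint : ∀ p q → p F.< q → ∀ {v w} → v ∈ A₀ p → w ∈ A₀ q → v ≢ w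
  A₀-disjoint p q l v∈ w∈ with slot-mono l
  ... | inj₁ lt = disjoint _ _ lt (slot-bound q) (piece⊆ p _ refl v∈) (piece⊆ q _ refl w∈)
  ... | inj₂ (_ , _ , e) = Arc⇒≢ T (A₀-aligned p q l e v∈ w∈)

  sparse₀ : ∀ p q → p F.< q → 2 * h * (2 * Λ) * ∑ (A₀ q) (λ w → # (λ v → nonarc T v w) (A₀ p)) ≤ length (A₀ q) * length (A₀ p)
  sparse₀ p q l with slot-mono l
  ... | inj₂ (_ , _ , e) = ≤-trans (≤-reflexive (trans (cong (2 * h * (2 * Λ) *_) none) (*-zeroʳ (2 * h * (2 * Λ))))) z≤n
    where
    none : ∑ (A₀ q) (λ w → # (λ v → nonarc T v w) (A₀ p)) ≡ 0
    none = trans (∑-cong (A₀ q) (λ {w} w∈ → trans (∑-cong (A₀ p) (λ {v} v∈ → cong (λ b → ⟦ not b ⟧) (A₀-aligned p q l e v∈ w∈))) (∑-zero (A₀ p)))) (∑-zero (A₀ q))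
  ... | inj₁ lt = *-cancelˡ-≤ (2 * h) (begin
    2 * h * (2 * h * (2 * Λ) * E) ≡⟨ regroup h (2 * Λ) E ⟩
    4 * h * h * (2 * Λ) * E ≡⟨ sym (∑-*ˡ (A₀ q) (4 * h * h * (2 * Λ)) _) ⟩
    ∑ (A₀ q) (λ w → 4 * h * h * (2 * Λ) * # (λ v → nonarc T v w) (A₀ p)) ≤⟨ ∑-bound (A₀ q) (length (S p)) (λ {w} w∈ →
      ≤-trans (*-monoʳ-≤ (4 * h * h * (2 * Λ)) (piece-∑ p _ refl _)) (smooth (slot p) (slot q) lt (slot-bound q) (piece⊆ q _ refl w∈))) ⟩
    length (A₀ q) * length (S p) ≤⟨ *-monoʳ-≤ (length (A₀ q)) (piece-large p _ refl) ⟩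
    length (A₀ q) * (2 * h * length (A₀ p)) ≡⟨ exchange (length (A₀ q)) (2 * h) (length (A₀ p)) ⟩
    2 * h * (length (A₀ q) * length (A₀ p)) ∎)
    where
    E = ∑ (A₀ q) (λ w → # (λ v → nonarc T v w) (A₀ p))
    regroup : ∀ h l e → 2 * h * (2 * h * l * e) ≡ 4 * h * h * l * e
    regroup = solve-∀
    exchange : ∀ a b c → a * (b * c) ≡ b * (a * c)
    exchange = solve-∀

  off : (p q : Fin h) → V → V → Bool
  off p q v w = not (forward T p q v w)

  sparse : ∀ p q → p ≢ q → 2 * h * (2 * Λ) * ∑ (A₀ p) (λ v → # (off p q v) (A₀ q)) ≤ length (A₀ p) * length (A₀ q)
  sparse p q ne with FP.<-cmp p q
  ... | tri≈ _ e _ = ⊥-elim (ne e)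
  ... | tri> _ _ g = ≤-trans (≤-reflexive (cong (2 * h * (2 * Λ) *_)
    (∑-cong (A₀ p) (λ {v} _ → ∑-cong (A₀ q) (λ {w} _ → cong (λ b → ⟦ not b ⟧) (forward-> T {p = p} {q} {v} {w} g)))))) (sparse₀ q p g)
  ... | tri< l _ _ = ≤-trans (≤-reflexive (cong (2 * h * (2 * Λ) *_)
    (trans (∑-cong (A₀ p) (λ {v} _ → ∑-cong (A₀ q) (λ {w} _ → cong (λ b → ⟦ not b ⟧) (forward-< T {p = p} {q} {v} {w} l)))) (∑-swap (A₀ p) (A₀ q) _))))
    (≤-trans (sparse₀ p q l) (≤-reflexive (*-comm (length (A₀ q)) _)))

  ok : (p q : Fin h) → V → Bool
  ok p q v = eqᵇ p q ∨ (2 * Λ * # (off p q v) (A₀ q) ≤ᵇ length (A₀ q))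

  good : Fin h → V → Bool
  good p v = allᵇ (λ q → ok p q v) (allFin h)

  fewNotOk : ∀ p q → 2 * h * # (λ v → not (ok p q v)) (A₀ p) ≤ length (A₀ p)
  fewNotOk p q with p FP.≟ q
  ... | yes _ = ≤-trans (≤-reflexive (trans (cong (2 * h *_) (∑-zero (A₀ p))) (*-zeroʳ (2 * h)))) z≤n
  ... | no ne = fewDense (off p q) (2 * h) (2 * Λ) (A₀ p) (A₀ q) (A₀>0 q) (sparse p q ne)

  A : Fin h → List V
  A p = filterᵇ (good p) (A₀ p)

  -- For each `q` at most a proportion `1 / 2h` of `A₀ p` is not `ok`, so the union over all `q`
  -- loses at most half.
  A-half : ∀ p → length (A₀ p) ≤ 2 * length (A p)
  A-half p = ≤-trans (halfRemains (good p) (A₀ p) (*-cancelˡ-≤ h (begin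
    h * (2 * # (not ∘ good p) (A₀ p)) ≡⟨ trans (sym (*-assoc h 2 (# (not ∘ good p) (A₀ p)))) (cong (_* # (not ∘ good p) (A₀ p)) (*-comm h 2)) ⟩
    2 * h * # (not ∘ good p) (A₀ p) ≤⟨ *-monoʳ-≤ (2 * h) (∑-mono (A₀ p) (λ {v} _ → witness v)) ⟩
    2 * h * ∑ (A₀ p) (λ v → ∑ (allFin h) (λ q → ⟦ not (ok p q v) ⟧)) ≡⟨ cong (2 * h *_) (∑-swap (A₀ p) (allFin h) _) ⟩
    2 * h * ∑ (allFin h) (λ q → # (λ v → not (ok p q v)) (A₀ p)) ≡⟨ sym (∑-*ˡ (allFin h) (2 * h) _) ⟩
    ∑ (allFin h) (λ q → 2 * h * # (λ v → not (ok p q v)) (A₀ p)) ≤⟨ ∑-bound (allFin h) (length (A₀ p)) (λ {q} _ → fewNotOk p q) ⟩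
    length (allFin h) * length (A₀ p) ≡⟨ cong (_* length (A₀ p)) (length-allFin h) ⟩
    h * length (A₀ p) ∎))) (≤-reflexive (cong (2 *_) (sym (length-filterᵇ (good p) (A₀ p)))))
    where
    witness : ∀ v → ⟦ not (good p v) ⟧ ≤ ∑ (allFin h) (λ q → ⟦ not (ok p q v) ⟧)
    witness v = ≤-trans (≤-reflexive (cong ⟦_⟧ (not-involutive _))) (⟦anyᵇ⟧≤# (λ q → not (ok p q v)) (allFin h))

  A⊆A₀ : ∀ p {x} → x ∈ A p → x ∈ A₀ p
  A⊆A₀ p i = proj₁ (∈-filterᵇ⁻ (good p) (A₀ p) i)

  A₀<n : ∀ p → length (A₀ p) < n
  A₀<n p = ≤-<-trans (unique-⊆ (A₀-unique p) (λ i → F⊆X (slot p) (slot-bound p) (piece⊆ p _ refl i))) X<n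

  frame : Frame T τ marked Λ (4 * C)
  frame = record
    { A = A
    ; A<n = λ p → ≤-<-trans (length-filterᵇ-≤ (good p) (A₀ p)) (A₀<n p)
    ; A-unique = λ p → AllPairs-filterᵇ (good p) (A₀-unique p)
    ; A-marked = λ p e → begin
        n ≤⟨ big p e ⟩
        2 * C * length (A₀ p) ≤⟨ *-monoʳ-≤ (2 * C) (A-half p) ⟩
        2 * C * (2 * length (A p)) ≡⟨ shuffle C (length (A p)) ⟩
        4 * C * length (A p) ∎
    ; A-chain = λ p e → AllPairs-filterᵇ (good p) (ch p e) , (begin
        τ ≤⟨ proj₂ (S-chain p e) ⟩
        2 * length (S p) ≤⟨ *-monoʳ-≤ 2 (≤-trans (piece-large p _ refl) (*-monoʳ-≤ (2 * h) (A-half p))) ⟩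
        2 * (2 * h * (2 * length (A p))) ≡⟨ shuffle' h (length (A p)) ⟩
        8 * h * length (A p) ∎)
    ; A-smooth = λ p q ne {v} i → *-cancelˡ-≤ 2 (begin
        2 * (Λ * # (off p q v) (A q)) ≡⟨ sym (*-assoc 2 Λ _) ⟩
        2 * Λ * # (off p q v) (A q) ≤⟨ *-monoʳ-≤ (2 * Λ) (∑-filterᵇ-≤ (good q) (A₀ q) _) ⟩
        2 * Λ * # (off p q v) (A₀ q) ≤⟨ okay p q ne (allᵇ⁻ _ (allFin h) (proj₂ (∈-filterᵇ⁻ (good p) (A₀ p) i)) (∈-allFin q)) ⟩
        length (A₀ q) ≤⟨ A-half q ⟩
        2 * length (A q) ∎)
    ; A-disjoint = λ p q ne i j → dis p q ne (A⊆A₀ p i) (A⊆A₀ q j)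
    ; A-aligned = λ p q l e i j → A₀-aligned p q l e (A⊆A₀ p i) (A⊆A₀ q j)
    }
    where
    shuffle : ∀ c x → 2 * c * (2 * x) ≡ 4 * c * x
    shuffle = solve-∀
    shuffle' : ∀ h x → 2 * (2 * h * (2 * x)) ≡ 8 * h * x
    shuffle' = solve-∀
    big : ∀ p → marked p ≡ true → n ≤ 2 * C * length (A₀ p)
    big p e = go (marked p) refl e
      where
      go : ∀ b e → b ≡ true → n ≤ 2 * C * length (piece p b e)
      go true e _ = proj₂ (S-marked p e)
    ch : ∀ p → marked p ≡ false → Chain T (A₀ p)
    ch p e = go (marked p) refl e
      where
      go : ∀ b e → b ≡ false → Chain T (piece p b e)
      go false e _ = AllPairs-chunk _ p (proj₁ (S-chain p e))
    okay : ∀ p q → p ≢ q → ∀ {v} → ok p q v ≡ true → 2 * Λ * # (off p q v) (A₀ q) ≤ length (A₀ q)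
    okay p q ne e with p FP.≟ q
    ... | yes y = ⊥-elim (ne y)
    ... | no _ = ≤ᵇ-true e
    dis : ∀ p q → p ≢ q → ∀ {v w} → v ∈ A₀ p → w ∈ A₀ q → v ≢ w
    dis p q ne i j with FP.<-cmp p q
    ... | tri< l _ _ = A₀-disjoint p q l i j
    ... | tri≈ _ e _ = ⊥-elim (ne e)
    ... | tri> _ _ g = A₀-disjoint q p g j i ∘ sym

-- Embedding H

choose4 : ∀ {h} {V : Set} {a b c d : Fin h} → a F.< b → b F.< c → c F.< d → (u v w x : V) →
  Σ (Fin h → V) λ ψ → ψ a ≡ u × ψ b ≡ v × ψ c ≡ w × ψ d ≡ x
choose4 {h} {V} {a} {b} {c} {d} ab bc cd u v w x = ψ , at-a , at-b , at-c , at-d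
  where
  ψ : Fin h → V
  ψ q = if eqᵇ q a then u else if eqᵇ q b then v else if eqᵇ q c then w else x
  differ : ∀ {p q : Fin h} → p F.< q → eqᵇ q p ≡ false
  differ l = not-¬ (λ e → FP.<-irrefl (sym (eqᵇ⇒≡ e)) l)
  at-a : ψ a ≡ u
  at-a rewrite eqᵇ-refl a = refl
  at-b : ψ b ≡ v
  at-b rewrite differ ab | eqᵇ-refl b = refl
  at-c : ψ c ≡ w
  at-c rewrite differ (FP.<-trans ab bc) | differ bc | eqᵇ-refl c = refl
  at-d : ψ d ≡ x
  at-d rewrite differ (FP.<-trans ab (FP.<-trans bc cd)) | differ (FP.<-trans bc cd) | differ cd = refl

OneOf : ∀ {h} → Fin h → Fin h → Fin h → Fin h → Fin h → Set
OneOf a b c d q = q ≡ a ⊎ q ≡ b ⊎ q ≡ c ⊎ q ≡ d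

pairs4 : ∀ {h} {a b c d : Fin h} (P : Fin h → Fin h → Set) → a F.< b → b F.< c → c F.< d →
  P a b → P a c → P a d → P b c → P b d → P c d →
  ∀ {q r} → OneOf a b c d q → OneOf a b c d r → q F.< r → P q r
pairs4 {a = a} {b} {c} {d} P ab bc cd pab pac pad pbc pbd pcd = go
  where
  wrong : ∀ {q r : Fin _} {X : Set} → r F.< q → q F.< r → X
  wrong l l' = ⊥-elim (FP.<-asym l l')
  ac = FP.<-trans ab bc
  bd = FP.<-trans bc cd
  ad = FP.<-trans ab bd
  go : ∀ {q r} → OneOf a b c d q → OneOf a b c d r → q F.< r → P q r
  go (inj₁ refl) (inj₁ refl) l = ⊥-elim (FP.<-irrefl refl l)
  go (inj₁ refl) (inj₂ (inj₁ refl)) l = pab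
  go (inj₁ refl) (inj₂ (inj₂ (inj₁ refl))) l = pac
  go (inj₁ refl) (inj₂ (inj₂ (inj₂ refl))) l = pad
  go (inj₂ (inj₁ refl)) (inj₁ refl) l = wrong ab l
  go (inj₂ (inj₁ refl)) (inj₂ (inj₁ refl)) l = ⊥-elim (FP.<-irrefl refl l)
  go (inj₂ (inj₁ refl)) (inj₂ (inj₂ (inj₁ refl))) l = pbc
  go (inj₂ (inj₁ refl)) (inj₂ (inj₂ (inj₂ refl))) l = pbd
  go (inj₂ (inj₂ (inj₁ refl))) (inj₁ refl) l = wrong ac l
  go (inj₂ (inj₂ (inj₁ refl))) (inj₂ (inj₁ refl)) l = wrong bc l
  go (inj₂ (inj₂ (inj₁ refl))) (inj₂ (inj₂ (inj₁ refl))) l = ⊥-elim (FP.<-irrefl refl l)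
  go (inj₂ (inj₂ (inj₁ refl))) (inj₂ (inj₂ (inj₂ refl))) l = pcd
  go (inj₂ (inj₂ (inj₂ refl))) (inj₁ refl) l = wrong ad l
  go (inj₂ (inj₂ (inj₂ refl))) (inj₂ (inj₁ refl)) l = wrong bd l
  go (inj₂ (inj₂ (inj₂ refl))) (inj₂ (inj₂ (inj₁ refl))) l = wrong cd l
  go (inj₂ (inj₂ (inj₂ refl))) (inj₂ (inj₂ (inj₂ refl))) l = ⊥-elim (FP.<-irrefl refl l)

-- The smoothness `128 * suc k` of the frame has two uses: here, hit sets of density at most
-- `1 / 64` after a halving; in `absorb₂`, a union bound over all positions that spares half of a
-- set.
absorb₆₄ : ∀ k {s L} → 128 * suc k * s ≤ 2 * L → 64 * s ≤ L
absorb₆₄ k {s} {L} l = *-cancelˡ-≤ 2 (begin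
  2 * (64 * s) ≡⟨ sym (*-assoc 2 64 s) ⟩
  128 * s ≤⟨ *-monoˡ-≤ s (m≤m*n 128 (suc k)) ⟩
  128 * suc k * s ≤⟨ l ⟩
  2 * L ∎)
  where open ≤-Reasoning

absorb₂ : ∀ k {s L} → 128 * suc k * s ≤ suc k * L → 2 * s ≤ L
absorb₂ k {s} {L} l = *-cancelˡ-≤ (suc k) (begin
  suc k * (2 * s) ≡⟨ trans (sym (*-assoc (suc k) 2 s)) (cong (_* s) (*-comm (suc k) 2)) ⟩
  2 * suc k * s ≤⟨ *-monoˡ-≤ s (*-monoˡ-≤ (suc k) (m≤m+n 2 126)) ⟩
  128 * suc k * s ≤⟨ l ⟩
  suc k * L ∎)
  where open ≤-Reasoning

module Galaxy {k} (H : Tournament (suc k)) (σ : Fin (suc k) → Fin (suc k)) (σ-inj : Injective _≡_ _≡_ σ)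
  (dec : FGDecomposition H σ) where

  open FGDecomposition dec public
  h = suc k

  -- Centers and boats are found by counting in sets of linear size, whereas leaves and singletons
  -- can be taken from chains.
  isMarked : Role H σ → Bool
  isMarked single = false
  isMarked leaf = false
  isMarked center = true
  isMarked boat = true

  marked : Fin h → Bool
  marked p = isMarked (role p)

  adj : Fin h → Fin h → Bool
  adj p q = arc H (σ p) (σ q)

  edge⇒adj : ∀ {p q} → p F.< q → Edge H σ p q → adj p q ≡ false
  edge⇒adj l (inj₁ (_ , e)) = Arc-asym H e
  edge⇒adj l (inj₂ (l' , _)) = ⊥-elim (FP.<-asym l l')

  edge-sym : ∀ {p q} → Edge H σ p q → Edge H σ q p
  edge-sym (inj₁ x) = inj₂ x
  edge-sym (inj₂ x) = inj₁ x

  nonedge⇒adj : ∀ {p q} → p F.< q → ¬ Edge H σ p q → adj p q ≡ true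
  nonedge⇒adj l ne = ¬Arc H (not-¬ (λ e → ne (inj₁ (l , e)))) (λ e → FP.<-irrefl (sym (σ-inj e)) l)

  -- The three consecutive vertices of a boat are all taken from the set of one of their positions;
  -- Alike expresses that this does not matter for the other classes.
  Alike : Fin h → Fin h → Set
  Alike q q' = lab q' ≡ lab q × (∀ r → lab r ≢ lab q → (r F.< q → r F.< q') × (q F.< r → q' F.< r))

  alike-refl : ∀ q → Alike q q
  alike-refl q = refl , λ r _ → (λ l → l) , (λ l → l)

  -- No position lies strictly between consecutive ones, and a position of another class differs
  -- from both, so it is on the same side of both.
  alike-pred : ∀ {q q'} → lab q' ≡ lab q → toℕ q ≡ suc (toℕ q') → Alike q q'
  alike-pred {q} {q'} e s = e , λ r ne →
    (λ l → ≤∧≢⇒< (≤-pred (≤-trans l (≤-reflexive s))) (λ eq → ne (trans (cong lab (FP.toℕ-injective eq)) e))) ,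
    (λ l → <-trans (≤-reflexive (sym s)) l)

  alike-trans : ∀ {p q r} → Alike p q → Alike q r → Alike p r
  alike-trans (e , f) (e' , f') = trans e' e , λ s ne →
    (λ l → proj₁ (f' s (λ x → ne (trans x e))) (proj₁ (f s ne) l)) ,
    (λ l → proj₂ (f' s (λ x → ne (trans x e))) (proj₂ (f s ne) l))

  -- The betweenness conditions enter here: no center of another star and no boat vertex lies
  -- between two leaves, and the own center is at an end of the star. So the leaves belong to one
  -- run of unmarked positions.
  leaves-share-slot : ∀ {p q r} → role p ≡ center → lab q ≡ lab p → lab r ≡ lab p → q ≢ p → r ≢ p → q F.< r →
    Slots.slot marked q ≡ Slots.slot marked r
  leaves-share-slot {p} {q} {r} pc lq lr q≢p r≢p q<r = Slots.slot-run marked q<r (leaf⇒unmarked ql) (leaf⇒unmarked rl) gap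
    where
    star = center-ok p pc
    ql = proj₁ (proj₁ (proj₂ star) q lq q≢p)
    rl = proj₁ (proj₁ (proj₂ star) r lr r≢p)
    leaf⇒unmarked : ∀ {s} → role s ≡ leaf → marked s ≡ false
    leaf⇒unmarked e rewrite e = refl
    outside : q F.< p → p F.< r → ⊥
    outside qp pr with proj₂ (proj₂ (proj₂ star))
    ... | inj₁ left = FP.<-asym pr (left r lr r≢p)
    ... | inj₂ right = FP.<-asym qp (right q lq q≢p)
    gap : ∀ s → q F.< s → s F.< r → marked s ≡ false
    gap s qs sr with role s in es
    ... | single = refl
    ... | leaf = refl
    ... | boat = ⊥-elim (no-boat-between s q r es ql rl (trans lq (sym lr)) (inj₁ (qs , sr)))
    ... | center with lab s ≟ lab q
    ... | no ne = ⊥-elim (no-center-between s q r es ql rl (trans lq (sym lr)) ne (inj₁ (qs , sr)))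
    ... | yes e with s FP.≟ p
    ... | yes refl = ⊥-elim (outside qs sr)
    ... | no s≢p with trans (sym es) (proj₁ (proj₁ (proj₂ star) s (trans e lq) s≢p))
    ... | ()

module Embedding {k} (H : Tournament (suc k)) (σ : Fin (suc k) → Fin (suc k)) (σ-inj : Injective _≡_ _≡_ σ)
  (dec : FGDecomposition H σ)
  {n} (T : Tournament n) (Q' c τ : ℕ)
  (her : Hereditary T (2 + Q')) (bounded : ∀ {R} → Chain T R → length R ≤ τ) (τ^Q<n : τ ^ (2 + Q') < n) (τ>0 : 0 < τ)
  (gap₂ : 16 * (4 * suc k * c) ≤ 2 ^ Q')
  (gapₐ : 4 * suc k * c * (k + 15 * suc k) ^ (2 + Q') ≤ (16 * suc k) ^ (2 + Q'))
  (c>0 : 0 < c) (n-large : 128 * c ≤ n)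
  (fr : Frame T τ (Galaxy.marked H σ σ-inj dec) (128 * suc k) c)
  where

  open Galaxy H σ σ-inj dec
  open ≤-Reasoning
  open Frame fr
  -- The successor of `k + 15 * suc k` is `16 * suc k`, the factor by which the chains in `B-chain`
  -- may fall short of `τ`.
  module K = Critical T Q' (4 * h * c) (k + 15 * suc k) τ her bounded τ^Q<n τ>0 gap₂ (≤-trans (s≤s z≤n) (m≤n+m (15 * suc k) k)) gapₐ
  V = Fin n

  4c≤Z : 2 * (2 * c) ≤ 4 * h * c
  4c≤Z = ≤-trans (≤-reflexive (sym (*-assoc 2 2 c))) (*-monoˡ-≤ c (m≤m*n 4 h))

  off : Fin h → Fin h → V → V → Bool
  off p q v w = not (forward T p q v w)

  -- A restriction will keep the candidates that are compatible with the classes embedded so far.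
  Restriction : Set
  Restriction = Fin h → V → Bool

  module _ (g : Restriction) where

    B : Fin h → List V
    B q = filterᵇ (g q) (A q)

    Roomy : Fin h → Set
    Roomy p = ∀ q → lab q ≡ lab p → length (A q) ≤ 2 * length (B q)

    Placement : Fin h → Set
    Placement p = Σ (Fin h → V) λ ψ → (∀ q → lab q ≡ lab p → Σ (Fin h) λ q' → Alike q q' × ψ q ∈ B q') ×
      (∀ {q r} → lab q ≡ lab p → lab r ≡ lab p → q F.< r → dir T (adj q r) (ψ q) (ψ r) ≡ true)

    B⊆A : ∀ {q x} → x ∈ B q → x ∈ A q
    B⊆A {q} i = proj₁ (∈-filterᵇ⁻ (g q) (A q) i)

    B<n : ∀ q → length (B q) < n
    B<n q = ≤-<-trans (length-filterᵇ-≤ (g q) (A q)) (A<n q)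

    B-unique : ∀ q → Unique (B q)
    B-unique q = AllPairs-filterᵇ (g q) (A-unique q)

    module _ (p : Fin h) (roomy : Roomy p) where

      B-marked : ∀ q → lab q ≡ lab p → marked q ≡ true → n ≤ 2 * c * length (B q)
      B-marked q lq mq = begin
        n ≤⟨ A-marked q mq ⟩
        c * length (A q) ≤⟨ *-monoʳ-≤ c (roomy q lq) ⟩
        c * (2 * length (B q)) ≡⟨ trans (sym (*-assoc c 2 _)) (cong (_* length (B q)) (*-comm c 2)) ⟩
        2 * c * length (B q) ∎

      B-chain : ∀ q → lab q ≡ lab p → marked q ≡ false → Chain T (B q) × τ ≤ 16 * h * length (B q)
      B-chain q lq mq = AllPairs-filterᵇ (g q) (proj₁ (A-chain q mq)) , (begin
        τ ≤⟨ proj₂ (A-chain q mq) ⟩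
        8 * h * length (A q) ≤⟨ *-monoʳ-≤ (8 * h) (roomy q lq) ⟩
        8 * h * (2 * length (B q)) ≡⟨ shuffle h (length (B q)) ⟩
        16 * h * length (B q) ∎)
        where
        shuffle : ∀ h x → 8 * h * (2 * x) ≡ 16 * h * x
        shuffle = solve-∀

      nonempty : ∀ {m j} → 0 < m → m ≤ j * length (B p) → Σ V λ v → v ∈ B p
      nonempty {m} {j} pos l = someElement (B p)
        (*-cancelˡ-< j 0 _ (≤-trans (s≤s (≤-reflexive (*-zeroʳ j))) (≤-trans pos l)))

      placeSingle : role p ≡ single → Placement p
      placeSingle e = (λ _ → v) ,
        (λ q lq → p , subst (λ x → Alike x p) (sym (single-ok p e q lq)) (alike-refl p) , v∈) ,
        (λ {q} {r} lq lr l → ⊥-elim (FP.<-irrefl (trans (single-ok p e q lq) (sym (single-ok p e r lr))) l))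
        where
        found = nonempty {j = 16 * h} τ>0 (proj₂ (B-chain p refl (cong isMarked e)))
        v = proj₁ found
        v∈ = proj₂ found

      module _ (pc : role p ≡ center) where

        star = center-ok p pc
        p-marked : marked p ≡ true
        p-marked = cong isMarked pc

        q-unmarked : ∀ q → lab q ≡ lab p → q ≢ p → marked q ≡ false
        q-unmarked q lq ne = cong isMarked (proj₁ (proj₁ (proj₂ star) q lq ne))

        -- Outside the star and at its center the test succeeds trivially, so it can be asked of all
        -- positions.
        serves : Fin h → V → Bool
        serves q v = (not (lab q ≡ᵇ lab p) ∨ eqᵇ q p) ∨ anyᵇ (off p q v) (B q)

        B-nonempty : 0 < length (B p)
        B-nonempty = ∈⇒nonempty (proj₂ (nonempty {j = 2 * c} K.n>0 (B-marked p refl p-marked)))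

        someBad : ∀ {s} → length (B p) ≤ length (allFin h) * s → s ≢ 0
        someBad l refl = <⇒≱ B-nonempty (≤-trans l (≤-reflexive (*-zeroʳ (length (allFin h)))))

        -- The vertices of `B p` without a backward arc to `B q` would form a large set complete to
        -- or from the chain `B q`, which `noExtension` forbids.
        noBadLeaf : ∀ q → length (B p) ≤ length (allFin h) * # (λ v → not (serves q v)) (B p) → ⊥
        noBadLeaf q many with lab q ≡ᵇ lab p in el | eqᵇ q p in ep
        ... | false | _ = someBad many (∑-zero (B p))
        ... | true | true = someBad many (∑-zero (B p))
        ... | true | false = K.noExtension {B q} {Y} (proj₂ Bq) (AllPairs-filterᵇ bad (B-unique p))
            (≤-<-trans (length-filterᵇ-≤ bad (B p)) (B<n p)) Y-large extend
          where
          lq : lab q ≡ lab p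
          lq = ≡ᵇ⇒≡ _ _ (subst IsTrue (sym el) _)
          q≢p : q ≢ p
          q≢p refl = f≢t ep (eqᵇ-refl q)
          Bq = B-chain q lq (q-unmarked q lq q≢p)
          bad : V → Bool
          bad v = not (anyᵇ (off p q v) (B q))
          Y = filterᵇ bad (B p)
          Y-large : n ≤ 4 * h * c * length Y
          Y-large = begin
            n ≤⟨ B-marked p refl p-marked ⟩
            2 * c * length (B p) ≤⟨ *-monoʳ-≤ (2 * c) many ⟩
            2 * c * (length (allFin h) * # bad (B p)) ≡⟨ cong₂ (λ x y → 2 * c * (x * y)) (length-allFin h) (sym (length-filterᵇ bad (B p))) ⟩
            2 * c * (h * length Y) ≤⟨ m≤m+n _ _ ⟩
            2 * c * (h * length Y) + 2 * c * (h * length Y) ≡⟨ shuffle c h (length Y) ⟩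
            4 * h * c * length Y ∎
            where
            shuffle : ∀ c h y → 2 * c * (h * y) + 2 * c * (h * y) ≡ 4 * h * c * y
            shuffle = solve-∀
          complete : ∀ {y w} → y ∈ Y → w ∈ B q → forward T p q y w ≡ true
          complete {y} {w} y∈ w∈ with forward T p q y w in e
          ... | true = refl
          ... | false = ⊥-elim (f≢t (trans (sym (not-involutive _)) (cong not (proj₂ (∈-filterᵇ⁻ bad (B p) y∈))))
                (anyᵇ⁺ (off p q y) w∈ (cong not e)))
          extend : ∀ {Y'} → Chain T Y' → (∀ {y} → y ∈ Y' → y ∈ Y) → length Y' + length (B q) ≤ τ
          extend {Y'} cY sub with FP.<-cmp p q
          ... | tri≈ _ e _ = ⊥-elim (q≢p (sym e))
          ... | tri< l _ _ = ≤-trans (≤-reflexive (sym (length-++ Y')))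
                (bounded (Chain-++ T cY (proj₁ Bq) (λ {y} {w} i j → trans (sym (forward-< T {p = p} {q} {y} {w} l)) (complete (sub i) j))))
          ... | tri> _ _ l = ≤-trans (≤-reflexive (trans (+-comm (length Y') _) (sym (length-++ (B q)))))
                (bounded (Chain-++ T (proj₁ Bq) cY (λ {w} {y} j i → trans (sym (forward-> T {p = p} {q} {y} {w} l)) (complete (sub i) j))))

        Hub : Set
        Hub = Σ V λ v → v ∈ B p × (∀ q → lab q ≡ lab p → q ≢ p → Σ V λ w → w ∈ B q × forward T p q v w ≡ false)

        -- If every vertex of `B p` failed at some leaf, pigeonhole would give one leaf at which a
        -- proportion `1 / h` of them fails.
        hub : Hub
        hub with anyᵇ (λ v → allᵇ (λ q → serves q v) (allFin h)) (B p) in eq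
        ... | false = ⊥-elim (let (q , _ , many) = pigeonhole (allFin h) (λ q v → not (serves q v)) (B p) B-nonempty fails
                              in noBadLeaf q many)
          where
          fails : ∀ {v} → v ∈ B p → Σ (Fin h) λ q → q ∈ allFin h × not (serves q v) ≡ true
          fails {v} i with allᵇ-fail (λ q → serves q v) (allFin h) (not-¬ (λ e → f≢t eq (anyᵇ⁺ _ i e)))
          ... | (q , m , e) = q , m , cong not e
        ... | true with anyᵇ⁻ (λ v → allᵇ (λ q → serves q v) (allFin h)) (B p) eq
        ... | (v , v∈ , all) = v , v∈ , leafOf
          where
          leafOf : ∀ q → lab q ≡ lab p → q ≢ p → Σ V λ w → w ∈ B q × forward T p q v w ≡ false
          leafOf q lq ne with lab q ≡ᵇ lab p in el | eqᵇ q p in ep | allᵇ⁻ (λ q → serves q v) (allFin h) all (∈-allFin q)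
          ... | false | _ | _ = ⊥-elim (subst IsTrue el (≡⇒≡ᵇ _ _ lq))
          ... | true | true | _ = ⊥-elim (ne (eqᵇ⇒≡ ep))
          ... | true | false | s with anyᵇ⁻ (off p q v) (B q) s
          ... | (w , w∈ , e) = w , w∈ , trans (sym (not-involutive _)) (cong not e)

        -- The leaves can be chosen independently: they come from successive pieces of one chain, so
        -- the arcs among them are forward, as in `H`.
        placeStar : Placement p
        placeStar = ψ , (λ q lq → q , alike-refl q , ψ∈ q lq) , right
          where
          v = proj₁ hub
          v∈ = proj₁ (proj₂ hub)
          leafOf = proj₂ (proj₂ hub)
          ψ : Fin h → V
          ψ q with q FP.≟ p | lab q ≟ lab p
          ... | yes _ | _ = v
          ... | no ne | yes lq = proj₁ (leafOf q lq ne)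
          ... | no _ | no _ = v
          ψ-center : ψ p ≡ v
          ψ-center with p FP.≟ p | lab p ≟ lab p
          ... | yes _ | _ = refl
          ... | no ne | _ = ⊥-elim (ne refl)
          ψ-leaf : ∀ q → lab q ≡ lab p → q ≢ p → ψ q ∈ B q × forward T p q v (ψ q) ≡ false
          ψ-leaf q lq ne with q FP.≟ p | lab q ≟ lab p
          ... | yes e | _ = ⊥-elim (ne e)
          ... | no ne' | yes lq' = proj₂ (leafOf q lq' ne')
          ... | no _ | no nl = ⊥-elim (nl lq)
          ψ∈ : ∀ q → lab q ≡ lab p → ψ q ∈ B q
          ψ∈ q lq = byCase (q FP.≟ p)
            where
            byCase : Dec (q ≡ p) → ψ q ∈ B q
            byCase (yes refl) = subst (_∈ B p) (sym ψ-center) v∈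
            byCase (no ne) = proj₁ (ψ-leaf q lq ne)
          right : ∀ {q r} → lab q ≡ lab p → lab r ≡ lab p → q F.< r → dir T (adj q r) (ψ q) (ψ r) ≡ true
          right {q} {r} lq lr l = byCase (q FP.≟ p) (r FP.≟ p)
            where
            backward : adj q r ≡ false → Arc T (ψ r) (ψ q) → dir T (adj q r) (ψ q) (ψ r) ≡ true
            backward e a = subst (λ b → dir T b (ψ q) (ψ r) ≡ true) (sym e) a
            apart : ψ q ≢ ψ r
            apart = A-disjoint q r (λ e → FP.<-irrefl e l) (B⊆A (ψ∈ q lq)) (B⊆A (ψ∈ r lr))
            byCase : Dec (q ≡ p) → Dec (r ≡ p) → dir T (adj q r) (ψ q) (ψ r) ≡ true
            byCase (yes e) (yes e') = ⊥-elim (FP.<-irrefl (trans e (sym e')) l)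
            byCase (yes refl) (no ne) = backward (edge⇒adj l (proj₂ (proj₁ (proj₂ star) r lr ne)))
              (¬Arc T (trans (cong (λ x → arc T x (ψ r)) ψ-center)
                (trans (sym (forward-< T {p = q} {r} {v} {ψ r} l)) (proj₂ (ψ-leaf r lr ne)))) apart)
            byCase (no ne) (yes refl) = backward (edge⇒adj l (edge-sym (proj₂ (proj₁ (proj₂ star) q lq ne))))
              (¬Arc T (trans (cong (arc T (ψ q)) ψ-center)
                (trans (sym (forward-> T {p = r} {q} {v} {ψ q} l)) (proj₂ (ψ-leaf q lq ne)))) apart)
            byCase (no ne) (no ne') = subst (λ b → dir T b (ψ q) (ψ r) ≡ true)
              (sym (nonedge⇒adj l (proj₁ (proj₂ (proj₂ star)) q r lq lr ne ne')))
              (A-aligned q r l (leaves-share-slot pc lq lr ne ne' l) (B⊆A (ψ∈ q lq)) (B⊆A (ψ∈ r lr)))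

      module _ (pb : role p ≡ boat) where

        B-half : ∀ q → lab q ≡ lab p → marked q ≡ true → 64 ≤ length (B q)
        B-half q lq mq = *-cancelˡ-≤ (2 * c) {{m*n≢0 2 c {{_}} {{>-nonZero c>0}}}} (begin
          2 * c * 64 ≡⟨ shuffle c ⟩
          128 * c ≤⟨ n-large ⟩
          n ≤⟨ B-marked q lq mq ⟩
          2 * c * length (B q) ∎)
          where
          shuffle : ∀ c → 2 * c * 64 ≡ 128 * c
          shuffle = solve-∀

        B-smooth : ∀ q r → q ≢ r → lab r ≡ lab p → ∀ {v} → v ∈ B q → 64 * # (off q r v) (B r) ≤ length (B r)
        B-smooth q r ne lr {v} v∈ = absorb₆₄ k {# (off q r v) (B r)} {length (B r)} (begin
          128 * h * # (off q r v) (B r) ≤⟨ *-monoʳ-≤ (128 * h) (∑-filterᵇ-≤ (g r) (A r) (λ w → ⟦ off q r v w ⟧)) ⟩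
          128 * h * # (off q r v) (A r) ≤⟨ A-smooth q r ne (B⊆A v∈) ⟩
          length (A r) ≤⟨ roomy r lr ⟩
          2 * length (B r) ∎)

        member-marked : ∀ q → lab q ≡ lab p → marked q ≡ true
        member-marked q lq with role q in e
        ... | center = refl
        ... | boat = refl
        ... | single = ⊥-elim (absurd (trans (sym e) (subst (λ x → role x ≡ boat) (single-ok q e p (sym lq)) pb)))
          where
          absurd : single ≡ boat → ⊥
          absurd ()
        ... | leaf with leaf-ok q e
        ... | (p' , p'c , l) with p FP.≟ p'
        ... | yes refl = ⊥-elim (absurd (trans (sym p'c) pb))
          where
          absurd : center ≡ boat → ⊥
          absurd ()
        ... | no ne = ⊥-elim (absurd (trans (sym (proj₁ (proj₁ (proj₂ (center-ok p' p'c)) p (sym (trans l lq)) ne))) pb))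
          where
          absurd : leaf ≡ boat → ⊥
          absurd ()

        assemble : ∀ {a b c d} → a F.< b → b F.< c → c F.< d → (∀ q → lab q ≡ lab p → OneOf a b c d q) →
          BoatEdges H σ a b c d → (ψ : Fin h → V) →
          (∀ q → OneOf a b c d q → Σ (Fin h) λ q' → Alike q q' × ψ q ∈ B q') →
          Arc T (ψ c) (ψ a) → Arc T (ψ d) (ψ a) → Arc T (ψ d) (ψ b) →
          Arc T (ψ a) (ψ b) → Arc T (ψ b) (ψ c) → Arc T (ψ c) (ψ d) → Placement p
        assemble a<b b<c c<d all (eac , ead , ebd , nab , nbc , ncd) ψ place ca da db ab bc cd =
          ψ , (λ q lq → place q (all q lq)) , λ {q} {r} lq lr → pairs4 (λ q r → dir T (adj q r) (ψ q) (ψ r) ≡ true) a<b b<c c<d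
            (ahead a<b nab ab) (behind (FP.<-trans a<b b<c) eac ca) (behind (FP.<-trans a<b (FP.<-trans b<c c<d)) ead da)
            (ahead b<c nbc bc) (behind (FP.<-trans b<c c<d) ebd db) (ahead c<d ncd cd) (all q lq) (all r lr)
          where
          ahead : ∀ {q r} → q F.< r → ¬ Edge H σ q r → Arc T (ψ q) (ψ r) → dir T (adj q r) (ψ q) (ψ r) ≡ true
          ahead {q} {r} l ne e = subst (λ b → dir T b (ψ q) (ψ r) ≡ true) (sym (nonedge⇒adj l ne)) e
          behind : ∀ {q r} → q F.< r → Edge H σ q r → Arc T (ψ r) (ψ q) → dir T (adj q r) (ψ q) (ψ r) ≡ true
          behind {q} {r} l ed e = subst (λ b → dir T b (ψ q) (ψ r) ≡ true) (sym (edge⇒adj l ed)) e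

        InClass : Fin h → Set
        InClass q = lab q ≡ lab p

        -- A cyclic triangle inside `B a` serves the three consecutive positions. Its two hit
        -- vertices take the first two and the missed one the third, so that its closing arc is the
        -- backward arc from the third to the first.
        leftBoat : ∀ {a b c d} → InClass a → InClass b → InClass c → InClass d →
          (∀ q → lab q ≡ lab p → OneOf a b c d q) → LeftBoat H σ a b c d → Placement p
        leftBoat {a} {b} {c'} {d} la lb lc ld all (b=a+1 , c=b+1 , c<d , edges) = build
          (K.boatExists (B a) (B d) (B-unique a) (B-unique d) (B<n a) (B<n d) (2 * c) 4c≤Z
            (B-marked a la (member-marked a la)) (B-marked d ld (member-marked d ld)) (B-half a la (member-marked a la))
            (arc T) sparse join)
          where
          a<b : a F.< b
          a<b = ≤-reflexive (sym b=a+1)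
          b<c : b F.< c'
          b<c = ≤-reflexive (sym c=b+1)
          a<d : a F.< d
          a<d = FP.<-trans a<b (FP.<-trans b<c c<d)
          d≢a : d ≢ a
          d≢a e = FP.<-irrefl (sym e) a<d
          sparse : ∀ {x} → x ∈ B d → 64 * # (arc T x) (B a) ≤ length (B a)
          sparse {x} x∈ = ≤-trans (*-monoʳ-≤ 64 (#-mono (B a) (λ {w} _ e → cong not
            (trans (forward-> T {p = d} {a} {x} {w} a<d) (Arc-asym T e))))) (B-smooth d a d≢a la x∈)
          join : ∀ {R Y} → Chain T R → Chain T Y → (∀ {x} → x ∈ R → x ∈ B a) → (∀ {y} → y ∈ Y → y ∈ B d) →
            (∀ {x y} → x ∈ R → y ∈ Y → arc T y x ≡ false) → length Y + length R ≤ τ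
          join {R} {Y} cR cY R⊆ Y⊆ unhit = ≤-trans (≤-reflexive (trans (+-comm (length Y) _) (sym (length-++ R))))
            (bounded (Chain-++ T cR cY (λ i j → ¬Arc T (unhit i j) (A-disjoint d a d≢a (B⊆A (Y⊆ j)) (B⊆A (R⊆ i))))))
          ba : Alike b a
          ba = alike-pred (trans la (sym lb)) b=a+1
          finish : ∀ ψ → (ψ d ∈ B d × ψ a ∈ B a × ψ b ∈ B a × ψ c' ∈ B a) →
            (Arc T (ψ a) (ψ b) × Arc T (ψ b) (ψ c') × Arc T (ψ c') (ψ a)) →
            (Arc T (ψ d) (ψ a) × Arc T (ψ d) (ψ b) × arc T (ψ d) (ψ c') ≡ false) → Placement p
          finish ψ (x∈ , u∈ , v∈ , w∈) (uv , vw , wu) (xu , xv , xw) = assemble a<b b<c c<d all edges ψ place wu xu xv uv vw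
            (¬Arc T xw (A-disjoint d a d≢a (B⊆A x∈) (B⊆A w∈)))
            where
            place : ∀ q → OneOf a b c' d q → Σ (Fin h) λ q' → Alike q q' × ψ q ∈ B q'
            place q (inj₁ refl) = a , alike-refl a , u∈
            place q (inj₂ (inj₁ refl)) = a , ba , v∈
            place q (inj₂ (inj₂ (inj₁ refl))) = a , alike-trans (alike-pred (trans lb (sym lc)) c=b+1) ba , w∈
            place q (inj₂ (inj₂ (inj₂ refl))) = d , alike-refl d , x∈
          build : (Σ V λ x → Σ V λ u → Σ V λ v → Σ V λ w → (x ∈ B d × u ∈ B a × v ∈ B a × w ∈ B a) ×
            (Arc T u v × Arc T v w × Arc T w u) × (Arc T x u × Arc T x v × arc T x w ≡ false)) → Placement p
          build (x , u , v , w , ms , arcs , hits) = choose (choose4 a<b b<c c<d u v w x)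
            where
            choose : (Σ (Fin h → V) λ ψ → ψ a ≡ u × ψ b ≡ v × ψ c' ≡ w × ψ d ≡ x) → Placement p
            choose (ψ , refl , refl , refl , refl) = finish ψ ms arcs hits

        -- The mirror image of leftBoat: the lone vertex precedes the block, and the arcs from the block to it are the hits.
        rightBoat : ∀ {a b c d} → InClass a → InClass b → InClass c → InClass d →
          (∀ q → lab q ≡ lab p → OneOf a b c d q) → RightBoat H σ a b c d → Placement p
        rightBoat {a} {b} {c'} {d} la lb lc ld all (a<b , c=b+1 , d=c+1 , edges) = build
          (K.boatExists (B b) (B a) (B-unique b) (B-unique a) (B<n b) (B<n a) (2 * c) 4c≤Z
            (B-marked b lb (member-marked b lb)) (B-marked a la (member-marked a la)) (B-half b lb (member-marked b lb))
            (λ x y → arc T y x) sparse join)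
          where
          b<c : b F.< c'
          b<c = ≤-reflexive (sym c=b+1)
          c<d : c' F.< d
          c<d = ≤-reflexive (sym d=c+1)
          a≢b : a ≢ b
          a≢b e = FP.<-irrefl e a<b
          sparse : ∀ {x} → x ∈ B a → 64 * # (λ w → arc T w x) (B b) ≤ length (B b)
          sparse {x} x∈ = ≤-trans (*-monoʳ-≤ 64 (#-mono (B b) (λ {w} _ e → cong not
            (trans (forward-< T {p = a} {b} {x} {w} a<b) (Arc-asym T e))))) (B-smooth a b a≢b lb x∈)
          join : ∀ {R Y} → Chain T R → Chain T Y → (∀ {x} → x ∈ R → x ∈ B b) → (∀ {y} → y ∈ Y → y ∈ B a) →
            (∀ {x y} → x ∈ R → y ∈ Y → arc T x y ≡ false) → length Y + length R ≤ τ
          join {R} {Y} cR cY R⊆ Y⊆ unhit = ≤-trans (≤-reflexive (sym (length-++ Y)))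
            (bounded (Chain-++ T cY cR (λ j i → ¬Arc T (unhit i j) (A-disjoint a b a≢b (B⊆A (Y⊆ j)) (B⊆A (R⊆ i)) ∘ sym))))
          cb : Alike c' b
          cb = alike-pred (trans lb (sym lc)) c=b+1
          finish : ∀ ψ → (ψ a ∈ B a × ψ c' ∈ B b × ψ d ∈ B b × ψ b ∈ B b) →
            (Arc T (ψ c') (ψ d) × Arc T (ψ d) (ψ b) × Arc T (ψ b) (ψ c')) →
            (Arc T (ψ c') (ψ a) × Arc T (ψ d) (ψ a) × arc T (ψ b) (ψ a) ≡ false) → Placement p
          finish ψ (x∈ , u∈ , v∈ , w∈) (uv , vw , wu) (ux , vx , wx) = assemble a<b b<c c<d all edges ψ place ux vx vw
            (¬Arc T wx (A-disjoint a b a≢b (B⊆A x∈) (B⊆A w∈) ∘ sym)) wu uv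
            where
            place : ∀ q → OneOf a b c' d q → Σ (Fin h) λ q' → Alike q q' × ψ q ∈ B q'
            place q (inj₁ refl) = a , alike-refl a , x∈
            place q (inj₂ (inj₁ refl)) = b , alike-refl b , w∈
            place q (inj₂ (inj₂ (inj₁ refl))) = b , cb , u∈
            place q (inj₂ (inj₂ (inj₂ refl))) = b , alike-trans (alike-pred (trans lc (sym ld)) d=c+1) cb , v∈
          build : (Σ V λ x → Σ V λ u → Σ V λ v → Σ V λ w → (x ∈ B a × u ∈ B b × v ∈ B b × w ∈ B b) ×
            (Arc T u v × Arc T v w × Arc T w u) × (Arc T u x × Arc T v x × arc T w x ≡ false)) → Placement p
          build (x , u , v , w , ms , arcs , hits) = choose (choose4 a<b b<c c<d x w u v)
            where
            choose : (Σ (Fin h → V) λ ψ → ψ a ≡ x × ψ b ≡ w × ψ c' ≡ u × ψ d ≡ v) → Placement p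
            choose (ψ , refl , refl , refl , refl) = finish ψ ms arcs hits

        placeBoat : Placement p
        placeBoat = let (a , b , c , d , (la , lb , lc , ld) , all , shape) = boat-ok p pb in
          [ leftBoat la lb lc ld all , rightBoat la lb lc ld all ]′ shape

    placeClass : ∀ p → Roomy p → Placement p
    placeClass p roomy with role p in e
    ... | single = placeSingle p roomy e
    ... | center = placeStar p roomy e
    ... | boat = placeBoat p roomy e
    ... | leaf with leaf-ok p e
    ... | (p' , pc , l) with placeStar p' (λ q lq → roomy q (trans lq l)) pc
    ... | ψ , place , right = ψ , (λ q lq → place q (trans lq (sym l))) , λ lq lr → right (trans lq (sym l)) (trans lr (sym l))

  record State : Set where
    field
      done : Fin h → Bool
      φ : Fin h → V
      closed : ∀ {p q} → done p ≡ true → lab p ≡ lab q → done q ≡ true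
      placed : ∀ p → done p ≡ true → Σ (Fin h) λ p' → Alike p p' × φ p ∈ A p'
      right : ∀ {p q} → done p ≡ true → done q ≡ true → p F.< q → dir T (adj p q) (φ p) (φ q) ≡ true

  emptyState : V → State
  emptyState v = record { done = λ _ → false ; φ = λ _ → v ; closed = λ () ; placed = λ _ () ; right = λ () }

  grow : (s : State) (p : Fin h) → Σ State λ s' → State.done s' p ≡ true × (∀ {q} → State.done s q ≡ true → State.done s' q ≡ true)
  grow s p with State.done s p in fresh
  ... | true = s , fresh , λ e → e
  ... | false = s' , doneClass p refl , old
    where
    open State s
    clash : Fin h → Fin h → V → Bool
    clash q r w = done r ∧ off r q (φ r) w
    g : Restriction
    g q w = allᵇ (λ r → not (clash q r w)) (allFin h)
    differ : ∀ {q r} → lab q ≡ lab p → done r ≡ true → lab q ≢ lab r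
    differ lq dr e = f≢t fresh (closed dr (trans (sym e) lq))
    moved : ∀ q r → lab q ≢ lab r → ∀ {r'} → Alike r r' → ∀ v w → off r q v w ≡ off r' q v w
    moved q r ne {r'} (_ , f) v w with FP.<-cmp r q
    ... | tri< l _ _ = cong not (trans (forward-< T {p = r} {q} {v} {w} l) (sym (forward-< T {p = r'} {q} {v} {w} (proj₂ (f q ne) l))))
    ... | tri≈ _ refl _ = ⊥-elim (ne refl)
    ... | tri> _ _ l = cong not (trans (forward-> T {p = r} {q} {v} {w} l) (sym (forward-> T {p = r'} {q} {v} {w} (proj₁ (f q ne) l))))
    fewClashes : ∀ q → lab q ≡ lab p → ∀ r → 128 * h * # (clash q r) (A q) ≤ length (A q)
    fewClashes q lq r with done r in dr
    ... | false = ≤-trans (≤-reflexive (trans (cong (128 * h *_) (∑-zero (A q))) (*-zeroʳ (128 * h)))) z≤n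
    ... | true = let (r' , al , i) = placed r dr in
      ≤-trans (≤-reflexive (cong (128 * h *_) (∑-cong (A q) (λ {w} _ → cong ⟦_⟧ (moved q r (differ lq dr) al (φ r) w)))))
        (A-smooth r' q (λ e → differ lq dr (trans (cong lab (sym e)) (proj₁ al))) i)
    roomy : Roomy g p
    roomy q lq = ≤-trans (halfRemains (g q) (A q) (absorb₂ k {# (not ∘ g q) (A q)} {length (A q)} (begin
      128 * h * # (not ∘ g q) (A q) ≤⟨ *-monoʳ-≤ (128 * h) (∑-mono (A q) (λ {w} _ → witness w)) ⟩
      128 * h * ∑ (A q) (λ w → ∑ (allFin h) (λ r → ⟦ clash q r w ⟧)) ≡⟨ cong (128 * h *_) (∑-swap (A q) (allFin h) _) ⟩
      128 * h * ∑ (allFin h) (λ r → # (clash q r) (A q)) ≡⟨ sym (∑-*ˡ (allFin h) (128 * h) _) ⟩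
      ∑ (allFin h) (λ r → 128 * h * # (clash q r) (A q)) ≤⟨ ∑-bound (allFin h) (length (A q)) (λ {r} _ → fewClashes q lq r) ⟩
      length (allFin h) * length (A q) ≡⟨ cong (_* length (A q)) (length-allFin h) ⟩
      h * length (A q) ∎))) (≤-reflexive (cong (2 *_) (sym (length-filterᵇ (g q) (A q)))))
      where
      witness : ∀ w → ⟦ not (g q w) ⟧ ≤ ∑ (allFin h) (λ r → ⟦ clash q r w ⟧)
      witness w = ≤-trans (≤-reflexive (cong ⟦_⟧ (not-involutive _))) (≤-trans (⟦anyᵇ⟧≤# (λ r → not (not (clash q r w))) (allFin h))
        (≤-reflexive (∑-cong (allFin h) (λ _ → cong ⟦_⟧ (not-involutive _)))))
    new = placeClass g p roomy
    ψ = proj₁ new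
    inClass : Fin h → Bool
    inClass q = lab q ≡ᵇ lab p
    inClass⇒ : ∀ {q} → inClass q ≡ true → lab q ≡ lab p
    inClass⇒ {q} e = ≡ᵇ⇒≡ _ _ (subst IsTrue (sym e) _)
    ⇒inClass : ∀ {q} → lab q ≡ lab p → inClass q ≡ true
    ⇒inClass {q} e with lab q ≡ᵇ lab p | ≡⇒≡ᵇ _ _ e
    ... | true | _ = refl
    φ' : Fin h → V
    φ' q = if inClass q then ψ q else φ q
    done' : Fin h → Bool
    done' q = inClass q ∨ done q
    doneClass : ∀ q → lab q ≡ lab p → done' q ≡ true
    doneClass q e rewrite ⇒inClass {q} e = refl
    old : ∀ {q} → done q ≡ true → done' q ≡ true
    old {q} e with inClass q
    ... | true = refl
    ... | false = e
    available : ∀ {q q' r} → lab q ≡ lab p → Alike q q' → ψ q ∈ B g q' → done r ≡ true → forward T r q (φ r) (ψ q) ≡ true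
    available {q} {q'} {r} lq (e , f) i dr = trans (sym (compare (FP.<-cmp q r)))
      (cleared dr (trans (sym (not-involutive _)) (cong not
        (allᵇ⁻ (λ r → not (clash q' r (ψ q))) (allFin h) (proj₂ (∈-filterᵇ⁻ (g q') (A q') i)) (∈-allFin r)))))
      where
      cleared : ∀ {x y} → x ≡ true → x ∧ not y ≡ false → y ≡ true
      cleared {y = true} _ _ = refl
      cleared {y = false} refl ()
      ne : lab r ≢ lab q
      ne x = differ lq dr (sym x)
      compare : _ → forward T r q' (φ r) (ψ q) ≡ forward T r q (φ r) (ψ q)
      compare (tri< l _ _) = trans (forward-> T {p = r} {q'} {φ r} {ψ q} (proj₂ (f r ne) l)) (sym (forward-> T {p = r} {q} {φ r} {ψ q} l))
      compare (tri≈ _ x _) = ⊥-elim (ne (cong lab (sym x)))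
      compare (tri> _ _ l) = trans (forward-< T {p = r} {q'} {φ r} {ψ q} (proj₁ (f r ne) l)) (sym (forward-< T {p = r} {q} {φ r} {ψ q} l))
    nonedge : ∀ {q r} → lab q ≢ lab r → ¬ Edge H σ q r
    nonedge ne e = ne (edge-inside _ _ e)
    outside : ∀ {q} → lab q ≢ lab p → inClass q ≡ false
    outside {q} ne = not-¬ (ne ∘ inClass⇒ {q})
    φ'-new : ∀ {q} → lab q ≡ lab p → φ' q ≡ ψ q
    φ'-new {q} e = cong (λ b → if b then ψ q else φ q) (⇒inClass {q} e)
    φ'-old : ∀ {q} → lab q ≢ lab p → φ' q ≡ φ q
    φ'-old {q} ne = cong (λ b → if b then ψ q else φ q) (outside {q} ne)
    wasDone : ∀ {q} → lab q ≢ lab p → done' q ≡ true → done q ≡ true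
    wasDone {q} ne = trans (cong (_∨ done q) (sym (outside {q} ne)))
    Right : Fin h → Fin h → V → V → Set
    Right q r v w = dir T (adj q r) v w ≡ true
    arcRight : ∀ {q r v w} → q F.< r → lab q ≢ lab r → Arc T v w → Right q r v w
    arcRight {v = v} {w} l ne a = subst (λ b → dir T b v w ≡ true) (sym (nonedge⇒adj l (nonedge ne))) a
    closed' : ∀ {q r} → done' q ≡ true → lab q ≡ lab r → done' r ≡ true
    closed' {q} {r} e l = byCase (lab q ≟ lab p)
      where
      byCase : Dec (lab q ≡ lab p) → done' r ≡ true
      byCase (yes c) = doneClass r (trans (sym l) c)
      byCase (no ne) = old {r} (closed (wasDone {q} ne e) l)
    placed' : ∀ q → done' q ≡ true → Σ (Fin h) λ q' → Alike q q' × φ' q ∈ A q'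
    placed' q e = byCase (lab q ≟ lab p)
      where
      byCase : Dec (lab q ≡ lab p) → Σ (Fin h) λ q' → Alike q q' × φ' q ∈ A q'
      byCase (yes c) = let (q' , al , i) = proj₁ (proj₂ new) q c in q' , al , subst (_∈ A q') (sym (φ'-new c)) (B⊆A g i)
      byCase (no ne) = let (q' , al , i) = placed q (wasDone {q} ne e) in q' , al , subst (_∈ A q') (sym (φ'-old ne)) i
    right' : ∀ {q r} → done' q ≡ true → done' r ≡ true → q F.< r → Right q r (φ' q) (φ' r)
    right' {q} {r} eq er l = byCase (lab q ≟ lab p) (lab r ≟ lab p)
      where
      newArc : ∀ {s} → lab s ≡ lab p → Σ (Fin h) λ s' → Alike s s' × ψ s ∈ B g s'
      newArc {s} = proj₁ (proj₂ new) s
      byCase : Dec (lab q ≡ lab p) → Dec (lab r ≡ lab p) → Right q r (φ' q) (φ' r)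
      byCase (yes cq) (yes cr) = subst₂ (Right q r) (sym (φ'-new cq)) (sym (φ'-new cr)) (proj₂ (proj₂ new) cq cr l)
      byCase (no nq) (no nr) = subst₂ (Right q r) (sym (φ'-old nq)) (sym (φ'-old nr)) (right (wasDone {q} nq eq) (wasDone {r} nr er) l)
      byCase (yes cq) (no nr) = let (q' , al , i) = newArc cq in
        subst₂ (Right q r) (sym (φ'-new cq)) (sym (φ'-old nr)) (arcRight l (differ cq (wasDone {r} nr er))
          (trans (sym (forward-> T {p = r} {q} {φ r} {ψ q} l)) (available cq al i (wasDone {r} nr er))))
      byCase (no nq) (yes cr) = let (r' , al , i) = newArc cr in
        subst₂ (Right q r) (sym (φ'-old nq)) (sym (φ'-new cr)) (arcRight l (differ cr (wasDone {q} nq eq) ∘ sym)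
          (trans (sym (forward-< T {p = q} {r} {φ q} {ψ r} l)) (available cr al i (wasDone {q} nq eq))))
    s' : State
    s' = record { done = done' ; φ = φ' ; closed = λ {q} {r} → closed' {q} {r} ; placed = placed' ; right = right' }

  growAll : (ps : List (Fin h)) (s : State) → Σ State λ s' → (∀ {p} → p ∈ ps → State.done s' p ≡ true) ×
    (∀ {q} → State.done s q ≡ true → State.done s' q ≡ true)
  growAll [] s = s , (λ ()) , λ e → e
  growAll (p ∷ ps) s =
    let (s₁ , e , m) = grow s p
        (s₂ , all , m') = growAll ps s₁
    in s₂ , (λ { (here refl) → m' e ; (there i) → all i }) , λ x → m' (m x)

  embedding : V → Σ (Fin h → V) λ φ → ∀ p q → p F.< q → dir T (adj p q) (φ p) (φ q) ≡ true
  embedding v = let (s , all , _) = growAll (allFin h) (emptyState v) in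
    State.φ s , λ p q → State.right s (all (∈-allFin p)) (all (∈-allFin q))

rootOf : ∀ q n → Σ ℕ λ τ → τ ^ suc q < suc n × suc n ≤ suc τ ^ suc q
rootOf q zero = 0 , s≤s z≤n , m^n>0 1 (suc q)
rootOf q (suc n) with rootOf q n
... | (τ , lo , hi) with 2 + n ≤? suc τ ^ suc q
... | yes p = τ , m<n⇒m<1+n lo , p
... | no np = suc τ , ≰⇒> np , ≤-<-trans hi (^-monoˡ-< (suc q) (n<1+n (suc τ)))

inverse : ∀ {h} (σ : Fin h → Fin h) → Injective _≡_ _≡_ σ → ∀ i → Σ (Fin h) λ p → σ p ≡ i
inverse {h} σ inj i with FP.any? (λ p → σ p FP.≟ i)
... | yes r = r
... | no nr = ⊥-elim (<⇒≱ (≤-reflexive (cong suc (sym (trans (length-map σ (allFin h)) (length-allFin h)))))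
      (Unique-length (All.tabulate (λ {x} m e → let (p , _ , e') = ∈-map⁻ σ m in nr (p , sym (trans e e'))) ∷
        UniqueP.map⁺ inj (UniqueP.allFin⁺ h))))

reorder : ∀ {h} (H : Tournament h) (σ : Fin h → Fin h) → Injective _≡_ _≡_ σ → Tournament h
reorder H σ inj = record
  { arc = λ p q → arc H (σ p) (σ q) ; irrefl = λ p → irrefl H (σ p) ; tourn = λ p q ne → tourn H _ _ (ne ∘ inj) }

contains-reorder : ∀ {n h} (T : Tournament n) (H : Tournament h) σ (inj : Injective _≡_ _≡_ σ) →
  Contains T (reorder H σ inj) → Contains T H
contains-reorder T H σ inj (f , f-inj , arcs) = f ∘ σ⁻¹ ,
  (λ {i} {j} e → trans (sym (σσ⁻¹ i)) (trans (cong σ (f-inj e)) (σσ⁻¹ j))) ,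
  (λ i j → trans (arcs (σ⁻¹ i) (σ⁻¹ j)) (cong₂ (arc H) (σσ⁻¹ i) (σσ⁻¹ j)))
  where
  σ⁻¹ = λ i → proj₁ (inverse σ inj i)
  σσ⁻¹ = λ i → proj₂ (inverse σ inj i)

twoChain : ∀ {m} (T : Tournament (2 + m)) → Σ (List (Fin (2 + m))) λ xs → Chain T xs × length xs ≡ 2
twoChain T with arc T zero (suc zero) in e
... | true = zero ∷ suc zero ∷ [] , (e ∷ []) ∷ [] ∷ [] , refl
... | false = suc zero ∷ zero ∷ [] , (¬Arc T e (λ ()) ∷ []) ∷ [] ∷ [] , refl

record Constants (k C : ℕ) : Set where
  field
    W Q' : ℕ
    W-roots : 2 * suc k ≤ W
    W-sizes : 128 * (4 * C) ≤ W
    W-tower : 2 + C ≤ W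
    W≤Q' : W ≤ Q'
    gap₂ : 16 * (4 * suc k * (4 * C)) ≤ 2 ^ Q'
    gapₐ : 4 * suc k * (4 * C) * (k + 15 * suc k) ^ (2 + Q') ≤ (16 * suc k) ^ (2 + Q')

abstract
  constants : ∀ k C → Constants k C
  constants k C = choose (128 * (4 * C)) (4 * suc k * (4 * C)) (k + 15 * suc k) ≤-refl
      (≤-trans (s≤s z≤n) (m≤n+m (15 * suc k) k)) refl refl
    where
    choose : ∀ y Z a → 128 * (4 * C) ≤ y → 0 < a → Z ≡ 4 * suc k * (4 * C) → a ≡ k + 15 * suc k → Constants k C
    choose y Z a y-large a>0 refl refl = record
      { W = W ; Q' = Q'
      ; W-roots = ≤-trans (m≤m+n (2 * suc k) y) (m≤m+n (2 * suc k + y) (2 + C))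
      ; W-sizes = ≤-trans y-large (≤-trans (m≤n+m y (2 * suc k)) (m≤m+n (2 * suc k + y) (2 + C)))
      ; W-tower = m≤n+m (2 + C) (2 * suc k + y)
      ; W≤Q' = m≤n+m W (16 * Z + a * Z)
      ; gap₂ = ≤-trans (n≤2^n (16 * Z)) (^-monoʳ-≤ 2 (≤-trans (m≤m+n (16 * Z) (a * Z)) (m≤m+n (16 * Z + a * Z) W)))
      ; gapₐ = powerGap a Z (2 + Q') a>0
          (≤-trans (m≤n+m (a * Z) (16 * Z)) (≤-trans (m≤m+n (16 * Z + a * Z) W) (m≤n+m Q' 2))) }
      where
      W Q' : ℕ
      W = 2 * suc k + y + (2 + C)
      Q' = 16 * Z + a * Z + W

module LargeChains {k} (H : Tournament (suc k)) (σ : Fin (suc k) → Fin (suc k)) (σ-inj : Injective _≡_ _≡_ σ)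
  (dec : FGDecomposition H σ) (C : ℕ) (C>0 : 0 < C)
  (towers : ∀ {n} (T : Tournament n) q → ¬ Contains T (reorder H σ σ-inj) → Hereditary T (suc q) →
    ∀ X → Unique X → length X < n → C ≤ length X →
    Tower T (suc q) X (2 + suc k * 2) C (4 * suc k * suc k * (2 * (128 * suc k))) odd)
  (cs : Constants k C) where

  open Galaxy H σ σ-inj dec using (h; marked)
  open Constants cs

  G : Tournament h
  G = reorder H σ σ-inj

  c = 4 * C
  Q = 2 + Q'

  LargeChain : ∀ {n} → Tournament n → Set
  LargeChain {n} T = Σ (List (Fin n)) λ xs → Chain T xs × n ≤ length xs ^ Q

  hereditary : ∀ {n} (T : Tournament n) → ¬ Contains T G →
    (∀ {m} → m < n → (T' : Tournament m) → ¬ Contains T' G → LargeChain T') → Hereditary T Q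
  hereditary T free rec S u S<n with rec S<n (sub T u) (sub-free T {H = G} u free)
  ... | (xs , ch , large) = map (lookup S) xs , APP.map⁺ ch ,
    (λ i → let (j , _ , e) = ∈-map⁻ (lookup S) i in subst (_∈ S) (sym e) (∈-lookup {xs = S} j)) ,
    ≤-trans large (≤-reflexive (cong (_^ Q) (sym (length-map (lookup S) xs))))

  noCritical : ∀ m (T : Tournament (suc m)) → ¬ Contains T G → Hereditary T Q → ∀ τ → τ ^ Q < suc m →
    (∀ {R} → Chain T R → length R ≤ τ) → 2 ^ W ≤ suc m → ⊥
  noCritical m T free her τ τ^Q<n bounded big = free (contains T G (proj₁ φ) (proj₂ φ))
    where
    n = suc m
    W≤n : W ≤ n
    W≤n = ≤-trans (n≤2^n W) big
    X = drop 1 (allFin n)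
    |X| : length X ≡ m
    |X| = trans (length-drop 1 (allFin n)) (cong (_∸ 1) (length-allFin n))
    2+C≤n : 2 + C ≤ n
    2+C≤n = ≤-trans W-tower W≤n
    n≤2X : n ≤ 2 * length X
    n≤2X = ≤-trans (≤-trans (+-monoˡ-≤ m (≤-pred (≤-trans (m≤m+n 2 C) 2+C≤n))) (≤-reflexive (cong (m +_) (sym (+-identityʳ m)))))
      (≤-reflexive (cong (2 *_) (sym |X|)))
    h≤τ : 2 * h ≤ τ
    h≤τ = let (xs , ch , l , _) = ramsey T (2 * h) (allFin n) (UniqueP.allFin⁺ n)
                (≤-trans (^-monoʳ-≤ 2 W-roots) (≤-trans big (≤-reflexive (sym (length-allFin n)))))
          in ≤-trans (≤-reflexive (sym l)) (bounded ch)
    τ>0 : 0 < τ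
    τ>0 = ≤-trans (s≤s z≤n) h≤τ
    module K = Critical T Q' (4 * h * c) (k + 15 * h) τ her bounded τ^Q<n τ>0 gap₂ (≤-trans (s≤s z≤n) (m≤n+m (15 * h) k)) gapₐ
    2C≤Z : 2 * C ≤ 4 * h * c
    2C≤Z = ≤-trans (*-monoˡ-≤ C (m≤m+n 2 2)) (m≤n*m c (4 * h))
    tow = towers T (suc Q') free her X (UniqueP.drop⁺ 1 (UniqueP.allFin⁺ n))
      (≤-reflexive (cong suc |X|)) (≤-trans (≤-trans (n≤1+n C) (≤-pred 2+C≤n)) (≤-reflexive (sym |X|)))
    frame : Frame T τ marked (128 * h) c
    frame = Framing.frame T Q τ marked (128 * h) C X (≤-reflexive (cong suc |X|)) n≤2X h≤τ
      (λ r l → K.halfRoot r (≤-trans l (*-monoˡ-≤ (r ^ Q) 2C≤Z))) tow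
    φ = Embedding.embedding H σ σ-inj dec T Q' c τ her bounded τ^Q<n τ>0 gap₂ gapₐ (≤-trans C>0 (m≤n*m C 4))
      (≤-trans W-sizes W≤n) frame zero

  largeChain : ∀ n (T : Tournament n) → ¬ Contains T G → LargeChain T
  largeChain = <-rec (λ n → (T : Tournament n) → ¬ Contains T G → LargeChain T) step
    where
    step : ∀ n → (∀ {m} → m < n → (T' : Tournament m) → ¬ Contains T' G → LargeChain T') →
      (T : Tournament n) → ¬ Contains T G → LargeChain T
    step 0 rec T free = [] , [] , z≤n
    step 1 rec T free = zero ∷ [] , [] ∷ [] , m^n>0 1 Q
    step n@(suc (suc m)) rec T free with 2 ^ W ≤? n
    ... | no small = let (xs , ch , l) = twoChain T in xs , ch ,
      ≤-trans (<⇒≤ (≰⇒> small)) (≤-trans (^-monoʳ-≤ 2 (≤-trans W≤Q' (m≤n+m Q' 2))) (≤-reflexive (cong (_^ Q) (sym l))))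
    ... | yes big with rootOf (suc Q') (suc m)
    ... | (τ , lo , hi) with chainOfLength? T (suc τ) (allFin n)
    ... | yes (xs , ch , l , _) = xs , ch , ≤-trans hi (≤-reflexive (cong (_^ Q) (sym l)))
    ... | no none = ⊥-elim (noCritical (suc m) T free (hereditary T free rec) τ lo bounded big)
      where
      bounded : ∀ {R} → Chain T R → length R ≤ τ
      bounded {R} ch with length R ≤? τ
      ... | yes p = p
      ... | no np = ⊥-elim (none (take (suc τ) R , APP.take⁺ (suc τ) ch ,
        trans (length-take (suc τ) R) (m≤n⇒m⊓n≡m (≰⇒> np)) , λ {x} _ → ∈-allFin x))

theorem7 : ∀ {h} (H : Tournament h) → FlotillaGalaxy H →
    Σ ℕ λ p → Σ ℕ λ q → 0 < p × 0 < q × EHWithExponent H p q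
theorem7 {zero} H _ = 1 , 1 , s≤s z≤n , s≤s z≤n , λ n T free → ⊥-elim (free ((λ ()) , (λ { {()} }) , λ ()))
theorem7 {suc k} H (σ , σ-inj , dec) = 1 , Q , s≤s z≤n , s≤s z≤n , λ n T free →
  let (xs , ch , large) = largeChain n T (free ∘ contains-reorder T H σ σ-inj)
  in length xs , ≤-trans (≤-reflexive (*-identityʳ n)) large , Chain⇒HasTransitiveSub T ch
  where
  Λ = 4 * suc k * suc k * (2 * (128 * suc k))
  C = towerCost (reorder H σ σ-inj) Λ (2 + suc k * 2)
  open LargeChains H σ σ-inj dec C (s≤s z≤n)
    (λ T q free her → tower (reorder H σ σ-inj) Λ (2 + suc k * 2) T q free her odd) (constants k C)
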